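{- For every skew shifted shape $\nu/\mu$ (that is, strict partitions $\mu\subseteq\nu$) there is a signed permutation $w$ with $G^C_w=GQ^{(\beta)}_{\nu/\mu}$.
   Context: **Signed permutations.** $W_n$ is the group of bijections $w$ of $\{ -n,\dots,-1,1,\dots,n\}$ with $w(-i)=-w(i)$; Coxeter generators $s_0=(-1\ 1)$, $s_i=(-i{ - }1\ \,{ - }i)(i\ \,i{+}1)$ for $1\le i\le n-1$. **$G^C_w$.** Let $u_0,\dots,u_{n-1}$ be noncommuting variables (commuting with $\beta$ and $x_1,x_2,\dots$) with $u_i^2=\beta u_i$, $u_1u_0u_1u_0=u_0u_1u_0u_1$, $u_iu_{i+1}u_i=u_{i+1}u_iu_{i+1}$ ($i>0$), $u_iu_j=u_ju_i$ ($|i-j|>1$). For $w\in W_n$ with reduced word $(a_1,\dots,a_\ell)$ put $u_w=u_{a_1}\cdots u_{a_\ell}$. $G^C_w$ is the coefficient of $u_w$ in $$\prod_{i\ge1}(1+x_iu_{n-1})\cdots(1+x_iu_1)(1+x_iu_0)(1+x_iu_0)(1+x_iu_1)\cdots(1+x_iu_{n-1}),$$ the product taken in order $i=1,2,\dots$ from left to right. **$GQ$.** A strict partition is $\lambda=(\lambda_1>\dots>\lambda_k>0)$, with shifted diagram $D_\lambda=\{(i,j):1\le i\le k,\ i\le j\le\lambda_i+i-1\}$; $\mu\subseteq\nu$ means $D_\mu\subseteq D_\nu$, and $D_{\nu/\mu}=D_\nu\setminus D_\mu$, $|\nu/\mu|=|D_{\nu/\mu}|$. Order $\mathbb{Z}\setminus\{0\}$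 by $\bar1\prec1\prec\bar2\prec2\prec\cdots$, where $\bar a=-a$. A shifted set-valued semistandard tableau of shape $\nu/\mu$ is a filling $T$ of $D_{\nu/\mu}$ by finite nonempty subsets of $\mathbb{Z}\setminus\{0\}$ with $\max T_{ij}\preceq\min T_{i+1,j}$, equality allowed only for negative values, and $\max T_{ij}\preceq\min T_{i,j+1}$, equality allowed only for positive values (whenever the cells exist; $\max,\min$ with respect to $\prec$). With $|T|=\sum|T_{ij}|$ and $x^T=\prod_{(i,j)}\prod_{s\in T_{ij}}x_{|s|}$, set $GQ^{(\beta)}_{\nu/\mu}=\sum_T\beta^{|T|-|\nu/\mu|}x^T$. -}

module Defs where

open import Algebra.Bundles using (Ring)
open import Data.Fin.Base as Fin using (Fin; toℕ; inject₁)
import Data.Fin.Properties as Fin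
open import Data.Fin.Permutation.Components using (transpose)
open import Data.List.Base as List
  using (List; []; _∷_; _++_; map; foldr; length; replicate; reverse; filter;
         upTo; allFin; concatMap; mapMaybe; cartesianProductWith; lookup)
open import Data.List.Membership.DecPropositional using (_∈?_)
open import Data.List.NonEmpty as List⁺ using (List⁺)
open import Data.List.Relation.Binary.Subset.Propositional using (_⊆_)
open import Data.List.Relation.Unary.All using (All)
open import Data.List.Relation.Unary.Linked using (Linked)
open import Data.Nat.Base as ℕ using (ℕ; zero; suc; _≤_; _<_; _>_; _∸_; ∣_-_∣)
import Data.Nat.Properties as ℕ
open import Data.Product.Base using (Σ-syntax; ∃-syntax; _×_; _,_; proj₁; proj₂)
open import Data.Product.Properties using (≡-dec)
open import Data.Sign.Base as Sign using (Sign; opposite)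
import Data.Sign.Properties as Sign
open import Data.Sum.Base using (_⊎_; inj₁; inj₂)
open import Data.Vec.Base as Vec using (Vec)
open import Function.Bundles using (_↔_; Inverse)
open import Level using (0ℓ)
open import Relation.Binary.Core using (Rel)
open import Relation.Binary.PropositionalEquality.Core using (_≡_)
open import Relation.Nullary.Decidable using (Dec; ¬?; _×-dec_; _→-dec_)
open import Relation.Nullary.Negation using (¬_)

------------------------------------------------------------------------
-- The set {±1,…,±n}

-- (σ , a) stands for σ·(toℕ a + 1).
±[_] : ℕ → Set
±[ n ] = Sign × Fin n

neg : ∀ {n} → ±[ n ] → ±[ n ]
neg (σ , a) = opposite σ , a

------------------------------------------------------------------------
-- Signed permutations

record SignedPerm (n : ℕ) : Set where
  field
    perm : ±[ n ] ↔ ±[ n ]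

  apply : ±[ n ] → ±[ n ]
  apply = Inverse.to perm

  field
    odd : ∀ p → apply (neg p) ≡ neg (apply p)

open SignedPerm public using (apply)

infix 4 _≗ₛ_
_≗ₛ_ : ∀ {n} → Rel (SignedPerm n) 0ℓ
v ≗ₛ w = ∀ p → apply v p ≡ apply w p

-- toℕ-value i of the index is the subscript of s.  As elements of Fin n are
-- shifted by one, s_i (i ≥ 1) exchanges the indices i - 1 and i.
s : ∀ {n} → Fin n → ±[ n ] → ±[ n ]
s Fin.zero    (σ , Fin.zero)  = opposite σ , Fin.zero
s Fin.zero    (σ , Fin.suc a) = σ , Fin.suc a
s (Fin.suc i) (σ , a)         = σ , transpose (inject₁ i) (Fin.suc i) a

-- s_{a₁} ∘ ⋯ ∘ s_{aℓ}
s-word : ∀ {n} → List (Fin n) → ±[ n ] → ±[ n ]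
s-word as p = foldr s p as

IsWord : ∀ {n} → List (Fin n) → SignedPerm n → Set
IsWord as w = ∀ p → s-word as p ≡ apply w p

IsReducedWord : ∀ {n} → List (Fin n) → SignedPerm n → Set
IsReducedWord as w = IsWord as w × (∀ bs → IsWord bs w → length as ≤ length bs)

------------------------------------------------------------------------
-- Associative unital rings given by generators and relations

infixl 6 _⊕_
infixl 7 _⊗_
infix  8 ⊖_

data Term (G : Set) : Set where
  gen     : G → Term G
  𝟘 𝟙     : Term G
  _⊕_ _⊗_ : Term G → Term G → Term G
  ⊖_      : Term G → Term G

mapTerm : ∀ {G H} → (G → H) → Term G → Term H
mapTerm f (gen g) = gen (f g)
mapTerm f 𝟘       = 𝟘
mapTerm f 𝟙       = 𝟙
mapTerm f (t ⊕ t′) = mapTerm f t ⊕ mapTerm f t′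
mapTerm f (t ⊗ t′) = mapTerm f t ⊗ mapTerm f t′
mapTerm f (⊖ t)   = ⊖ mapTerm f t

∑ ∏ : ∀ {G} → List (Term G) → Term G
∑ = foldr _⊕_ 𝟘
∏ = foldr _⊗_ 𝟙

module Presentation {G : Set} (R : Rel (Term G) 0ℓ) where

  infix 4 _≈_
  data _≈_ : Rel (Term G) 0ℓ where
    relation     : ∀ {a b} → R a b → a ≈ b
    ≈-refl       : ∀ {a} → a ≈ a
    ≈-sym        : ∀ {a b} → a ≈ b → b ≈ a
    ≈-trans      : ∀ {a b c} → a ≈ b → b ≈ c → a ≈ c
    ⊕-cong       : ∀ {a b c d} → a ≈ b → c ≈ d → a ⊕ c ≈ b ⊕ d
    ⊗-cong       : ∀ {a b c d} → a ≈ b → c ≈ d → a ⊗ c ≈ b ⊗ d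
    ⊖-cong       : ∀ {a b} → a ≈ b → ⊖ a ≈ ⊖ b
    ⊕-assoc      : ∀ a b c → (a ⊕ b) ⊕ c ≈ a ⊕ (b ⊕ c)
    ⊕-comm       : ∀ a b → a ⊕ b ≈ b ⊕ a
    ⊕-identityˡ  : ∀ a → 𝟘 ⊕ a ≈ a
    ⊕-identityʳ  : ∀ a → a ⊕ 𝟘 ≈ a
    ⊖-inverseˡ   : ∀ a → (⊖ a) ⊕ a ≈ 𝟘
    ⊖-inverseʳ   : ∀ a → a ⊕ (⊖ a) ≈ 𝟘
    ⊗-assoc      : ∀ a b c → (a ⊗ b) ⊗ c ≈ a ⊗ (b ⊗ c)
    ⊗-identityˡ  : ∀ a → 𝟙 ⊗ a ≈ a
    ⊗-identityʳ  : ∀ a → a ⊗ 𝟙 ≈ a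
    distribˡ     : ∀ a b c → a ⊗ (b ⊕ c) ≈ (a ⊗ b) ⊕ (a ⊗ c)
    distribʳ     : ∀ a b c → (b ⊕ c) ⊗ a ≈ (b ⊗ a) ⊕ (c ⊗ a)

  ring : Ring 0ℓ 0ℓ
  ring = record
    { Carrier = Term G ; _≈_ = _≈_
    ; _+_ = _⊕_ ; _*_ = _⊗_ ; -_ = ⊖_ ; 0# = 𝟘 ; 1# = 𝟙
    ; isRing = record
      { +-isAbelianGroup = record
        { isGroup = record
          { isMonoid = record
            { isSemigroup = record
              { isMagma = record
                { isEquivalence = record
                  { refl = ≈-refl ; sym = ≈-sym ; trans = ≈-trans }
                ; ∙-cong = ⊕-cong }
              ; assoc = ⊕-assoc }
            ; identity = ⊕-identityˡ , ⊕-identityʳ }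
          ; inverse = ⊖-inverseˡ , ⊖-inverseʳ
          ; ⁻¹-cong = ⊖-cong }
        ; comm = ⊕-comm }
      ; *-cong = ⊗-cong
      ; *-assoc = ⊗-assoc
      ; *-identity = ⊗-identityˡ , ⊗-identityʳ
      ; distrib = distribˡ , distribʳ
      }
    }

------------------------------------------------------------------------
-- The algebra of the u_i over ℤ[β, x₁, …, x_N]

-- Power series in x₁, x₂, … enter through their truncations
-- x_{N+1} = x_{N+2} = ⋯ = 0 for all N: a series over ℤ[β] is determined by
-- these, and those of G^C_w and GQ are polynomials.  The truncation of the
-- infinite product defining G^C_w is the product of its first N factors.

data Scalar (N : ℕ) : Set where
  `β : Scalar N
  `x : Fin N → Scalar N

-- Expressions for elements of ℤ[β, x₁, …, x_N].  They are only compared after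
-- embedding in the Hecke algebra, where the scalars are made central.
Poly : ℕ → Set
Poly N = Term (Scalar N)

HeckeGen : ℕ → ℕ → Set
HeckeGen n N = Scalar N ⊎ Fin n

Hecke : ℕ → ℕ → Set
Hecke n N = Term (HeckeGen n N)

scalar : ∀ {n N} → Poly N → Hecke n N
scalar = mapTerm inj₁

u : ∀ {n N} → Fin n → Hecke n N
u i = gen (inj₂ i)

data HeckeRel {n N : ℕ} : Rel (Hecke n N) 0ℓ where
  central : ∀ c (g : HeckeGen n N) →
            HeckeRel (gen (inj₁ c) ⊗ gen g) (gen g ⊗ gen (inj₁ c))
  quad    : ∀ i → HeckeRel (u i ⊗ u i) (scalar (gen `β) ⊗ u i)
  braid₄  : ∀ i j → toℕ i ≡ 0 → toℕ j ≡ 1 →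
            HeckeRel (u j ⊗ u i ⊗ u j ⊗ u i) (u i ⊗ u j ⊗ u i ⊗ u j)
  braid₃  : ∀ i j → toℕ i > 0 → toℕ j ≡ suc (toℕ i) →
            HeckeRel (u i ⊗ u j ⊗ u i) (u j ⊗ u i ⊗ u j)
  commute : ∀ i j → ∣ toℕ i - toℕ j ∣ > 1 →
            HeckeRel (u i ⊗ u j) (u j ⊗ u i)

module HeckeAlgebra (n N : ℕ) = Presentation (HeckeRel {n} {N})

u-word : ∀ {n N} → List (Fin n) → Hecke n N
u-word as = ∏ (map u as)

-- (1 + x_i u_{n-1}) ⋯ (1 + x_i u_0)(1 + x_i u_0) ⋯ (1 + x_i u_{n-1})
factor : ∀ n {N} → Fin N → Hecke n N
factor n i =
  ∏ (map (λ k → 𝟙 ⊕ scalar (gen (`x i)) ⊗ u k) (reverse (allFin n) ++ allFin n))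

cauchyProduct : ∀ n N → Hecke n N
cauchyProduct n N = ∏ (map (factor n) (allFin N))

-- Choosing a reduced word for each element picks out the basis element u_w.
record Basis (n : ℕ) : Set where
  field
    element : SignedPerm n
    word    : List (Fin n)
    reduced : IsReducedWord word element

open Basis public

combination : ∀ {n N} → List (Poly N × Basis n) → Hecke n N
combination = List.foldr (λ { (c , b) t → scalar c ⊗ u-word (word b) ⊕ t }) 𝟘

-- h = c·u_w + Σ c_v u_v, the sum being over v ≠ w.  The u_v form a basis of the
-- Hecke algebra over ℤ[β, x₁, …, x_N], so c is determined by h and w.
IsCoefficient : ∀ {n N} → Hecke n N → SignedPerm n → Poly N → Set
IsCoefficient {n} {N} h w c =
  Σ[ b ∈ Basis n ] element b ≗ₛ w ×
  Σ[ rest ∈ List (Poly N × Basis n) ]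
    All (λ (_ , b′) → ¬ (element b′ ≗ₛ w)) rest ×
    h ≈ combination ((c , b) ∷ rest)
  where open HeckeAlgebra n N using (_≈_)

-- G^C_w = g, where g N is the truncation of the series g to x₁, …, x_N.
IsGC : ∀ {n} → SignedPerm n → (∀ N → Poly N) → Set
IsGC {n} w g = ∀ N → IsCoefficient (cauchyProduct n N) w (g N)

------------------------------------------------------------------------
-- Shifted shapes

record StrictPartition : Set where
  field
    parts      : List ℕ
    decreasing : Linked _>_ parts
    positive   : All (_> 0) parts

open StrictPartition public using (parts)

Cell : Set
Cell = ℕ × ℕ

-- The rows i, i + 1, …, with lengths given by the list; the row i consists of
-- the cells (i , i), …, (i , l + i - 1).
rows : ℕ → List ℕ → List Cell
rows i []       = []
rows i (l ∷ ls) = map (λ k → i , i ℕ.+ k) (upTo l) ++ rows (suc i) ls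

D : StrictPartition → List Cell
D λ′ = rows 1 (parts λ′)

infix 4 _⊆ˢ_
_⊆ˢ_ : Rel StrictPartition 0ℓ
μ ⊆ˢ ν = D μ ⊆ D ν

infix 6 _∖_
_∖_ : StrictPartition → StrictPartition → List Cell
ν ∖ μ = filter (λ c → ¬? (_∈?_ (≡-dec ℕ._≟_ ℕ._≟_) c (D μ))) (D ν)

------------------------------------------------------------------------
-- Shifted set-valued tableaux with entries in {±1,…,±N}

-- The position of a letter in 1̄ ≺ 1 ≺ 2̄ ≺ 2 ≺ ⋯
rank : ∀ {N} → ±[ N ] → ℕ
rank (Sign.- , a) = 2 ℕ.* toℕ a
rank (Sign.+ , a) = suc (2 ℕ.* toℕ a)

infix 4 _⪯_
_⪯_ : ∀ {N} → Rel ±[ N ] 0ℓ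
p ⪯ q = rank p ≤ rank q

-- In ≺-increasing order.
letters : ∀ N → List ±[ N ]
letters N = concatMap (λ a → (Sign.- , a) ∷ (Sign.+ , a) ∷ []) (allFin N)

sublists : ∀ {A : Set} → List A → List (List A)
sublists []       = [] ∷ []
sublists (x ∷ xs) = map (x ∷_) (sublists xs) ++ sublists xs

-- A finite nonempty set of letters is represented by its ≺-increasing list.
Entry : ℕ → Set
Entry N = List⁺ ±[ N ]

entries : ∀ N → List (Entry N)
entries N = mapMaybe List⁺.fromList (sublists (letters N))

-- These use that entries are ≺-increasing.
minᴱ maxᴱ : ∀ {N} → Entry N → ±[ N ]
minᴱ = List⁺.head
maxᴱ = List⁺.last

vectors : ∀ {A : Set} → List A → ∀ m → List (Vec A m)
vectors as zero    = Vec.[] ∷ []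
vectors as (suc m) = cartesianProductWith Vec._∷_ as (vectors as m)

-- The k-th component is the entry in the k-th cell.
Filling : ℕ → List Cell → Set
Filling N cells = Vec (Entry N) (length cells)

-- max S ⪯ min T, with equality allowed only for letters of sign σ.
Precedes : ∀ {N} → Sign → Rel (Entry N) 0ℓ
Precedes σ S T = maxᴱ S ⪯ minᴱ T × (maxᴱ S ≡ minᴱ T → proj₁ (maxᴱ S) ≡ σ)

below right : Cell → Cell
below (i , j) = suc i , j
right (i , j) = i , suc j

IsTableau : ∀ {N} (cells : List Cell) → Filling N cells → Set
IsTableau cells T = ∀ k l →
  (lookup cells l ≡ below (lookup cells k) →
     Precedes Sign.- (Vec.lookup T k) (Vec.lookup T l)) ×
  (lookup cells l ≡ right (lookup cells k) →
     Precedes Sign.+ (Vec.lookup T k) (Vec.lookup T l))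

precedes? : ∀ {N} σ (S T : Entry N) → Dec (Precedes σ S T)
precedes? σ S T =
  (rank (maxᴱ S) ℕ.≤? rank (minᴱ T)) ×-dec
  (≡-dec Sign._≟_ Fin._≟_ (maxᴱ S) (minᴱ T) →-dec (proj₁ (maxᴱ S) Sign.≟ σ))

isTableau? : ∀ {N} (cells : List Cell) (T : Filling N cells) →
             Dec (IsTableau cells T)
isTableau? cells T = Fin.all? λ k → Fin.all? λ l →
  (≡-dec ℕ._≟_ ℕ._≟_ (lookup cells l) (below (lookup cells k)) →-dec
     precedes? Sign.- (Vec.lookup T k) (Vec.lookup T l)) ×-dec
  (≡-dec ℕ._≟_ ℕ._≟_ (lookup cells l) (right (lookup cells k)) →-dec
     precedes? Sign.+ (Vec.lookup T k) (Vec.lookup T l))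

tableaux : ∀ N (cells : List Cell) → List (Filling N cells)
tableaux N cells =
  filter (isTableau? cells) (vectors (entries N) (length cells))

content : ∀ {N m} → Vec (Entry N) m → List ±[ N ]
content T = concatMap List⁺.toList (Vec.toList T)

-- β^{|T| - |ν/μ|} x^T; here |T| ≥ |ν/μ| since entries are nonempty.
weight : ∀ {N} (cells : List Cell) → Filling N cells → Poly N
weight cells T =
  ∏ (replicate (length (content T) ∸ length cells) (gen `β)) ⊗
  ∏ (map (λ p → gen (`x (proj₂ p))) (content T))

-- GQ_{ν/μ}(x₁, …, x_N); tableaux with a letter ±a, a > N, contribute 0.
GQ : StrictPartition → StrictPartition → ∀ N → Poly N
GQ ν μ N = ∑ (map (weight (ν ∖ μ)) (tableaux N (ν ∖ μ)))

{-# OPTIONS --safe #-}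

-- Double strict partitions to partitions invariant under transposition; their boundaries are
-- lattice paths symmetric about the diagonal, and the inverse of the signed permutation w carries
-- the boundary of μ to that of ν, keeping the order of the down steps and that of the other steps.
-- Expand the product defining G^C from the right: the summands are multiples of basis elements
-- u_v, and a factor x u_k turns u_v into u_{s_k v} or, at a descent, into β u_v (this uses the exchange
-- property).  As long as no inversion foreign to w occurs, v is the element of ν/λ for some λ
-- between μ and ν, and the summand remembers a set-valued filling of ν/λ: the factor x u_k either
-- removes a corner of λ on the diagonal k and puts the letter of x into the new cell, or, giving
-- a β, adds this letter to the cell on the diagonal k that was filled last.  In all other cases
-- the factor creates an inversion that w does not have, and inversions are never lost again.  The
-- summands that end at w therefore correspond to the set-valued tableaux of shape ν/μ.

module Submission where

open import Defs
open import Data.Nat.Base using (ℕ)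
open import Data.Product.Base using (Σ-syntax)
open import Algebra.Bundles using (Ring)
import Algebra.Properties.Ring as RingProperties
open import Data.Empty using (⊥; ⊥-elim)
open import Data.Fin.Base as Fin using (Fin; toℕ; inject₁; fromℕ<)
open import Data.Fin.Permutation.Components using (transpose)
import Data.Fin.Properties as Fin
open import Data.Integer.Base using (ℤ; +_; -[1+_]; _<_; +<+; -<-; -<+)
import Data.Integer.Properties as ℤ
open import Data.List.Base as List
  using (List; []; _∷_; _++_; map; length; drop; filter; mapMaybe; concatMap; reverse; upTo; allFin)
open import Data.List.Membership.DecPropositional using (_∈?_)
open import Data.List.Membership.Propositional using (_∈_)
open import Data.List.Membership.Propositional.Properties
  using (∈-map⁺; ∈-map⁻; ∈-++⁺ˡ; ∈-++⁺ʳ; ∈-++⁻; ∈-filter⁺; ∈-filter⁻; ∈-upTo⁺; ∈-upTo⁻; ∈-lookup;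
         ∈-allFin; ∈-concatMap⁺; ∈-cartesianProductWith⁺; ∈-cartesianProductWith⁻)
open import Data.List.Membership.Propositional.Properties.WithK using (unique∧set⇒bag)
open import Data.List.NonEmpty as List⁺ using (List⁺; _∷_; toList; _∷ʳ′_)
open import Data.List.Properties
  using (map-++; map-∘; unfold-reverse; length-++; filter-accept; filter-reject)
open import Data.List.Relation.Binary.BagAndSetEquality using (∼bag⇒↭)
open import Data.List.Relation.Binary.Permutation.Propositional as ↭ using (_↭_)
open import Data.List.Relation.Unary.All as All using (All; []; _∷_)
import Data.List.Relation.Unary.All.Properties as All
open import Data.List.Relation.Unary.AllPairs as AllPairs using (AllPairs; []; _∷_)
import Data.List.Relation.Unary.AllPairs.Properties as AllPairs
open import Data.List.Relation.Unary.Any as Any using (here; there)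
import Data.List.Relation.Unary.Any.Properties as Any
open import Data.List.Relation.Unary.Linked using (Linked; []; [-]; _∷_)
open import Data.List.Relation.Unary.Unique.Propositional using (Unique)
import Data.List.Relation.Unary.Unique.Propositional.Properties as Unique
open import Data.Nat.Base as ℕ using (zero; suc; pred; _>_; _∸_; ∣_-_∣; s≤s; z≤n)
import Data.Nat.Properties as ℕ
open import Data.Product.Base using (_×_; _,_; proj₁; proj₂; ∃-syntax)
open import Data.Product.Properties using (≡-dec)
open import Data.Sign.Base as Sign using (Sign)
import Data.Sign.Properties as Sign
open import Data.Sum.Base using (_⊎_; inj₁; inj₂)
open import Data.Unit.Base using (⊤; tt)
open import Data.Vec.Base as Vec using (Vec; []; _∷_; lookup; updateAt)
open import Data.Vec.Properties
  using (lookup∘updateAt; lookup∘updateAt′; updateAt-updateAt; updateAt-id; updateAt-id-local;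
         lookup-replicate; lookup-map)
open import Function.Base using (_∘_; id; flip)
open import Function.Bundles using (mk↔ₛ′; mk⇔)
open import Relation.Binary.Definitions using (tri<; tri≈; tri>)
open import Relation.Binary.PropositionalEquality
  using (_≡_; _≢_; refl; sym; trans; cong; cong₂; subst; subst₂; ≢-sym)
import Relation.Binary.Reasoning.Setoid as Reasoning
open import Relation.Nullary using (Dec; yes; no; ¬_; ¬?; _×-dec_; _⊎-dec_)

-- Positions

-- The rule for equal letters in a tableau is the order of the factors in disguise. A right
-- neighbour lies on the next diagonal, a lower neighbour on the previous one; within the factor of
-- x the index k falls through the first half, whose letters are negative, and rises through the
-- second. So the tableau condition says that the factors used for neighbouring cells occur in the
-- order of the product.
--
-- The obstacle is that a coefficient is read off from reduced words, while every summand brings the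
-- word by which it was reached. Minimal length cannot be checked letter by letter, so summands
-- carry words in which each letter is an ascent (`Asc`). The exchange property is proved together
-- with an equation in the Hecke algebra; it shows that such words are reduced, that two of them for
-- one element v give the same u_v, and that a descent gives β.
--
-- Doubling the shape lets one generator remove a corner on or off the main diagonal alike: s_k
-- exchanges a pair of neighbouring boundary steps and the mirror image of this pair, and for k = 0
-- the two pairs coincide.

mirror : ℤ → ℤ
mirror (+ a)    = -[1+ a ]
mirror -[1+ a ] = + a

mirror-involutive : ∀ p → mirror (mirror p) ≡ p
mirror-involutive (+ a)    = refl
mirror-involutive -[1+ a ] = refl

mirror-anti : ∀ {p q} → p < q → mirror q < mirror p
mirror-anti (-<- n<m) = +<+ n<m
mirror-anti -<+       = -<+
mirror-anti (+<+ m<n) = -<- m<n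

swap : ℕ → ℕ → ℕ
swap zero    zero          = 1
swap zero    (suc zero)    = 0
swap zero    (suc (suc a)) = suc (suc a)
swap (suc i) zero          = zero
swap (suc i) (suc a)       = suc (swap i a)

swap-involutive : ∀ i a → swap i (swap i a) ≡ a
swap-involutive zero    zero          = refl
swap-involutive zero    (suc zero)    = refl
swap-involutive zero    (suc (suc a)) = refl
swap-involutive (suc i) zero          = refl
swap-involutive (suc i) (suc a)       = cong suc (swap-involutive i a)

swap-lower : ∀ i → swap i i ≡ suc i
swap-lower zero    = refl
swap-lower (suc i) = cong suc (swap-lower i)

swap-upper : ∀ i → swap i (suc i) ≡ i
swap-upper zero    = refl
swap-upper (suc i) = cong suc (swap-upper i)

swap-other : ∀ i {a} → a ≢ i → a ≢ suc i → swap i a ≡ a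
swap-other zero    {zero}        a≢i _ = ⊥-elim (a≢i refl)
swap-other zero    {suc zero}    _ a≢j = ⊥-elim (a≢j refl)
swap-other zero    {suc (suc a)} _ _   = refl
swap-other (suc i) {zero}        _ _   = refl
swap-other (suc i) {suc a} a≢i a≢j     =
  cong suc (swap-other i (a≢i ∘ cong suc) (a≢j ∘ cong suc))

swap-mono : ∀ i {a b} → a ℕ.< b → ¬ (a ≡ i × b ≡ suc i) → swap i a ℕ.< swap i b
swap-mono zero    {zero}        {suc zero}    _ ne = ⊥-elim (ne (refl , refl))
swap-mono zero    {zero}        {suc (suc b)} _ _ = s≤s (s≤s z≤n)
swap-mono zero    {suc zero}    {suc zero} (s≤s ()) _
swap-mono zero    {suc zero}    {suc (suc b)} _ _ = s≤s z≤n
swap-mono zero    {suc (suc a)} {suc zero} (s≤s ()) _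
swap-mono zero    {suc (suc a)} {suc (suc b)} lt _ = lt
swap-mono (suc i) {zero}  {suc b} _ _ = s≤s z≤n
swap-mono (suc i) {suc a} {suc b} (s≤s lt) ne =
  s≤s (swap-mono i lt λ { (refl , refl) → ne (refl , refl) })

-- The difference m - n, recursive in both arguments so that common successors cancel by
-- computation. Since `+ a` stands for a + 1, the position 0 is skipped and negation sends p to -1 -
-- p; this is the extra `suc` in `mirror-diff`.
diff : ℕ → ℕ → ℤ
diff m       zero    = + m
diff zero    (suc n) = -[1+ n ]
diff (suc m) (suc n) = diff m n

mirror-diff : ∀ m n → mirror (diff m n) ≡ diff n (suc m)
mirror-diff m       zero    = refl
mirror-diff zero    (suc n) = refl
mirror-diff (suc m) (suc n) = mirror-diff m n

diff-≡ : ∀ m n k e → m ℕ.+ e ≡ k ℕ.+ n → diff m n ≡ diff k e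
diff-≡ m zero k zero eq = cong +_ (trans (sym (ℕ.+-identityʳ m)) (trans eq (ℕ.+-identityʳ k)))
diff-≡ m zero zero (suc e) eq with trans (sym (ℕ.+-suc m e)) eq
... | ()
diff-≡ m zero (suc k) (suc e) eq =
  diff-≡ m zero k e (ℕ.suc-injective (trans (sym (ℕ.+-suc m e)) eq))
diff-≡ zero (suc n) k zero eq with trans eq (ℕ.+-suc k n)
... | ()
diff-≡ zero (suc n) zero (suc e) refl = refl
diff-≡ zero (suc n) (suc k) (suc e) eq =
  diff-≡ zero (suc n) k e (ℕ.suc-injective eq)
diff-≡ (suc m) (suc n) k e eq =
  diff-≡ m n k e (ℕ.suc-injective (trans eq (ℕ.+-suc k n)))

diff-< : ∀ m n k e → m ℕ.+ e ℕ.< k ℕ.+ n → diff m n < diff k e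
diff-< m zero k zero lt = +<+ (subst₂ ℕ._<_ (ℕ.+-identityʳ m) (ℕ.+-identityʳ k) lt)
diff-< m zero zero (suc e) lt with subst (ℕ._< zero) (ℕ.+-suc m e) lt
... | ()
diff-< m zero (suc k) (suc e) lt =
  diff-< m zero k e (ℕ.≤-pred (subst (λ l → l ℕ.< suc (k ℕ.+ zero)) (ℕ.+-suc m e) lt))
diff-< zero (suc n) k zero _ = -<+
diff-< zero (suc n) zero (suc e) lt = -<- (ℕ.≤-pred lt)
diff-< zero (suc n) (suc k) (suc e) lt = diff-< zero (suc n) k e (ℕ.≤-pred lt)
diff-< (suc m) (suc n) k e lt =
  diff-< m n k e (ℕ.≤-pred (subst (λ l → suc (m ℕ.+ e) ℕ.< l) (ℕ.+-suc k n) lt))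

diff-injective : ∀ m n k e → diff m n ≡ diff k e → m ℕ.+ e ≡ k ℕ.+ n
diff-injective m n k e eq with ℕ.<-cmp (m ℕ.+ e) (k ℕ.+ n)
... | tri< lt _ _ = ⊥-elim (ℤ.<-irrefl eq (diff-< m n k e lt))
... | tri≈ _ e′ _ = e′
... | tri> _ _ gt = ⊥-elim (ℤ.<-irrefl (sym eq) (diff-< k e m n gt))

-- The positions that s_k exchanges, besides their mirror images. As the encoding leaves no gap at
-- 0, they are neighbours in ℤ for k = 0 as well, where they stand for -1 and 1; descents at s_0 and
-- at the other generators thus share one definition.
lo hi : ℕ → ℤ
lo k = diff k 1
hi k = + k

-- The action of s_k on positions, where + a stands for a + 1 and -[1+ a ] for -(a + 1).
σ : ℕ → ℤ → ℤ
σ zero    (+ zero)     = -[1+ zero ]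
σ zero    (+ suc a)    = + suc a
σ zero    -[1+ zero ]  = + zero
σ zero    -[1+ suc a ] = -[1+ suc a ]
σ (suc i) (+ a)        = + swap i a
σ (suc i) -[1+ a ]     = -[1+ swap i a ]

σ-involutive : ∀ k p → σ k (σ k p) ≡ p
σ-involutive zero    (+ zero)     = refl
σ-involutive zero    (+ suc a)    = refl
σ-involutive zero    -[1+ zero ]  = refl
σ-involutive zero    -[1+ suc a ] = refl
σ-involutive (suc i) (+ a)        = cong +_ (swap-involutive i a)
σ-involutive (suc i) -[1+ a ]     = cong -[1+_] (swap-involutive i a)

σ-mirror : ∀ k p → σ k (mirror p) ≡ mirror (σ k p)
σ-mirror zero    (+ zero)     = refl
σ-mirror zero    (+ suc a)    = refl
σ-mirror zero    -[1+ zero ]  = refl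
σ-mirror zero    -[1+ suc a ] = refl
σ-mirror (suc i) (+ a)        = refl
σ-mirror (suc i) -[1+ a ]     = refl

σ-lo : ∀ k → σ k (lo k) ≡ hi k
σ-lo zero    = refl
σ-lo (suc i) = cong +_ (swap-lower i)

σ-hi : ∀ k → σ k (hi k) ≡ lo k
σ-hi zero    = refl
σ-hi (suc i) = cong +_ (swap-upper i)

σ-fixes-hi : ∀ j k → k ≢ j → suc k ≢ j → σ j (hi k) ≡ hi k
σ-fixes-hi zero    zero    k≢j _ = ⊥-elim (k≢j refl)
σ-fixes-hi zero    (suc k) _ _   = refl
σ-fixes-hi (suc i) k k≢j k≢i     = cong +_ (swap-other i (k≢i ∘ cong suc) k≢j)

σ-fixes-lo : ∀ j k → k ≢ j → k ≢ suc j → suc k ≢ j → σ j (lo k) ≡ lo k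
σ-fixes-lo j       (suc k) k≢j k≢ _ = σ-fixes-hi j k (k≢ ∘ cong suc) k≢j
σ-fixes-lo zero    zero k≢j _ _ = ⊥-elim (k≢j refl)
σ-fixes-lo (suc i) zero _ _ ≢j  = cong -[1+_] (swap-other i (≢j ∘ cong suc) λ ())

σ-fixes : ∀ k p → p ≢ lo k → p ≢ hi k → mirror p ≢ lo k → mirror p ≢ hi k → σ k p ≡ p
σ-fixes zero    (+ zero) _ ne _ _     = ⊥-elim (ne refl)
σ-fixes zero    (+ suc a) _ _ _ _     = refl
σ-fixes zero    -[1+ zero ] ne _ _ _  = ⊥-elim (ne refl)
σ-fixes zero    -[1+ suc a ] _ _ _ _  = refl
σ-fixes (suc i) (+ a) ≢lo ≢hi _ _     = cong +_ (swap-other i (≢lo ∘ cong +_) (≢hi ∘ cong +_))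
σ-fixes (suc i) -[1+ a ] _ _ ≢lo ≢hi  = cong -[1+_] (swap-other i (≢lo ∘ cong +_) (≢hi ∘ cong +_))

-- Only two neighbouring positions change places, together with their mirror images, so no other
-- pair can change its order. This is what makes inversions persist along ascending words.
σ-mono : ∀ k {p q} → p < q → ¬ (p ≡ lo k × q ≡ hi k) →
         ¬ (mirror q ≡ lo k × mirror p ≡ hi k) → σ k p < σ k q
σ-mono zero    {+ zero}     {+ suc b} _ _ _ = -<+
σ-mono zero    {+ zero}     {+ zero} (+<+ ()) _ _
σ-mono zero    {+ suc a}    {+ suc b} lt _ _ = lt
σ-mono zero    {+ suc a}    {+ zero} (+<+ ()) _ _
σ-mono zero    { -[1+ zero ]} {+ zero} _ ne _ = ⊥-elim (ne (refl , refl))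
σ-mono zero    { -[1+ zero ]} {+ suc b} _ _ _ = +<+ (s≤s z≤n)
σ-mono zero    { -[1+ suc a ]} {+ zero} _ _ _ = -<- (s≤s z≤n)
σ-mono zero    { -[1+ suc a ]} {+ suc b} _ _ _ = -<+
σ-mono zero    { -[1+ zero ]} { -[1+ b ]} (-<- ()) _ _
σ-mono zero    { -[1+ suc a ]} { -[1+ zero ]} _ _ _ = -<+
σ-mono zero    { -[1+ suc a ]} { -[1+ suc b ]} lt _ _ = lt
σ-mono (suc i) {+ a}        {+ b} (+<+ lt) ne _ =
  +<+ (swap-mono i lt λ { (refl , refl) → ne (refl , refl) })
σ-mono (suc i) { -[1+ a ]} {+ b} _ _ _ = -<+
σ-mono (suc i) { -[1+ a ]} { -[1+ b ]} (-<- lt) _ ne =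
  -<- (swap-mono i lt λ { (refl , refl) → ne (refl , refl) })

lo<hi : ∀ k → lo k < hi k
lo<hi zero = -<+
lo<hi (suc k) = +<+ (ℕ.n<1+n k)

swap-commute : ∀ {i j} → suc i ℕ.< j → ∀ a → swap i (swap j a) ≡ swap j (swap i a)
swap-commute {zero}  {suc (suc j)} _ zero          = refl
swap-commute {zero}  {suc (suc j)} _ (suc zero)    = refl
swap-commute {zero}  {suc (suc j)} _ (suc (suc a)) = refl
swap-commute {suc i} {suc j} (s≤s lt) zero         = refl
swap-commute {suc i} {suc j} (s≤s lt) (suc a)      = cong suc (swap-commute lt a)
swap-commute {zero}  {suc zero} (s≤s ()) _

swap-braid : ∀ i a → swap i (swap (suc i) (swap i a)) ≡ swap (suc i) (swap i (swap (suc i) a))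
swap-braid zero    zero                = refl
swap-braid zero    (suc zero)          = refl
swap-braid zero    (suc (suc zero))    = refl
swap-braid zero    (suc (suc (suc a))) = refl
swap-braid (suc i) zero                = refl
swap-braid (suc i) (suc a)             = cong suc (swap-braid i a)

σ-commute : ∀ {i j} → suc i ℕ.< j → ∀ p → σ i (σ j p) ≡ σ j (σ i p)
σ-commute {zero}  {suc (suc j)} _ (+ zero)     = refl
σ-commute {zero}  {suc (suc j)} _ (+ suc a)    = refl
σ-commute {zero}  {suc (suc j)} _ -[1+ zero ]  = refl
σ-commute {zero}  {suc (suc j)} _ -[1+ suc a ] = refl
σ-commute {zero}  {suc zero} (s≤s ()) _
σ-commute {suc i} {suc j} (s≤s lt) (+ a)       = cong +_ (swap-commute lt a)
σ-commute {suc i} {suc j} (s≤s lt) -[1+ a ]    = cong -[1+_] (swap-commute lt a)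

σ-braid₃ : ∀ i p → let j = suc i; k = suc j in σ j (σ k (σ j p)) ≡ σ k (σ j (σ k p))
σ-braid₃ i (+ a)    = cong +_ (swap-braid i a)
σ-braid₃ i -[1+ a ] = cong -[1+_] (swap-braid i a)

σ-braid₄ : ∀ p → σ 1 (σ 0 (σ 1 (σ 0 p))) ≡ σ 0 (σ 1 (σ 0 (σ 1 p)))
σ-braid₄ (+ zero)           = refl
σ-braid₄ (+ suc zero)       = refl
σ-braid₄ (+ suc (suc a))    = refl
σ-braid₄ -[1+ zero ]        = refl
σ-braid₄ -[1+ suc zero ]    = refl
σ-braid₄ -[1+ suc (suc a) ] = refl

-- Descents and the exchange property

Increases Decreases : (ℤ → ℤ) → ℕ → Set
Increases f k = f (lo k) < f (hi k)
Decreases f k = f (hi k) < f (lo k)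

Odd : (ℤ → ℤ) → Set
Odd f = ∀ p → f (mirror p) ≡ mirror (f p)

Injective : (ℤ → ℤ) → Set
Injective f = ∀ {p q} → f p ≡ f q → p ≡ q

at : ∀ (f : ℤ → ℤ) {p p′ q q′} → p ≡ p′ → q ≡ q′ → f p < f q → f p′ < f q′
at f refl refl lt = lt

-- The Coxeter diagram: the subscript of an edge is the order of the product of its two generators,
-- and up or down is the direction in which the edge is traversed.
data Bond : ℕ → ℕ → Set where
  bond-far   : ∀ {j k} → ∣ j - k ∣ > 1 → Bond j k
  bond-up₃   : ∀ {i} → Bond (suc i) (suc (suc i))
  bond-down₃ : ∀ {i} → Bond (suc (suc i)) (suc i)
  bond-up₄   : Bond 0 1
  bond-down₄ : Bond 1 0

bond : ∀ j k → j ≢ k → Bond j k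
bond zero          zero          ne = ⊥-elim (ne refl)
bond zero          (suc zero)    _  = bond-up₄
bond zero          (suc (suc k)) _  = bond-far (s≤s (s≤s z≤n))
bond (suc zero)    zero          _  = bond-down₄
bond (suc (suc j)) zero          _  = bond-far (s≤s (s≤s z≤n))
bond (suc j)       (suc k)       ne with bond j k (ne ∘ cong suc)
... | bond-far gt = bond-far gt
... | bond-up₃    = bond-up₃
... | bond-down₃  = bond-down₃
-- Raising both indices by one moves the edge of order 4, which occurs only at the end of the
-- diagram, to an edge of order 3.
... | bond-up₄    = bond-up₃
... | bond-down₄  = bond-down₃

far⇒≢ : ∀ j k → ∣ j - k ∣ > 1 → k ≢ j × suc k ≢ j × k ≢ suc j
far⇒≢ zero          zero          ()
far⇒≢ zero          (suc zero)    (s≤s ())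
far⇒≢ zero          (suc (suc k)) _  = (λ ()) , (λ ()) , λ ()
far⇒≢ (suc zero)    zero          (s≤s ())
far⇒≢ (suc (suc j)) zero          _  = (λ ()) , (λ ()) , λ ()
far⇒≢ (suc j)       (suc k)       gt with a , b , c ← far⇒≢ j k gt =
  a ∘ ℕ.suc-injective , b ∘ ℕ.suc-injective , c ∘ ℕ.suc-injective

σ-far : ∀ {j k} → ∣ j - k ∣ > 1 → ∀ p → σ j (σ k p) ≡ σ k (σ j p)
σ-far {j} {k} gt p with ℕ.<-cmp j k | far⇒≢ j k gt
... | tri< lt _ _ | _ , _ , k≢ = σ-commute (ℕ.≤∧≢⇒< lt (≢-sym k≢)) p
... | tri≈ _ eq _ | k≢ , _ , _ = ⊥-elim (k≢ (sym eq))
... | tri> _ _ gt | _ , ≢j , _ = sym (σ-commute (ℕ.≤∧≢⇒< gt ≢j) p)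

-- Positions of the window i + 1, i + 2, i + 3, permuted by s_{i+1} and s_{i+2} as 0, 1, 2 are by
-- the two adjacent transpositions.
module Window (i : ℕ) where

  pos : ℕ → ℤ
  pos x = + (x ℕ.+ i)

  swap-window₀ : ∀ x → swap i (x ℕ.+ i) ≡ swap 0 x ℕ.+ i
  swap-window₀ zero          = swap-lower i
  swap-window₀ (suc zero)    = swap-upper i
  swap-window₀ (suc (suc x)) = swap-other i
    (≢-sym (ℕ.m≢1+n+m i)) (≢-sym (ℕ.m≢1+n+m i) ∘ ℕ.suc-injective)

  swap-window₁ : ∀ x → swap (suc i) (x ℕ.+ i) ≡ swap 1 x ℕ.+ i
  swap-window₁ zero    = swap-other (suc i) (≢-sym ℕ.1+n≢n) (ℕ.m≢1+n+m i)
  swap-window₁ (suc x) = cong suc (swap-window₀ x)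

  along : List ℕ → ℤ → ℤ
  along []      p = p
  along (g ∷ w) p = along w (σ (suc (g ℕ.+ i)) p)

  track : List ℕ → ℕ → ℕ
  track []      x = x
  track (g ∷ w) x = track w (swap g x)

  -- For words in these two letters `track` evaluates on numerals, so inequalities between values of
  -- f composed with several `σ` reduce to inequalities between the three values of f on the window.
  data Small : List ℕ → Set where
    []  : Small []
    0∷_ : ∀ {w} → Small w → Small (0 ∷ w)
    1∷_ : ∀ {w} → Small w → Small (1 ∷ w)

  along-track : ∀ {w} → Small w → ∀ x → along w (pos x) ≡ pos (track w x)
  along-track []     x = refl
  along-track (0∷_ {w} s) x =
    trans (cong (along w ∘ +_) (swap-window₀ x)) (along-track s (swap 0 x))
  along-track (1∷_ {w} s) x =
    trans (cong (along w ∘ +_) (swap-window₁ x)) (along-track s (swap 1 x))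

  windowed : ∀ {w} → Small w → ∀ (f : ℤ → ℤ) x y →
             f (pos (track w x)) < f (pos (track w y)) → f (along w (pos x)) < f (along w (pos y))
  windowed s f x y = at f (sym (along-track s x)) (sym (along-track s y))

  windowed⁻ : ∀ {w} → Small w → ∀ (f : ℤ → ℤ) x y →
              f (along w (pos x)) < f (along w (pos y)) → f (pos (track w x)) < f (pos (track w y))
  windowed⁻ s f x y = at f (along-track s x) (along-track s y)

-- Descents of f ∘ σ j at j and k force the descents met when the longest element of the
-- dihedral group generated by s_j and s_k is split off.
record Split₃ (j k : ℕ) (f : ℤ → ℤ) : Set where
  field
    down₁ : Decreases f k
    down₂ : Decreases (f ∘ σ k) j
    inc₀  : Increases (f ∘ σ k ∘ σ j) k
    inc₁  : Increases (f ∘ σ k ∘ σ j ∘ σ k) j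
    inc₂  : Increases (f ∘ σ k ∘ σ j ∘ σ k ∘ σ j) k

-- Let a, b, c be the values of f on the window. The hypotheses read a < b and c < a, so the order c
-- < a < b is known completely and each field compares two of these values. In `split₃-down` the
-- order is b < c < a.
split₃-up : ∀ {i} f → let j = suc i; k = suc j in
            Increases f j → Decreases (f ∘ σ j) k → Split₃ j k f
split₃-up {i} f inc dec = record
  { down₁ = ℤ.<-trans c<a inc
  ; down₂ = windowed (1∷ []) f 1 0 c<a
  ; inc₀  = windowed (0∷ 1∷ []) f 1 2 inc
  ; inc₁  = windowed (1∷ 0∷ 1∷ []) f 0 1 (ℤ.<-trans c<a inc)
  ; inc₂  = windowed (0∷ 1∷ 0∷ 1∷ []) f 1 2 c<a
  }
  where
  open Window i
  c<a : f (pos 2) < f (pos 0)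
  c<a = windowed⁻ (0∷ []) f 2 1 dec

split₃-down : ∀ {i} f → let k = suc i; j = suc k in
              Increases f j → Decreases (f ∘ σ j) k → Split₃ j k f
split₃-down {i} f inc dec = record
  { down₁ = ℤ.<-trans inc c<a
  ; down₂ = windowed (0∷ []) f 2 1 c<a
  ; inc₀  = windowed (1∷ 0∷ []) f 0 1 inc
  ; inc₁  = windowed (0∷ 1∷ 0∷ []) f 1 2 (ℤ.<-trans inc c<a)
  ; inc₂  = windowed (1∷ 0∷ 1∷ 0∷ []) f 0 1 c<a
  }
  where
  open Window i
  c<a : f (pos 2) < f (pos 0)
  c<a = windowed⁻ (1∷ []) f 1 0 dec

record Split₄ (j k : ℕ) (f : ℤ → ℤ) : Set where
  field
    down₁ : Decreases f k
    down₂ : Decreases (f ∘ σ k) j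
    down₃ : Decreases (f ∘ σ k ∘ σ j) k
    inc₀  : Increases (f ∘ σ k ∘ σ j ∘ σ k) j
    inc₁  : Increases (f ∘ σ k ∘ σ j ∘ σ k ∘ σ j) k
    inc₂  : Increases (f ∘ σ k ∘ σ j ∘ σ k ∘ σ j ∘ σ k) j
    inc₃  : Increases (f ∘ σ k ∘ σ j ∘ σ k ∘ σ j ∘ σ k ∘ σ j) k

-- Let a, b, c be the values of f at -1, 1, 2 and c̄ the value at -2. The hypotheses give c < a < b,
-- and oddness turns c < a into b < c̄, so all four values are ordered. In `split₄-down` the order
-- is b < c < c̄ < a.
split₄-up : ∀ f → Odd f → Increases f 0 → Decreases (f ∘ σ 0) 1 → Split₄ 0 1 f
split₄-up f odd a<b c<a = record
  { down₁ = ℤ.<-trans c<a a<b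
  ; down₂ = ℤ.<-trans c<a (ℤ.<-trans a<b b<c̄)
  ; down₃ = b<c̄
  ; inc₀  = a<b
  ; inc₁  = ℤ.<-trans a<b b<c̄
  ; inc₂  = ℤ.<-trans c<a (ℤ.<-trans a<b b<c̄)
  ; inc₃  = c<a
  }
  where
  b<c̄ : f (+ 0) < f -[1+ 1 ]
  b<c̄ = subst₂ _<_ (sym (odd -[1+ 0 ])) (sym (odd (+ 1))) (mirror-anti c<a)

split₄-down : ∀ f → Odd f → Increases f 1 → Decreases (f ∘ σ 1) 0 → Split₄ 1 0 f
split₄-down f odd b<c c<c̄ = record
  { down₁ = ℤ.<-trans b<c (ℤ.<-trans c<c̄ c̄<a)
  ; down₂ = ℤ.<-trans c<c̄ c̄<a
  ; down₃ = c<c̄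
  ; inc₀  = c̄<a
  ; inc₁  = ℤ.<-trans b<c (ℤ.<-trans c<c̄ c̄<a)
  ; inc₂  = ℤ.<-trans b<c c<c̄
  ; inc₃  = c<c̄
  }
  where
  c̄<a : f -[1+ 1 ] < f -[1+ 0 ]
  c̄<a = subst₂ _<_ (sym (odd (+ 1))) (sym (odd (+ 0))) (mirror-anti b<c)

Adjacent₃ Adjacent₄ : ℕ → ℕ → Set
Adjacent₃ j k = (j > 0 × k ≡ suc j) ⊎ (k > 0 × j ≡ suc k)
Adjacent₄ j k = (j ≡ 0 × k ≡ 1) ⊎ (k ≡ 0 × j ≡ 1)

data Dihedral (j k : ℕ) : Set where
  order₂ : ∣ j - k ∣ > 1 → Dihedral j k
  order₃ : Adjacent₃ j k →
           (∀ f → Increases f j → Decreases (f ∘ σ j) k → Split₃ j k f) → Dihedral j k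
  order₄ : Adjacent₄ j k →
           (∀ f → Odd f → Increases f j → Decreases (f ∘ σ j) k → Split₄ j k f) → Dihedral j k

dihedral : ∀ j k → j ≢ k → Dihedral j k
dihedral j k j≢k with bond j k j≢k
... | bond-far gt = order₂ gt
... | bond-up₃    = order₃ (inj₁ (s≤s z≤n , refl)) split₃-up
... | bond-down₃  = order₃ (inj₂ (s≤s z≤n , refl)) split₃-down
... | bond-up₄    = order₄ (inj₁ (refl , refl)) split₄-up
... | bond-down₄  = order₄ (inj₂ (refl , refl)) split₄-down

σ-adjacent₃ : ∀ {j k} → Adjacent₃ j k → ∀ p → σ j (σ k (σ j p)) ≡ σ k (σ j (σ k p))
σ-adjacent₃ {suc i} (inj₁ (_ , refl)) p = σ-braid₃ i p
σ-adjacent₃ {k = suc i} (inj₂ (_ , refl)) p = sym (σ-braid₃ i p)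

σ-adjacent₄ : ∀ {j k} → Adjacent₄ j k → ∀ p →
              σ k (σ j (σ k (σ j p))) ≡ σ j (σ k (σ j (σ k p)))
σ-adjacent₄ (inj₁ (refl , refl)) p = σ-braid₄ p
σ-adjacent₄ (inj₂ (refl , refl)) p = sym (σ-braid₄ p)

module Words (n : ℕ) where

  Word : Set
  Word = List (Fin n)

  -- The inverse of the signed permutation with the given word.
  act : Word → ℤ → ℤ
  act []      p = p
  act (k ∷ r) p = act r (σ (toℕ k) p)

  act-odd : ∀ r → Odd (act r)
  act-odd []      p = refl
  act-odd (k ∷ r) p = trans (cong (act r) (σ-mirror (toℕ k) p)) (act-odd r _)

  act-injective : ∀ r → Injective (act r)
  act-injective []      eq = eq
  act-injective (k ∷ r) {p} {q} eq =
    trans (sym (σ-involutive (toℕ k) p))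
      (trans (cong (σ (toℕ k)) (act-injective r eq)) (σ-involutive (toℕ k) q))

  -- Prefixing s_k lengthens an element exactly if its inverse increases at k. This local form of
  -- reducedness stands in for minimal length, which is recovered in `Asc⇒minimal`.
  Asc : Word → Set
  Asc []      = ⊤
  Asc (k ∷ r) = Increases (act r) (toℕ k) × Asc r

-- Exchange property in the Hecke algebra

module Exchange (n N : ℕ) where

  open HeckeAlgebra n N
  open Words n public

  infix 4 _∼_
  -- The consequences of braid equivalence, kept instead of a chain of braid moves. Ascents are
  -- recorded for the target only, since the source is a word already known to be ascending.
  record _∼_ (r r′ : Word) : Set where
    constructor mk∼
    field
      right-Asc     : Asc r′
      act≗    : ∀ p → act r p ≡ act r′ p
      length≡ : length r ≡ length r′
      u≈      : u-word r ≈ u-word r′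
  open _∼_ public

  ∼-refl : ∀ {r} → Asc r → r ∼ r
  ∼-refl a = mk∼ a (λ _ → refl) refl ≈-refl

  ∼-trans : ∀ {r s t} → r ∼ s → s ∼ t → r ∼ t
  ∼-trans a b = mk∼ (right-Asc b) (λ p → trans (act≗ a p) (act≗ b p))
    (trans (length≡ a) (length≡ b)) (≈-trans (u≈ a) (u≈ b))

  ∼-cons : ∀ {r s} k → Increases (act r) (toℕ k) → r ∼ s → (k ∷ r) ∼ (k ∷ s)
  ∼-cons k up a = mk∼
    (subst₂ _<_ (act≗ a _) (act≗ a _) up , right-Asc a)
    (λ p → act≗ a _) (cong suc (length≡ a)) (⊗-cong ≈-refl (u≈ a))

  open Reasoning (Ring.setoid ring)

  u-commute : ∀ {j k} r → ∣ toℕ j - toℕ k ∣ > 1 → u-word (j ∷ k ∷ r) ≈ u-word (k ∷ j ∷ r)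
  u-commute {j} {k} r gt = begin
    u j ⊗ (u k ⊗ u-word r) ≈⟨ ⊗-assoc _ _ _ ⟨
    (u j ⊗ u k) ⊗ u-word r ≈⟨ ⊗-cong (relation (commute j k gt)) ≈-refl ⟩
    (u k ⊗ u j) ⊗ u-word r ≈⟨ ⊗-assoc _ _ _ ⟩
    u k ⊗ (u j ⊗ u-word r) ∎

  ⊗-assoc₃ : ∀ a b c d → a ⊗ (b ⊗ (c ⊗ d)) ≈ a ⊗ b ⊗ c ⊗ d
  ⊗-assoc₃ a b c d = ≈-trans (≈-sym (⊗-assoc a b (c ⊗ d))) (≈-sym (⊗-assoc (a ⊗ b) c d))

  ⊗-assoc₄ : ∀ a b c d e → a ⊗ (b ⊗ (c ⊗ (d ⊗ e))) ≈ a ⊗ b ⊗ c ⊗ d ⊗ e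
  ⊗-assoc₄ a b c d e = ≈-trans (⊗-assoc₃ a b c (d ⊗ e)) (≈-sym (⊗-assoc (a ⊗ b ⊗ c) d e))

  u-adjacent₃ : ∀ {j k} r → Adjacent₃ (toℕ j) (toℕ k) →
                u-word (j ∷ k ∷ j ∷ r) ≈ u-word (k ∷ j ∷ k ∷ r)
  u-adjacent₃ {j} {k} r adj = begin
    u j ⊗ (u k ⊗ (u j ⊗ u-word r)) ≈⟨ ⊗-assoc₃ _ _ _ _ ⟩
    u j ⊗ u k ⊗ u j ⊗ u-word r     ≈⟨ ⊗-cong (braid adj) ≈-refl ⟩
    u k ⊗ u j ⊗ u k ⊗ u-word r     ≈⟨ ⊗-assoc₃ _ _ _ _ ⟨
    u k ⊗ (u j ⊗ (u k ⊗ u-word r)) ∎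
    where
    braid : Adjacent₃ (toℕ j) (toℕ k) → u j ⊗ u k ⊗ u j ≈ u k ⊗ u j ⊗ u k
    braid (inj₁ (pos , eq)) = relation (braid₃ j k pos eq)
    braid (inj₂ (pos , eq)) = ≈-sym (relation (braid₃ k j pos eq))

  u-adjacent₄ : ∀ {j k} r → Adjacent₄ (toℕ j) (toℕ k) →
                u-word (j ∷ k ∷ j ∷ k ∷ r) ≈ u-word (k ∷ j ∷ k ∷ j ∷ r)
  u-adjacent₄ {j} {k} r adj = begin
    u j ⊗ (u k ⊗ (u j ⊗ (u k ⊗ u-word r))) ≈⟨ ⊗-assoc₄ _ _ _ _ _ ⟩
    u j ⊗ u k ⊗ u j ⊗ u k ⊗ u-word r       ≈⟨ ⊗-cong (braid adj) ≈-refl ⟩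
    u k ⊗ u j ⊗ u k ⊗ u j ⊗ u-word r       ≈⟨ ⊗-assoc₄ _ _ _ _ _ ⟨
    u k ⊗ (u j ⊗ (u k ⊗ (u j ⊗ u-word r))) ∎
    where
    braid : Adjacent₄ (toℕ j) (toℕ k) → u j ⊗ u k ⊗ u j ⊗ u k ≈ u k ⊗ u j ⊗ u k ⊗ u j
    braid (inj₁ (j≡0 , k≡1)) = ≈-sym (relation (braid₄ j k j≡0 k≡1))
    braid (inj₂ (k≡0 , j≡1)) = relation (braid₄ k j k≡0 j≡1)

  act-tail : ∀ {r k r′} → r ∼ (k ∷ r′) → ∀ p → act r′ p ≡ act r (σ (toℕ k) p)
  act-tail {k = k} {r′} a p =
    trans (cong (act r′) (sym (σ-involutive (toℕ k) p))) (sym (act≗ a _))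

  private
    along : ∀ {f g : ℤ → ℤ} {p q} → (∀ x → g x ≡ f x) → f p < f q → g p < g q
    along eq = subst₂ _<_ (sym (eq _)) (sym (eq _))

    tail-≤ : ∀ {m r k r′} → length r ℕ.≤ m → r ∼ (k ∷ r′) → length r′ ℕ.≤ m
    tail-≤ le a = ℕ.≤-trans (ℕ.n≤1+n _) (subst (ℕ._≤ _) (length≡ a) le)

    -- If the first letter j differs from k, both are descents of the whole word, so the longest
    -- element of the dihedral group generated by s_j and s_k can be split off: its other letters
    -- come out of the tail by induction, and one braid relation brings k to the front. The
    -- induction is on the bound m because it is also applied to words that are only equivalent to
    -- tails.
    exchange-bounded : ∀ m r k → length r ℕ.≤ m → Asc r → Decreases (act r) (toℕ k) →
                       ∃[ r′ ] r ∼ (k ∷ r′)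
    exchange-bounded m [] k _ _ dec = ⊥-elim (ℤ.<-asym dec (lo<hi (toℕ k)))
    exchange-bounded (suc m) (j ∷ r) k (s≤s le) (inc , a) dec with j Fin.≟ k
    ... | yes refl = r , ∼-refl (inc , a)
    ... | no j≢k with dihedral (toℕ j) (toℕ k) (j≢k ∘ Fin.toℕ-injective)
    ... | order₂ gt = j ∷ r₁ , ∼-trans (∼-cons j inc r∼)
          (mk∼ ( at (act r₁) (sym (σ-fixes-lo J K k≢j k≢ ≢j)) (sym (σ-fixes-hi J K k≢j ≢j))
                   (proj₁ (right-Asc r∼))
               , along (act-tail r∼) (at (act r) (sym (σ-fixes-lo K J (≢-sym k≢j) (≢-sym ≢j) (≢-sym k≢)))
                   (sym (σ-fixes-hi K J (≢-sym k≢j) (≢-sym k≢))) inc)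
               , proj₂ (right-Asc r∼))
            (λ p → cong (act r₁) (sym (σ-far gt p))) refl (u-commute r₁ gt))
      where
      J = toℕ j
      K = toℕ k
      k≢j = proj₁ (far⇒≢ J K gt)
      ≢j = proj₁ (proj₂ (far⇒≢ J K gt))
      k≢ = proj₂ (proj₂ (far⇒≢ J K gt))
      step = exchange-bounded m r k le a
        (at (act r) (σ-fixes-hi J K k≢j ≢j) (σ-fixes-lo J K k≢j k≢ ≢j) dec)
      r₁ = proj₁ step
      r∼ = proj₂ step
    -- The tail is equivalent to k, j, `r₂`, hence the word to j, k, j, `r₂`, which the braid
    -- relation turns into k, j, k, `r₂`.
    ... | order₃ adj split = j ∷ k ∷ r₂ ,
          ∼-trans (∼-cons j inc r∼) (∼-trans (∼-cons j inc′ (∼-cons k (proj₁ (right-Asc r∼)) r₁∼))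
          (mk∼ (along eq₂ inc₂ , along eq₂ inc₁ , along eq₂ inc₀ , proj₂ (right-Asc r₁∼))
            (λ p → cong (act r₂) (σ-adjacent₃ adj p)) refl (u-adjacent₃ r₂ adj)))
      where
      open Split₃ (split (act r) inc dec)
      step₁ = exchange-bounded m r k le a down₁
      r₁ = proj₁ step₁
      r∼ = proj₂ step₁
      inc′ = along (λ x → sym (act≗ r∼ x)) inc
      step₂ = exchange-bounded m r₁ j (tail-≤ le r∼) (proj₂ (right-Asc r∼)) (along (act-tail r∼) down₂)
      r₂ = proj₁ step₂
      r₁∼ = proj₂ step₂
      eq₂ : ∀ x → act r₂ x ≡ act r (σ (toℕ k) (σ (toℕ j) x))
      eq₂ x = trans (act-tail r₁∼ x) (act-tail r∼ _)
    ... | order₄ adj split = j ∷ k ∷ j ∷ r₃ ,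
          ∼-trans (∼-cons j inc r∼) (∼-trans (∼-cons j inc′ (∼-cons k (proj₁ (right-Asc r∼))
            (∼-trans r₁∼ (∼-cons j (proj₁ (right-Asc r₁∼)) r₂∼))))
          (mk∼ (along eq₃ inc₃ , along eq₃ inc₂ , along eq₃ inc₁ , along eq₃ inc₀ , proj₂ (right-Asc r₂∼))
            (λ p → cong (act r₃) (σ-adjacent₄ adj p)) refl (u-adjacent₄ r₃ adj)))
      where
      open Split₄ (split (act r) (act-odd r) inc dec)
      step₁ = exchange-bounded m r k le a down₁
      r₁ = proj₁ step₁
      r∼ = proj₂ step₁
      inc′ = along (λ x → sym (act≗ r∼ x)) inc
      r₁≤ = tail-≤ le r∼
      step₂ = exchange-bounded m r₁ j r₁≤ (proj₂ (right-Asc r∼)) (along (act-tail r∼) down₂)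
      r₂ = proj₁ step₂
      r₁∼ = proj₂ step₂
      eq₂ : ∀ x → act r₂ x ≡ act r (σ (toℕ k) (σ (toℕ j) x))
      eq₂ x = trans (act-tail r₁∼ x) (act-tail r∼ _)
      step₃ = exchange-bounded m r₂ k (tail-≤ r₁≤ r₁∼) (proj₂ (right-Asc r₁∼)) (along eq₂ down₃)
      r₃ = proj₁ step₃
      r₂∼ = proj₂ step₃
      eq₃ : ∀ x → act r₃ x ≡ act r (σ (toℕ k) (σ (toℕ j) (σ (toℕ k) x)))
      eq₃ x = trans (act-tail r₂∼ x) (eq₂ _)

  exchange : ∀ r k → Asc r → Decreases (act r) (toℕ k) → ∃[ r′ ] r ∼ (k ∷ r′)
  exchange r k = exchange-bounded (length r) r k ℕ.≤-refl

-- Words and signed permutations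

position : ∀ {n} → ±[ n ] → ℤ
position (Sign.+ , a) = + toℕ a
position (Sign.- , a) = -[1+ toℕ a ]

position-injective : ∀ {n} {p q : ±[ n ]} → position p ≡ position q → p ≡ q
position-injective {p = Sign.+ , _} {Sign.+ , _} eq =
  cong (Sign.+ ,_) (Fin.toℕ-injective (ℤ.+-injective eq))
position-injective {p = Sign.- , _} {Sign.- , _} eq =
  cong (Sign.- ,_) (Fin.toℕ-injective (ℤ.-[1+-injective eq))
position-injective {p = Sign.+ , _} {Sign.- , _} ()
position-injective {p = Sign.- , _} {Sign.+ , _} ()

position-neg : ∀ {n} (p : ±[ n ]) → position (neg p) ≡ mirror (position p)
position-neg (Sign.+ , _) = refl
position-neg (Sign.- , _) = refl

toℕ-transpose : ∀ {n} (i : Fin n) a →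
                toℕ (transpose (inject₁ i) (Fin.suc i) a) ≡ swap (toℕ i) (toℕ a)
toℕ-transpose i a with a Fin.≟ inject₁ i
... | yes refl = sym (trans (cong (swap (toℕ i)) (Fin.toℕ-inject₁ i)) (swap-lower (toℕ i)))
... | no a≢i with a Fin.≟ Fin.suc i
...   | yes refl = trans (Fin.toℕ-inject₁ i) (sym (swap-upper (toℕ i)))
...   | no a≢si = sym (swap-other (toℕ i)
          (λ eq → a≢i (Fin.toℕ-injective (trans eq (sym (Fin.toℕ-inject₁ i)))))
          (a≢si ∘ Fin.toℕ-injective))

position-s : ∀ {n} (k : Fin n) p → position (s k p) ≡ σ (toℕ k) (position p)
position-s Fin.zero    (Sign.+ , Fin.zero)  = refl
position-s Fin.zero    (Sign.- , Fin.zero)  = refl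
position-s Fin.zero    (Sign.+ , Fin.suc a) = refl
position-s Fin.zero    (Sign.- , Fin.suc a) = refl
position-s (Fin.suc i) (Sign.+ , a)         = cong +_ (toℕ-transpose i a)
position-s (Fin.suc i) (Sign.- , a)         = cong -[1+_] (toℕ-transpose i a)

s-involutive : ∀ {n} (k : Fin n) p → s k (s k p) ≡ p
s-involutive k p = position-injective (trans (position-s k (s k p))
  (trans (cong (σ (toℕ k)) (position-s k p)) (σ-involutive (toℕ k) _)))

s-odd : ∀ {n} (k : Fin n) p → s k (neg p) ≡ neg (s k p)
s-odd k p = position-injective (trans (position-s k (neg p))
  (trans (cong (σ (toℕ k)) (position-neg p)) (trans (σ-mirror (toℕ k) _)
    (trans (cong mirror (sym (position-s k p))) (sym (position-neg (s k p)))))))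

InRange : ℕ → ℤ → Set
InRange n p = Σ[ q ∈ ±[ n ] ] position q ≡ p

inRange? : ∀ n p → Dec (InRange n p)
inRange? n (+ a) with a ℕ.<? n
... | yes a<n = yes ((Sign.+ , fromℕ< a<n) , cong +_ (Fin.toℕ-fromℕ< a<n))
... | no a≮n  = no λ { ((Sign.+ , b) , refl) → a≮n (Fin.toℕ<n b) ; ((Sign.- , _) , ()) }
inRange? n -[1+ a ] with a ℕ.<? n
... | yes a<n = yes ((Sign.- , fromℕ< a<n) , cong -[1+_] (Fin.toℕ-fromℕ< a<n))
... | no a≮n  = no λ { ((Sign.- , b) , refl) → a≮n (Fin.toℕ<n b) ; ((Sign.+ , _) , ()) }

σ-beyond : ∀ {n} (k : Fin n) p → ¬ InRange n p → σ (toℕ k) p ≡ p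
σ-beyond {n} k p out = σ-fixes (toℕ k) p
  (≢lo p out) (≢hi p out) (≢lo (mirror p) mirror-out) (≢hi (mirror p) mirror-out)
  where
  mirror-out : ¬ InRange n (mirror p)
  mirror-out (q , eq) = out (neg q ,
    trans (position-neg q) (trans (cong mirror eq) (mirror-involutive p)))
  ≢hi : ∀ p → ¬ InRange n p → p ≢ hi (toℕ k)
  ≢hi _ out refl = out ((Sign.+ , k) , refl)
  lo∈ : ∀ {n} (k : Fin n) → InRange n (lo (toℕ k))
  lo∈ Fin.zero    = (Sign.- , Fin.zero) , refl
  lo∈ (Fin.suc k) = (Sign.+ , inject₁ k) , cong +_ (Fin.toℕ-inject₁ k)
  ≢lo : ∀ p → ¬ InRange n p → p ≢ lo (toℕ k)
  ≢lo _ out refl = out (lo∈ k)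

module SignedWords (n : ℕ) where

  open Words n

  s-word⁻¹ : Word → ±[ n ] → ±[ n ]
  s-word⁻¹ []      p = p
  s-word⁻¹ (k ∷ r) p = s-word⁻¹ r (s k p)

  position-s-word⁻¹ : ∀ r p → position (s-word⁻¹ r p) ≡ act r (position p)
  position-s-word⁻¹ []      p = refl
  position-s-word⁻¹ (k ∷ r) p =
    trans (position-s-word⁻¹ r (s k p)) (cong (act r) (position-s k p))

  s-word-inverseˡ : ∀ r p → s-word r (s-word⁻¹ r p) ≡ p
  s-word-inverseˡ []      p = refl
  s-word-inverseˡ (k ∷ r) p = trans (cong (s k) (s-word-inverseˡ r (s k p))) (s-involutive k p)

  s-word-inverseʳ : ∀ r p → s-word⁻¹ r (s-word r p) ≡ p
  s-word-inverseʳ []      p = refl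
  s-word-inverseʳ (k ∷ r) p =
    trans (cong (s-word⁻¹ r) (s-involutive k (s-word r p))) (s-word-inverseʳ r p)

  s-word-odd : ∀ (r : Word) p → s-word r (neg p) ≡ neg (s-word r p)
  s-word-odd []      p = refl
  s-word-odd (k ∷ r) p = trans (cong (s k) (s-word-odd r p)) (s-odd k (s-word r p))

  signedPerm : Word → SignedPerm n
  signedPerm r = record
    { perm = mk↔ₛ′ (s-word r) (s-word⁻¹ r) (s-word-inverseˡ r) (s-word-inverseʳ r)
    ; odd = s-word-odd r }

  act-beyond : ∀ r p → ¬ InRange n p → act r p ≡ p
  act-beyond []      p _   = refl
  act-beyond (k ∷ r) p out = trans (cong (act r) (σ-beyond k p out)) (act-beyond r p out)

  -- Words act on all of ℤ, but the hypothesis concerns only the range of n. Beyond it every word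
  -- acts trivially, because both positions exchanged by a generator lie in the range.
  s-word⇒act : ∀ r r′ → (∀ p → s-word r p ≡ s-word r′ p) → ∀ p → act r p ≡ act r′ p
  s-word⇒act r r′ eq p with inRange? n p
  ... | no out = trans (act-beyond r p out) (sym (act-beyond r′ p out))
  ... | yes (q , refl) = trans (sym (position-s-word⁻¹ r q)) (trans (cong position q≡) (position-s-word⁻¹ r′ q))
    where
    q≡ : s-word⁻¹ r q ≡ s-word⁻¹ r′ q
    q≡ = trans (cong (s-word⁻¹ r) (sym (trans (eq _) (s-word-inverseˡ r′ q))))
      (s-word-inverseʳ r (s-word⁻¹ r′ q))

  increases? : ∀ r k → Increases (act r) k ⊎ Decreases (act r) k
  increases? r k with ℤ.<-cmp (act r (lo k)) (act r (hi k))
  ... | tri< lt _ _ = inj₁ lt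
  ... | tri≈ _ eq _ = ⊥-elim (ℤ.<-irrefl (act-injective r eq) (lo<hi k))
  ... | tri> _ _ gt = inj₂ gt

-- Reducedness of ascending words

module WordProperties (n N : ℕ) where

  open Exchange n N public
  open SignedWords n public
  open HeckeAlgebra n N

  -- A form of Matsumoto's theorem. The first letter of `r′` is a descent of r too, since both act
  -- alike; exchange moves it to the front of r, and the tails remain. A nonempty ascending word
  -- cannot act as the identity because it has a descent.
  Asc⇒∼ : ∀ r r′ → Asc r → Asc r′ → (∀ p → act r p ≡ act r′ p) → r ∼ r′
  Asc⇒∼ []      []       _ _ _ = ∼-refl tt
  Asc⇒∼ (k ∷ r) []       (inc , _) _ eq = ⊥-elim (ℤ.<-asym (lo<hi (toℕ k))
    (subst₂ _<_ (trans (cong (act r) (sym (σ-hi (toℕ k)))) (eq _))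
                (trans (cong (act r) (sym (σ-lo (toℕ k)))) (eq _)) inc))
  Asc⇒∼ r (k ∷ r′) a (inc , a′) eq with r₁ , r∼ ← exchange r k a
      (subst₂ _<_ (trans (cong (act r′) (sym (σ-hi (toℕ k)))) (sym (eq _)))
                  (trans (cong (act r′) (sym (σ-lo (toℕ k)))) (sym (eq _))) inc) =
    ∼-trans r∼ (∼-cons k (proj₁ (right-Asc r∼)) (Asc⇒∼ r₁ r′ (proj₂ (right-Asc r∼)) a′
      λ p → trans (act-tail r∼ p) (trans (eq _) (cong (act r′) (σ-involutive (toℕ k) p)))))

  -- A letter that is not an ascent cancels against the equal letter that exchange brings to the
  -- front. Any word can thus be compared in length with an ascending one.
  ascend : ∀ r → ∃[ r′ ] Asc r′ × (∀ p → act r p ≡ act r′ p) × length r′ ℕ.≤ length r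
  ascend []      = [] , tt , (λ _ → refl) , z≤n
  ascend (k ∷ r) with r′ , a , eq , le ← ascend r with increases? r′ (toℕ k)
  ... | inj₁ inc = k ∷ r′ , (inc , a) , (λ p → eq _) , s≤s le
  ... | inj₂ dec with r₁ , r∼ ← exchange r′ k a dec =
    r₁ , proj₂ (right-Asc r∼) , (λ p → trans (eq _) (sym (act-tail r∼ p))) ,
    ℕ.≤-trans (ℕ.n≤1+n _) (ℕ.≤-trans (subst (ℕ._≤ _) (length≡ r∼) le) (ℕ.n≤1+n _))

  Asc⇒minimal : ∀ r r′ → Asc r → (∀ p → s-word r′ p ≡ s-word r p) → length r ℕ.≤ length r′
  Asc⇒minimal r r′ a eq with r″ , a″ , eq″ , le ← ascend r′ =
    subst (ℕ._≤ length r′)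
      (length≡ (Asc⇒∼ r″ r a″ a λ p → trans (sym (eq″ p)) (s-word⇒act r′ r eq p))) le

  basis : ∀ r → Asc r → Basis n
  basis r a = record
    { element = signedPerm r ; word = r ; reduced = (λ _ → refl) , λ r′ → Asc⇒minimal r r′ a }

  u-decreases : ∀ r k → Asc r → Decreases (act r) (toℕ k) →
                u k ⊗ u-word r ≈ scalar (gen `β) ⊗ u-word r
  u-decreases r k a dec with r′ , r∼ ← exchange r k a dec = begin
    u k ⊗ u-word r                          ≈⟨ ⊗-cong ≈-refl (u≈ r∼) ⟩
    u k ⊗ (u k ⊗ u-word r′)                 ≈⟨ ⊗-assoc _ _ _ ⟨
    (u k ⊗ u k) ⊗ u-word r′                 ≈⟨ ⊗-cong (relation (quad k)) ≈-refl ⟩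
    (scalar (gen `β) ⊗ u k) ⊗ u-word r′     ≈⟨ ⊗-assoc _ _ _ ⟩
    scalar (gen `β) ⊗ (u k ⊗ u-word r′)     ≈⟨ ⊗-cong ≈-refl (u≈ r∼) ⟨
    scalar (gen `β) ⊗ u-word r              ∎
    where open Reasoning (Ring.setoid ring)

-- Shifted shapes as symmetric partitions

-- A shifted shape, doubled to a partition invariant under transposition: row i has the cells
-- (i , j) with j < R i, rows and columns being numbered from 0.
Shape : (ℕ → ℕ) → Set
Shape R = ∀ {i j} → j ℕ.< R i → i ℕ.< R j

-- Read from the top, the boundary of the shape has its i-th down step at the position E R i;
-- its other steps are at the mirror images.
E : (ℕ → ℕ) → ℕ → ℤ
E R i = diff (R i) (suc i)

mirror-E : ∀ R i → mirror (E R i) ≡ diff i (R i)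
mirror-E R i = mirror-diff (R i) (suc i)

module _ {R : ℕ → ℕ} (shape : Shape R) where

  outside : ∀ {i j} → R i ℕ.≤ j → R j ℕ.≤ i
  outside le = ℕ.≮⇒≥ λ lt → ℕ.<⇒≱ (shape lt) le

  -- Rows are initial segments by definition and columns by symmetry, which already makes the shape
  -- a partition.
  Shape-antitone : ∀ {i i′} → i ℕ.≤ i′ → R i′ ℕ.≤ R i
  Shape-antitone le = ℕ.≮⇒≥ λ lt → ℕ.<-irrefl refl (shape (ℕ.≤-<-trans le (shape lt)))

  E-antitone : ∀ {i j} → i ℕ.< j → E R j < E R i
  E-antitone {i} {j} i<j =
    diff-< (R j) (suc j) (R i) (suc i) (ℕ.+-mono-≤-< (Shape-antitone (ℕ.<⇒≤ i<j)) (s≤s i<j))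

  E-inside : ∀ {i j} → j ℕ.< R i → mirror (E R j) < E R i
  E-inside {i} {j} lt = subst (_< E R i) (sym (mirror-E R j))
    (diff-< j (R j) (R i) (suc i) (ℕ.+-mono-<-≤ lt (shape lt)))

  E-outside : ∀ {i j} → R i ℕ.≤ j → E R i < mirror (E R j)
  E-outside {i} {j} le = subst (E R i <_) (sym (mirror-E R j))
    (diff-< (R i) (suc i) j (R j) (ℕ.+-mono-≤-< le (s≤s (outside le))))

  E-injective : ∀ {i j} → E R i ≡ E R j → i ≡ j
  E-injective {i} {j} eq with ℕ.<-cmp i j
  ... | tri< lt _ _ = ⊥-elim (ℤ.<-irrefl (sym eq) (E-antitone lt))
  ... | tri≈ _ e _  = e
  ... | tri> _ _ gt = ⊥-elim (ℤ.<-irrefl eq (E-antitone gt))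

  E-≢-mirror : ∀ i j → E R i ≢ mirror (E R j)
  E-≢-mirror i j eq with j ℕ.<? R i
  ... | yes lt = ℤ.<-irrefl (sym eq) (E-inside lt)
  ... | no ≮   = ℤ.<-irrefl eq (E-outside (ℕ.≮⇒≥ ≮))

  -- The search finds a row whose down step is at or before the given position while that of the row
  -- above is after it. If the down step misses the position, the step there belongs to a column
  -- that ends just above this row, and mirrors the down step with the index of that column.
  E-cover : ∀ k e → ∃[ i ] (E R i ≡ diff k e ⊎ mirror (E R i) ≡ diff k e)
  E-cover k e = search (R 0 ℕ.+ e) (ℕ.≤-trans
      (ℕ.+-monoˡ-≤ e (Shape-antitone {0} z≤n))
      (ℕ.≤-trans (ℕ.n≤1+n _) (ℕ.m≤n+m _ k)))
    where
    search : ∀ i → R i ℕ.+ e ℕ.≤ k ℕ.+ suc i → ∃[ i ] (E R i ≡ diff k e ⊎ mirror (E R i) ≡ diff k e)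

    boundary : ∀ i → R i ℕ.+ e ℕ.≤ k ℕ.+ suc i → (∀ i′ → i ≡ suc i′ → k ℕ.+ i ℕ.< R i′ ℕ.+ e) →
               ∃[ i ] (E R i ≡ diff k e ⊎ mirror (E R i) ≡ diff k e)
    boundary i le least with ℕ.m≤n⇒m<n∨m≡n le
    ... | inj₂ eq = i , inj₁ (diff-≡ (R i) (suc i) k e eq)
    ... | inj₁ lt = j , inj₂ (trans (mirror-E R j) (diff-≡ j (R j) k e (trans j+e (cong (k ℕ.+_) (sym Rj≡i)))))
      where
      le′ : R i ℕ.+ e ℕ.≤ k ℕ.+ i
      le′ = ℕ.≤-pred (subst (suc (R i ℕ.+ e) ℕ.≤_) (ℕ.+-suc k i) lt)
      -- The column j has its step at j - `R j`, so this is the only choice with `R j` equal to i.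
      j = k ℕ.+ i ∸ e
      j+e : j ℕ.+ e ≡ k ℕ.+ i
      j+e = ℕ.m∸n+n≡m (ℕ.≤-trans (ℕ.m≤n+m e (R i)) le′)
      i≤ : ∀ i → (∀ i′ → i ≡ suc i′ → k ℕ.+ i ℕ.< R i′ ℕ.+ e) → j ℕ.+ e ≡ k ℕ.+ i → i ℕ.≤ R j
      i≤ zero    _ _ = z≤n
      i≤ (suc i′) least eq =
        shape (ℕ.+-cancelʳ-< e _ _ (subst (ℕ._< R i′ ℕ.+ e) (sym eq) (least i′ refl)))
      Rj≡i : R j ≡ i
      Rj≡i = ℕ.≤-antisym (outside (ℕ.+-cancelʳ-≤ e _ _ (subst (R i ℕ.+ e ℕ.≤_) (sym j+e) le′)))
        (i≤ i least j+e)

    search zero    le = boundary zero le λ _ ()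
    search (suc i) le with R i ℕ.+ e ℕ.≤? k ℕ.+ suc i
    ... | yes le′ = search i le′
    ... | no ≰    = boundary (suc i) le λ { _ refl → ℕ.≰⇒> ≰ }

-- These concern the cell (a , b) together with its mirror image; a = b is a cell on the main
-- diagonal. A pivot is a place where the boundary has a corner, of either kind.
Removable Addable Pivot : (ℕ → ℕ) → ℕ → ℕ → Set
Removable R a b = R a ≡ suc b × R b ≡ suc a
Addable   R a b = R a ≡ b × R b ≡ a
Pivot     R a b = Removable R a b ⊎ Addable R a b

Pivot? : ∀ R a b → Dec (Pivot R a b)
Pivot? R a b = (R a ℕ.≟ suc b ×-dec R b ℕ.≟ suc a) ⊎-dec (R a ℕ.≟ b ×-dec R b ℕ.≟ a)

module _ {R : ℕ → ℕ} (shape : Shape R) where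

  private
    Pivot-≮ : ∀ {k a a′} → Pivot R a (k ℕ.+ a) → Pivot R a′ (k ℕ.+ a′) → ¬ a ℕ.< a′
    Pivot-≮ {k} {a} {a′} p p′ a<a′ = conclude p p′
      where
      b<b′ : k ℕ.+ a ℕ.< k ℕ.+ a′
      b<b′ = ℕ.+-monoʳ-< k a<a′
      Ra′≤Ra : R a′ ℕ.≤ R a
      Ra′≤Ra = Shape-antitone shape (ℕ.<⇒≤ a<a′)
      conclude : Pivot R a (k ℕ.+ a) → Pivot R a′ (k ℕ.+ a′) → ⊥
      conclude (inj₂ (Ra , _)) (inj₁ (Ra′ , _)) = ℕ.<⇒≱ b<b′ (ℕ.≤-trans (ℕ.n≤1+n _) (subst₂ ℕ._≤_ Ra′ Ra Ra′≤Ra))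
      conclude (inj₂ (Ra , _)) (inj₂ (Ra′ , _)) = ℕ.<⇒≱ b<b′ (subst₂ ℕ._≤_ Ra′ Ra Ra′≤Ra)
      conclude (inj₁ (Ra , _)) (inj₁ (Ra′ , _)) = ℕ.<⇒≱ b<b′ (ℕ.≤-pred (subst₂ ℕ._≤_ Ra′ Ra Ra′≤Ra))
      conclude (inj₁ (Ra , Rb)) (inj₂ (Ra′ , _)) =
        ℕ.<-irrefl refl (ℕ.<-≤-trans (shape (subst (k ℕ.+ a ℕ.<_) (sym Ra′) b<b′))
          (subst (ℕ._≤ a′) (sym Rb) a<a′))

  -- The boundary crosses a diagonal once. A removable cell and an addable place further down the
  -- same diagonal exclude each other: the place in the column of the former and the row of the
  -- latter would be both outside and inside the shape.
  Pivot-unique : ∀ {k a b a′ b′} → k ℕ.+ a ≡ b → k ℕ.+ a′ ≡ b′ →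
                 Pivot R a b → Pivot R a′ b′ → a ≡ a′
  Pivot-unique refl refl p p′ =
    ℕ.≤-antisym (ℕ.≮⇒≥ (Pivot-≮ p′ p)) (ℕ.≮⇒≥ (Pivot-≮ p p′))

  Pivot-below : ∀ {a b i j} → Pivot R a b → i ℕ.≤ a → j ℕ.≤ b → ¬ (i ≡ a × j ≡ b) → j ℕ.< R i
  Pivot-below {a} {b} {i} {j} (inj₁ (Ra , Rb)) i≤a j≤b _ =
    ℕ.<-≤-trans (subst (j ℕ.<_) (sym Ra) (s≤s j≤b)) (Shape-antitone shape i≤a)
  Pivot-below {a} {b} {i} {j} (inj₂ (Ra , Rb)) i≤a j≤b ne with ℕ.m≤n⇒m<n∨m≡n j≤b
  ... | inj₁ j<b  = ℕ.<-≤-trans (subst (j ℕ.<_) (sym Ra) j<b) (Shape-antitone shape i≤a)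
  ... | inj₂ refl = shape (subst (i ℕ.<_) (sym Rb) (ℕ.≤∧≢⇒< i≤a λ eq → ne (eq , refl)))

  Pivot-above : ∀ {a b i j} → Pivot R a b → a ℕ.≤ i → b ℕ.≤ j → ¬ (i ≡ a × j ≡ b) → R i ℕ.≤ j
  Pivot-above {a} {b} {i} {j} (inj₂ (Ra , Rb)) a≤i b≤j _ =
    ℕ.≤-trans (Shape-antitone shape a≤i) (subst (ℕ._≤ j) (sym Ra) b≤j)
  Pivot-above {a} {b} {i} {j} (inj₁ (Ra , Rb)) a≤i b≤j ne with ℕ.m≤n⇒m<n∨m≡n b≤j
  ... | inj₁ b<j  = ℕ.≤-trans (Shape-antitone shape a≤i) (subst (ℕ._≤ j) (sym Ra) b<j)
  ... | inj₂ refl = outside shape (subst (ℕ._≤ i) (sym Rb) (ℕ.≤∧≢⇒< a≤i λ eq → ne (sym eq , refl)))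

remove : ℕ → ℕ → (ℕ → ℕ) → ℕ → ℕ
remove a b R i with i ℕ.≟ a
... | yes _ = b
... | no _ with i ℕ.≟ b
...   | yes _ = a
...   | no _  = R i

remove-a : ∀ a b R → remove a b R a ≡ b
remove-a a b R with a ℕ.≟ a
... | yes _ = refl
... | no ne = ⊥-elim (ne refl)

remove-b : ∀ a b R → remove a b R b ≡ a
remove-b a b R with b ℕ.≟ a
... | yes eq = eq
... | no _ with b ℕ.≟ b
...   | yes _ = refl
...   | no ne = ⊥-elim (ne refl)

remove-other : ∀ {a b} R {i} → i ≢ a → i ≢ b → remove a b R i ≡ R i
remove-other {a} {b} R {i} i≢a i≢b with i ℕ.≟ a
... | yes eq = ⊥-elim (i≢a eq)
... | no _ with i ℕ.≟ b
...   | yes eq = ⊥-elim (i≢b eq)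
...   | no _  = refl

data Row (a b : ℕ) : ℕ → Set where
  row-a     : Row a b a
  row-b     : Row a b b
  row-other : ∀ {i} → i ≢ a → i ≢ b → Row a b i

row? : ∀ a b i → Row a b i
row? a b i with i ℕ.≟ a
... | yes refl = row-a
... | no i≢a with i ℕ.≟ b
...   | yes refl = row-b
...   | no i≢b   = row-other i≢a i≢b

module _ {R : ℕ → ℕ} (shape : Shape R) {a b : ℕ} (rem : Removable R a b) where

  private
    R′ = remove a b R
    Ra = proj₁ rem
    Rb = proj₂ rem

  remove-≤ : ∀ i → R′ i ℕ.≤ R i
  remove-≤ i with row? a b i
  ... | row-a = subst₂ ℕ._≤_ (sym (remove-a a b R)) (sym Ra) (ℕ.n≤1+n b)
  ... | row-b = subst₂ ℕ._≤_ (sym (remove-b a b R)) (sym Rb) (ℕ.n≤1+n a)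
  ... | row-other i≢a i≢b = ℕ.≤-reflexive (remove-other R i≢a i≢b)

  remove-inside : ∀ {i j} → j ℕ.< R i → ¬ (i ≡ a × j ≡ b) → ¬ (i ≡ b × j ≡ a) → j ℕ.< R′ i
  remove-inside {i} {j} lt ne ne′ with row? a b i
  ... | row-a = subst (j ℕ.<_) (sym (remove-a a b R))
        (ℕ.≤∧≢⇒< (ℕ.≤-pred (subst (j ℕ.<_) Ra lt)) λ eq → ne (refl , eq))
  ... | row-b = subst (j ℕ.<_) (sym (remove-b a b R))
        (ℕ.≤∧≢⇒< (ℕ.≤-pred (subst (j ℕ.<_) Rb lt)) λ eq → ne′ (refl , eq))
  ... | row-other i≢a i≢b = subst (j ℕ.<_) (sym (remove-other R i≢a i≢b)) lt

  remove-≢ : ∀ {i j} → j ℕ.< R′ i → ¬ (i ≡ a × j ≡ b) × ¬ (i ≡ b × j ≡ a)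
  remove-≢ lt = (λ { (refl , refl) → ℕ.<-irrefl (sym (remove-a a b R)) lt })
              , (λ { (refl , refl) → ℕ.<-irrefl (sym (remove-b a b R)) lt })

  remove-shape : Shape R′
  remove-shape {i} lt = remove-inside (shape (ℕ.<-≤-trans lt (remove-≤ i)))
    (λ { (p , q) → proj₂ (remove-≢ lt) (q , p) }) (λ { (p , q) → proj₁ (remove-≢ lt) (q , p) })

  E-removable-hi : ∀ {k} → k ℕ.+ a ≡ b → E R a ≡ hi k
  E-removable-hi {k} refl = diff-≡ (R a) (suc a) k 0
    (trans (ℕ.+-identityʳ (R a)) (trans Ra (sym (ℕ.+-suc k a))))

  E-removable-lo : ∀ {k} → k ℕ.+ a ≡ b → mirror (E R b) ≡ lo k
  E-removable-lo {k} refl = trans (mirror-E R b) (diff-≡ b (R b) k 1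
    (trans (ℕ.+-comm b 1) (trans (sym (ℕ.+-suc k a)) (cong (k ℕ.+_) (sym Rb)))))

  -- Removing the corner interchanges the down step at `hi k` with the other step at `lo k`, and
  -- likewise their mirror images. All remaining steps are at positions that s_k fixes.
  σ-E-remove : ∀ {k} → k ℕ.+ a ≡ b → ∀ i → σ k (E R′ i) ≡ E R i
  σ-E-remove {k} refl i with row? a b i
  ... | row-a = trans (cong (σ k)
          (trans (cong (λ l → diff l (suc a)) (remove-a a b R)) (diff-≡ b (suc a) k 1
            (trans (ℕ.+-comm b 1) (sym (ℕ.+-suc k a))))))
          (trans (σ-lo k) (sym (E-removable-hi refl)))
  ... | row-b = trans (cong (σ k)
          (trans (cong (λ l → diff l (suc b)) (remove-b a b R))
            (trans (sym (mirror-diff b a)) (cong mirror (diff-≡ b a k 0 (ℕ.+-identityʳ b))))))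
          (trans (σ-mirror k (hi k)) (trans (cong mirror (σ-hi k))
            (trans (cong mirror (sym (E-removable-lo refl))) (mirror-involutive (E R b)))))
  ... | row-other i≢a i≢b = trans (cong (λ l → σ k (diff l (suc i))) (remove-other R i≢a i≢b))
          (σ-fixes k (E R i)
            (λ eq → E-≢-mirror shape i b (trans eq (sym (E-removable-lo refl))))
            (λ eq → i≢a (E-injective shape (trans eq (sym (E-removable-hi refl)))))
            (λ eq → i≢b (E-injective shape (trans (sym (mirror-involutive _))
              (trans (cong mirror (trans eq (sym (E-removable-lo refl)))) (mirror-involutive _)))))
            (λ eq → E-≢-mirror shape a i (sym (trans eq (sym (E-removable-hi refl))))))

module _ {R : ℕ → ℕ} {a b : ℕ} (add : Addable R a b) where

  E-addable-lo : ∀ {k} → k ℕ.+ a ≡ b → E R a ≡ lo k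
  E-addable-lo {k} refl = diff-≡ (R a) (suc a) k 1
    (trans (cong (ℕ._+ 1) (proj₁ add)) (trans (ℕ.+-comm b 1) (sym (ℕ.+-suc k a))))

  E-addable-hi : ∀ {k} → k ℕ.+ a ≡ b → mirror (E R b) ≡ hi k
  E-addable-hi {k} refl = trans (mirror-E R b) (diff-≡ b (R b) k 0
    (trans (ℕ.+-identityʳ b) (cong (k ℕ.+_) (sym (proj₂ add)))))

-- The weak order interval below the element of ν/μ

module Interval (n : ℕ) {Rμ Rν : ℕ → ℕ} (shapeμ : Shape Rμ) (shapeν : Shape Rν)
                (μ≤ν : ∀ i → Rμ i ℕ.≤ Rν i) (bounded : ∀ i → Rν i ℕ.≤ n) where

  open Words n
  open SignedWords n

  -- The inverse act r of the element of ν/R carries the boundary of R to that of ν, preserving the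
  -- order of the down steps and that of the other steps.
  record Reached (R : ℕ → ℕ) (r : Word) : Set where
    field
      shape : Shape R
      lower : ∀ i → Rμ i ℕ.≤ R i
      upper : ∀ i → R i ℕ.≤ Rν i
      act-E : ∀ i → act r (E R i) ≡ E Rν i

    act-mirror-E : ∀ i → act r (mirror (E R i)) ≡ mirror (E Rν i)
    act-mirror-E i = trans (act-odd r (E R i)) (cong mirror (act-E i))

  open Reached

  Reached-ν : Reached Rν []
  Reached-ν = record { shape = shapeν ; lower = μ≤ν ; upper = λ i → ℕ.≤-refl ; act-E = λ i → refl }

  module _ {R r} (reached : Reached R r) {a b} (k : Fin n) (k+a : toℕ k ℕ.+ a ≡ b) where

    removable-increases : Removable R a b → Increases (act r) (toℕ k)
    removable-increases rem = subst₂ _<_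
      (trans (sym (act-mirror-E reached b)) (cong (act r) (E-removable-lo (shape reached) rem k+a)))
      (trans (sym (act-E reached a)) (cong (act r) (E-removable-hi (shape reached) rem k+a)))
      (E-inside shapeν (ℕ.≤-trans (ℕ.≤-reflexive (sym (proj₁ rem))) (upper reached a)))

    remove-reached : Removable R a b → Rμ a ℕ.≤ b → Reached (remove a b R) (k ∷ r)
    remove-reached rem ≤b = record
      { shape = remove-shape (shape reached) rem
      ; lower = lower′
      ; upper = λ i → ℕ.≤-trans (remove-≤ (shape reached) rem i) (upper reached i)
      ; act-E = λ i → trans (cong (act r) (σ-E-remove (shape reached) rem k+a i)) (act-E reached i)
      }
      where
      lower′ : ∀ i → Rμ i ℕ.≤ remove a b R i
      lower′ i with row? a b i
      ... | row-a = subst (Rμ a ℕ.≤_) (sym (remove-a a b R)) ≤b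
      ... | row-b = subst (Rμ b ℕ.≤_) (sym (remove-b a b R)) (outside shapeμ ≤b)
      ... | row-other i≢a i≢b =
            subst (Rμ i ℕ.≤_) (sym (remove-other R i≢a i≢b)) (lower reached i)

    addable-decreases : Addable R a b → b ℕ.< Rν a → Decreases (act r) (toℕ k)
    addable-decreases add lt = subst₂ _<_
      (trans (sym (act-mirror-E reached b)) (cong (act r) (E-addable-hi add k+a)))
      (trans (sym (act-E reached a)) (cong (act r) (E-addable-lo add k+a)))
      (E-inside shapeν lt)

  private
    -- Cells are removed from the lowest row of the doubled shape that is too long.
    Descent : Set
    Descent = ∃[ r ] Asc r × (∀ i → act r (E Rμ i) ≡ E Rν i)

    descend : ∀ i {R r} → Reached R r → Asc r → (∀ i′ → i ℕ.≤ i′ → R i′ ≡ Rμ i′) → Descent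
    descend-row : ∀ i d {R r} → Reached R r → Asc r → (∀ i′ → suc i ℕ.≤ i′ → R i′ ≡ Rμ i′) →
                  R i ℕ.≤ d ℕ.+ Rμ i → Descent

    descend zero {R} {r} reached a done = r , a ,
      λ i → trans (cong (λ l → act r (diff l (suc i))) (sym (done i z≤n))) (act-E reached i)
    descend (suc i) {R} reached a done =
      descend-row i (R i) reached a done (ℕ.m≤m+n (R i) (Rμ i))

    descend-row i d {R} {r} reached a done fuel with R i ℕ.≤? Rμ i
    ... | yes le = descend i reached a λ i′ i≤i′ → finished i′ (ℕ.m≤n⇒m<n∨m≡n i≤i′)
      where
      finished : ∀ i′ → i ℕ.< i′ ⊎ i ≡ i′ → R i′ ≡ Rμ i′
      finished i′ (inj₁ lt)   = done i′ lt
      finished i′ (inj₂ refl) = ℕ.≤-antisym le (lower reached i)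
    descend-row i zero reached a done fuel | no ≰ = ⊥-elim (≰ fuel)
    descend-row i (suc d) {R} {r} reached a done fuel | no ≰ with R i in eq
    ... | zero  = ⊥-elim (≰ z≤n)
    -- The last cell (i , j) of the row is on or below the diagonal, so the corner is named by its
    -- mirror image (j , i).
    ... | suc j = descend-row i d (remove-reached reached k k+j rem Rμj≤i)
                    (removable-increases reached k k+j rem , a) done′ fuel′
      where
      Rμi≤j : Rμ i ℕ.≤ j
      Rμi≤j = ℕ.≤-pred (ℕ.≰⇒> ≰)
      Rμj≤i : Rμ j ℕ.≤ i
      Rμj≤i = outside shapeμ Rμi≤j
      i<Rj : i ℕ.< R j
      i<Rj = shape reached (ℕ.≤-reflexive (sym eq))
      Rj≤ : R j ℕ.≤ suc i
      Rj≤ = outside (shape reached) (subst (ℕ._≤ j) (sym (done (suc i) ℕ.≤-refl))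
              (ℕ.≤-trans (Shape-antitone shapeμ (ℕ.n≤1+n i)) Rμi≤j))
      rem : Removable R j i
      rem = ℕ.≤-antisym Rj≤ i<Rj , eq
      -- If j exceeded i, the mirror cell (j , i) would lie in a lower row; such rows already agree
      -- with μ, which does not contain it.
      j≤i : j ℕ.≤ i
      j≤i = ℕ.≮⇒≥ λ i<j → ℕ.<⇒≱ (subst (i ℕ.<_) (done j i<j) i<Rj) Rμj≤i
      i∸j<n : i ∸ j ℕ.< n
      i∸j<n = ℕ.<-≤-trans (ℕ.≤-<-trans (ℕ.m∸n≤m i j) i<Rj)
                (ℕ.≤-trans (upper reached j) (bounded j))
      k : Fin n
      k = fromℕ< i∸j<n
      k+j : toℕ k ℕ.+ j ≡ i
      k+j = trans (cong (ℕ._+ j) (Fin.toℕ-fromℕ< i∸j<n)) (ℕ.m∸n+n≡m j≤i)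
      done′ : ∀ i′ → suc i ℕ.≤ i′ → remove j i R i′ ≡ Rμ i′
      done′ i′ i<i′ = trans (remove-other R (λ { refl → ℕ.<⇒≱ i<i′ j≤i }) (λ { refl → ℕ.<-irrefl refl i<i′ }))
        (done i′ i<i′)
      fuel′ : remove j i R i ℕ.≤ d ℕ.+ Rμ i
      fuel′ = subst (ℕ._≤ d ℕ.+ Rμ i) (sym (remove-b j i R)) (ℕ.≤-pred fuel)

    descent : Descent
    descent = descend n Reached-ν tt λ i n≤i →
      trans (ℕ.n≤0⇒n≡0 (outside shapeν {0} (ℕ.≤-trans (bounded 0) n≤i)))
        (sym (ℕ.n≤0⇒n≡0 (ℕ.≤-trans (μ≤ν i) (outside shapeν {0} (ℕ.≤-trans (bounded 0) n≤i)))))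

  word-ν/μ : Word
  word-ν/μ = proj₁ descent

  Asc-ν/μ : Asc word-ν/μ
  Asc-ν/μ = proj₁ (proj₂ descent)

  act-ν/μ : ∀ i → act word-ν/μ (E Rμ i) ≡ E Rν i
  act-ν/μ = proj₂ (proj₂ descent)

  act-mirror-ν/μ : ∀ i → act word-ν/μ (mirror (E Rμ i)) ≡ mirror (E Rν i)
  act-mirror-ν/μ i = trans (act-odd word-ν/μ (E Rμ i)) (cong mirror (act-ν/μ i))

  Reached⇒μ : ∀ {R r} → Reached R r → (∀ p → act r p ≡ act word-ν/μ p) → ∀ i → R i ≡ Rμ i
  Reached⇒μ {R} {r} reached eq i = ℕ.+-cancelʳ-≡ (suc i) _ _
    (diff-injective (R i) (suc i) (Rμ i) (suc i) (act-injective r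
      (trans (act-E reached i) (trans (sym (act-ν/μ i)) (sym (eq (E Rμ i)))))))

  -- By `E-cover` every position is a down step of μ or mirrors one, so the images of the down steps
  -- of μ determine an odd map.
  μ⇒act : ∀ {R r} → Reached R r → (∀ i → R i ≡ Rμ i) → ∀ p → act r p ≡ act word-ν/μ p
  μ⇒act {R} {r} reached R≗μ = agree
    where
    agree-E : ∀ i → act r (E Rμ i) ≡ act word-ν/μ (E Rμ i)
    agree-E i = trans (cong (λ l → act r (diff l (suc i))) (sym (R≗μ i)))
      (trans (act-E reached i) (sym (act-ν/μ i)))
    agree-diff : ∀ k e → act r (diff k e) ≡ act word-ν/μ (diff k e)
    agree-diff k e with E-cover shapeμ k e
    ... | i , inj₁ eq = subst (λ p → act r p ≡ act word-ν/μ p) eq (agree-E i)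
    ... | i , inj₂ eq = subst (λ p → act r p ≡ act word-ν/μ p) eq
      (trans (act-odd r _) (trans (cong mirror (agree-E i)) (sym (act-odd word-ν/μ _))))
    agree : ∀ p → act r p ≡ act word-ν/μ p
    agree (+ a)    = agree-diff a 0
    agree -[1+ a ] = agree-diff 0 (suc a)

  -- r has an inversion that the element of ν/μ does not have, so it is not below it in weak order.
  Bad : Word → Set
  Bad r = ∃[ p ] ∃[ q ] ∃[ p′ ] ∃[ q′ ] p < q × p′ < q′ × act r q < act r p ×
          act word-ν/μ p′ ≡ act r q × act word-ν/μ q′ ≡ act r p

  Bad⇒≢ : ∀ r → Bad r → ¬ (∀ p → act r p ≡ act word-ν/μ p)
  Bad⇒≢ r (p , q , p′ , q′ , p<q , p′<q′ , _ , p′≡ , q′≡) eq = ℤ.<-asym p<q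
    (subst₂ _<_ (act-injective r (trans (eq p′) p′≡)) (act-injective r (trans (eq q′) q′≡)) p′<q′)

  -- Prefixing k could undo the inversion only if it sat at `lo k` and `hi k` or at their mirror
  -- images, but the hypothesis, with oddness in the second case, says that there is no inversion
  -- there. The pair of values stays the same, so p′ and q′ are kept.
  Bad-∷ : ∀ r k → Increases (act r) (toℕ k) → Bad r → Bad (k ∷ r)
  Bad-∷ r k inc (p , q , p′ , q′ , p<q , p′<q′ , inv , p′≡ , q′≡) =
    σ (toℕ k) p , σ (toℕ k) q , p′ , q′ ,
    σ-mono (toℕ k) p<q
      (λ { (refl , refl) → ℤ.<-asym inc inv })
      (λ { (q≡ , p≡) → ℤ.<-asym inc (subst₂ _<_
        (trans (sym (act-odd r p)) (cong (act r) p≡))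
        (trans (sym (act-odd r q)) (cong (act r) q≡)) (mirror-anti inv)) }) ,
    p′<q′ , subst₂ _<_ (back q) (back p) inv , trans p′≡ (back q) , trans q′≡ (back p)
    where
    back : ∀ x → act r x ≡ act (k ∷ r) (σ (toℕ k) x)
    back x = cong (act r) (sym (σ-involutive (toℕ k) x))

  Bad-new : ∀ r k {x y p′ q′} → act r (lo (toℕ k)) ≡ x → act r (hi (toℕ k)) ≡ y → x < y →
            act word-ν/μ p′ ≡ x → act word-ν/μ q′ ≡ y → p′ < q′ →
            Increases (act r) (toℕ k) × Bad (k ∷ r)
  Bad-new r k {p′ = p′} {q′} refl refl x<y p′≡ q′≡ p′<q′ =
    x<y , lo (toℕ k) , hi (toℕ k) , p′ , q′ , lo<hi (toℕ k) , p′<q′ ,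
    subst₂ _<_ (sym hi≡) (sym lo≡) x<y , trans p′≡ (sym hi≡) , trans q′≡ (sym lo≡)
    where
    lo≡ : act (k ∷ r) (lo (toℕ k)) ≡ act r (hi (toℕ k))
    lo≡ = cong (act r) (σ-lo (toℕ k))
    hi≡ : act (k ∷ r) (hi (toℕ k)) ≡ act r (lo (toℕ k))
    hi≡ = cong (act r) (σ-hi (toℕ k))

  no-pivot⇒Bad : ∀ {R r} → Reached R r → ∀ k →
                 (∀ a b → toℕ k ℕ.+ a ≡ b → Pivot R a b → b ℕ.< Rν a → Rμ a ℕ.≤ b → ⊥) →
                 Increases (act r) (toℕ k) × Bad (k ∷ r)
  no-pivot⇒Bad {R} {r} reached k none with E-cover (shape reached) (toℕ k) 1 | E-cover (shape reached) (toℕ k) 0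
  ... | i , inj₁ lo≡ | j , inj₁ hi≡ = Bad-new r k
        (trans (cong (act r) (sym lo≡)) (act-E reached i))
        (trans (cong (act r) (sym hi≡)) (act-E reached j))
        (E-antitone shapeν j<i) (act-ν/μ i) (act-ν/μ j) (E-antitone shapeμ j<i)
    where
    Ei<Ej : E R i < E R j
    Ei<Ej = subst₂ _<_ (sym lo≡) (sym hi≡) (lo<hi (toℕ k))
    j<i : j ℕ.< i
    j<i with ℕ.<-cmp i j
    ... | tri< lt _ _   = ⊥-elim (ℤ.<-asym Ei<Ej (E-antitone (shape reached) lt))
    ... | tri≈ _ refl _ = ⊥-elim (ℤ.<-irrefl refl Ei<Ej)
    ... | tri> _ _ gt   = gt
  ... | i , inj₂ lo≡ | j , inj₂ hi≡ = Bad-new r k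
        (trans (cong (act r) (sym lo≡)) (act-mirror-E reached i))
        (trans (cong (act r) (sym hi≡)) (act-mirror-E reached j))
        (mirror-anti (E-antitone shapeν i<j)) (act-mirror-ν/μ i) (act-mirror-ν/μ j)
        (mirror-anti (E-antitone shapeμ i<j))
    where
    Ej<Ei : mirror (E R i) < mirror (E R j)
    Ej<Ei = subst₂ _<_ (sym lo≡) (sym hi≡) (lo<hi (toℕ k))
    i<j : i ℕ.< j
    i<j with ℕ.<-cmp i j
    ... | tri< lt _ _   = lt
    ... | tri≈ _ refl _ = ⊥-elim (ℤ.<-irrefl refl Ej<Ei)
    ... | tri> _ _ gt   = ⊥-elim (ℤ.<-asym Ej<Ei (mirror-anti (E-antitone (shape reached) gt)))
  -- An addable place: it is outside ν, hence outside μ.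
  ... | i , inj₁ lo≡ | j , inj₂ hi≡ = Bad-new r k
        (trans (cong (act r) (sym lo≡)) (act-E reached i))
        (trans (cong (act r) (sym hi≡)) (act-mirror-E reached j))
        (E-outside shapeν Rνi≤j) (act-ν/μ i) (act-mirror-ν/μ j)
        (E-outside shapeμ Rμi≤j)
    where
    Ri≤j : R i ℕ.≤ j
    Ri≤j = ℕ.≮⇒≥ λ lt → ℤ.<-asym (lo<hi (toℕ k)) (subst₂ _<_ hi≡ lo≡ (E-inside (shape reached) lt))
    Ri≡ : R i ≡ toℕ k ℕ.+ i
    Ri≡ = ℕ.suc-injective (trans (ℕ.+-comm 1 (R i))
      (trans (diff-injective (R i) (suc i) (toℕ k) 1 lo≡) (ℕ.+-suc (toℕ k) i)))
    j≡ : j ≡ toℕ k ℕ.+ R j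
    j≡ = trans (sym (ℕ.+-identityʳ j))
      (diff-injective j (R j) (toℕ k) 0 (trans (sym (mirror-E R j)) hi≡))
    Ri≡j : R i ≡ j
    Ri≡j = ℕ.≤-antisym Ri≤j (subst₂ ℕ._≤_ (sym j≡) (sym Ri≡)
      (ℕ.+-monoʳ-≤ (toℕ k) (outside (shape reached) Ri≤j)))
    Rj≡i : R j ≡ i
    Rj≡i = ℕ.+-cancelˡ-≡ (toℕ k) _ _ (trans (sym j≡) (trans (sym Ri≡j) Ri≡))
    Rμi≤j : Rμ i ℕ.≤ j
    Rμi≤j = ℕ.≤-trans (lower reached i) Ri≤j
    Rνi≤j : Rν i ℕ.≤ j
    Rνi≤j = ℕ.≮⇒≥ λ lt → none i j (trans (sym Ri≡) Ri≡j) (inj₂ (Ri≡j , Rj≡i)) lt Rμi≤j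
  -- A removable cell: it belongs to μ, as otherwise it would be an available cell of ν/μ.
  ... | j , inj₂ lo≡ | i , inj₁ hi≡ = Bad-new r k
        (trans (cong (act r) (sym lo≡)) (act-mirror-E reached j))
        (trans (cong (act r) (sym hi≡)) (act-E reached i))
        (E-inside shapeν j<Rνi) (act-mirror-ν/μ j) (act-ν/μ i)
        (E-inside shapeμ (ℕ.≰⇒> (none i j k+i (inj₁ (Ri≡sj , Rj≡si)) j<Rνi)))
    where
    j<Ri : j ℕ.< R i
    j<Ri = ℕ.≰⇒> λ le → ℤ.<-asym (lo<hi (toℕ k)) (subst₂ _<_ hi≡ lo≡ (E-outside (shape reached) le))
    j<Rνi : j ℕ.< Rν i
    j<Rνi = ℕ.<-≤-trans j<Ri (upper reached i)
    Ri≡ : R i ≡ toℕ k ℕ.+ suc i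
    Ri≡ = trans (sym (ℕ.+-identityʳ (R i))) (diff-injective (R i) (suc i) (toℕ k) 0 hi≡)
    sj≡ : suc j ≡ toℕ k ℕ.+ R j
    sj≡ = trans (ℕ.+-comm 1 j) (diff-injective j (R j) (toℕ k) 1 (trans (sym (mirror-E R j)) lo≡))
    Ri≡sj : R i ≡ suc j
    Ri≡sj = ℕ.≤-antisym (subst₂ ℕ._≤_ (sym Ri≡) (sym sj≡)
      (ℕ.+-monoʳ-≤ (toℕ k) (shape reached j<Ri))) j<Ri
    Rj≡si : R j ≡ suc i
    Rj≡si = ℕ.+-cancelˡ-≡ (toℕ k) _ _ (trans (sym sj≡) (trans (sym Ri≡sj) Ri≡))
    k+i : toℕ k ℕ.+ i ≡ j
    k+i = ℕ.suc-injective (trans (sym (ℕ.+-suc (toℕ k) i)) (trans (sym Ri≡) Ri≡sj))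

-- Scalars and weights in the Hecke algebra

module HeckeProperties (n N : ℕ) where

  open HeckeAlgebra n N public
  module HeckeRing = Ring ring
  open RingProperties ring using (-‿distribˡ-*; -‿distribʳ-*)
  open Reasoning HeckeRing.setoid

  ⟦_⟧ : Poly N → Hecke n N
  ⟦ c ⟧ = scalar c

  variable-central : ∀ c h → ⟦ gen c ⟧ ⊗ h ≈ h ⊗ ⟦ gen c ⟧
  variable-central c (gen g) = relation (central c g)
  variable-central c 𝟘 = ≈-trans (HeckeRing.zeroʳ _) (≈-sym (HeckeRing.zeroˡ _))
  variable-central c 𝟙 = ≈-trans (⊗-identityʳ _) (≈-sym (⊗-identityˡ _))
  variable-central c (a ⊕ b) = ≈-trans (distribˡ _ a b)
    (≈-trans (⊕-cong (variable-central c a) (variable-central c b)) (≈-sym (distribʳ _ a b)))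
  variable-central c (a ⊗ b) = begin
    ⟦ gen c ⟧ ⊗ (a ⊗ b) ≈⟨ ⊗-assoc _ _ _ ⟨
    (⟦ gen c ⟧ ⊗ a) ⊗ b ≈⟨ ⊗-cong (variable-central c a) ≈-refl ⟩
    (a ⊗ ⟦ gen c ⟧) ⊗ b ≈⟨ ⊗-assoc _ _ _ ⟩
    a ⊗ (⟦ gen c ⟧ ⊗ b) ≈⟨ ⊗-cong ≈-refl (variable-central c b) ⟩
    a ⊗ (b ⊗ ⟦ gen c ⟧) ≈⟨ ⊗-assoc _ _ _ ⟨
    (a ⊗ b) ⊗ ⟦ gen c ⟧ ∎
  variable-central c (⊖ a) = ≈-trans (≈-sym (-‿distribʳ-* _ a))
    (≈-trans (⊖-cong (variable-central c a)) (-‿distribˡ-* a _))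

  scalar-central : ∀ c h → ⟦ c ⟧ ⊗ h ≈ h ⊗ ⟦ c ⟧
  scalar-central (gen c) h = variable-central c h
  scalar-central 𝟘 h = ≈-trans (HeckeRing.zeroˡ _) (≈-sym (HeckeRing.zeroʳ _))
  scalar-central 𝟙 h = ≈-trans (⊗-identityˡ _) (≈-sym (⊗-identityʳ _))
  scalar-central (a ⊕ b) h = ≈-trans (distribʳ h ⟦ a ⟧ ⟦ b ⟧)
    (≈-trans (⊕-cong (scalar-central a h) (scalar-central b h)) (≈-sym (distribˡ h ⟦ a ⟧ ⟦ b ⟧)))
  scalar-central (a ⊗ b) h = begin
    (⟦ a ⟧ ⊗ ⟦ b ⟧) ⊗ h ≈⟨ ⊗-assoc _ _ _ ⟩
    ⟦ a ⟧ ⊗ (⟦ b ⟧ ⊗ h) ≈⟨ ⊗-cong ≈-refl (scalar-central b h) ⟩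
    ⟦ a ⟧ ⊗ (h ⊗ ⟦ b ⟧) ≈⟨ ⊗-assoc _ _ _ ⟨
    (⟦ a ⟧ ⊗ h) ⊗ ⟦ b ⟧ ≈⟨ ⊗-cong (scalar-central a h) ≈-refl ⟩
    (h ⊗ ⟦ a ⟧) ⊗ ⟦ b ⟧ ≈⟨ ⊗-assoc _ _ _ ⟩
    h ⊗ (⟦ a ⟧ ⊗ ⟦ b ⟧) ∎
  scalar-central (⊖ a) h = ≈-trans (≈-sym (-‿distribˡ-* ⟦ a ⟧ h))
    (≈-trans (⊖-cong (scalar-central a h)) (-‿distribʳ-* h ⟦ a ⟧))

  scalar-left : ∀ a c b → a ⊗ (⟦ c ⟧ ⊗ b) ≈ ⟦ c ⟧ ⊗ (a ⊗ b)
  scalar-left a c b = begin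
    a ⊗ (⟦ c ⟧ ⊗ b) ≈⟨ ⊗-assoc _ _ _ ⟨
    (a ⊗ ⟦ c ⟧) ⊗ b ≈⟨ ⊗-cong (scalar-central c a) ≈-refl ⟨
    (⟦ c ⟧ ⊗ a) ⊗ b ≈⟨ ⊗-assoc _ _ _ ⟩
    ⟦ c ⟧ ⊗ (a ⊗ b) ∎

  variable-of : ±[ N ] → Poly N
  variable-of (_ , a) = gen (`x a)

  -- What a further letter contributes to the weight of a cell: every letter but one carries a β.
  growth : List ±[ N ] → ±[ N ] → Poly N
  growth []      ℓ = variable-of ℓ
  growth (_ ∷ _) ℓ = gen `β ⊗ variable-of ℓ

  cell-weight : List ±[ N ] → Poly N
  cell-weight []       = 𝟙
  cell-weight (ℓ ∷ ls) = growth ls ℓ ⊗ cell-weight ls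

  filling-weight : ∀ {m} → Vec (List ±[ N ]) m → Poly N
  filling-weight []       = 𝟙
  filling-weight (ls ∷ T) = cell-weight ls ⊗ filling-weight T

  filling-weight-updateAt : ∀ {m} (T : Vec (List ±[ N ]) m) c ℓ →
    ⟦ filling-weight (updateAt T c (ℓ ∷_)) ⟧ ≈ ⟦ growth (lookup T c) ℓ ⟧ ⊗ ⟦ filling-weight T ⟧
  filling-weight-updateAt (ls ∷ T) Fin.zero    ℓ = ⊗-assoc _ _ _
  filling-weight-updateAt (ls ∷ T) (Fin.suc c) ℓ =
    ≈-trans (⊗-cong ≈-refl (filling-weight-updateAt T c ℓ))
      (scalar-left ⟦ cell-weight ls ⟧ (growth (lookup T c) ℓ) ⟦ filling-weight T ⟧)

  step : ±[ N ] → Fin n → Hecke n N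
  step ℓ k = ⟦ variable-of ℓ ⟧ ⊗ u k

  factorAt : ±[ N ] × Fin n → Hecke n N
  factorAt (ℓ , k) = 𝟙 ⊕ step ℓ k

  ∏-++ : ∀ (ts ts′ : List (Hecke n N)) → ∏ (ts ++ ts′) ≈ ∏ ts ⊗ ∏ ts′
  ∏-++ []       ts′ = ≈-sym (⊗-identityˡ _)
  ∏-++ (t ∷ ts) ts′ = ≈-trans (⊗-cong ≈-refl (∏-++ ts ts′)) (≈-sym (⊗-assoc _ _ _))

  multiply-increasing : ∀ (x : Poly N) k c r → (⟦ x ⟧ ⊗ u k) ⊗ (⟦ c ⟧ ⊗ u-word r) ≈ ⟦ x ⊗ c ⟧ ⊗ u-word (k ∷ r)
  multiply-increasing x k c r = begin
    (⟦ x ⟧ ⊗ u k) ⊗ (⟦ c ⟧ ⊗ u-word r)   ≈⟨ ⊗-assoc _ _ _ ⟩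
    ⟦ x ⟧ ⊗ (u k ⊗ (⟦ c ⟧ ⊗ u-word r))   ≈⟨ ⊗-cong ≈-refl (scalar-left (u k) c (u-word r)) ⟩
    ⟦ x ⟧ ⊗ (⟦ c ⟧ ⊗ u-word (k ∷ r))     ≈⟨ ⊗-assoc _ _ _ ⟨
    (⟦ x ⟧ ⊗ ⟦ c ⟧) ⊗ u-word (k ∷ r)     ∎

  multiply-decreasing : ∀ (x : Poly N) k c r → u k ⊗ u-word r ≈ ⟦ gen `β ⟧ ⊗ u-word r →
    (⟦ x ⟧ ⊗ u k) ⊗ (⟦ c ⟧ ⊗ u-word r) ≈ ⟦ (gen `β ⊗ x) ⊗ c ⟧ ⊗ u-word r
  multiply-decreasing x k c r eq = begin
    (⟦ x ⟧ ⊗ u k) ⊗ (⟦ c ⟧ ⊗ u-word r)             ≈⟨ multiply-increasing x k c r ⟩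
    ⟦ x ⊗ c ⟧ ⊗ (u k ⊗ u-word r)                   ≈⟨ ⊗-cong ≈-refl eq ⟩
    ⟦ x ⊗ c ⟧ ⊗ (⟦ gen `β ⟧ ⊗ u-word r)            ≈⟨ scalar-left ⟦ x ⊗ c ⟧ (gen `β) (u-word r) ⟩
    ⟦ gen `β ⟧ ⊗ (⟦ x ⊗ c ⟧ ⊗ u-word r)            ≈⟨ ⊗-assoc _ _ _ ⟨
    (⟦ gen `β ⟧ ⊗ ⟦ x ⊗ c ⟧) ⊗ u-word r            ≈⟨ ⊗-cong (≈-sym (⊗-assoc _ _ _)) ≈-refl ⟩
    ⟦ (gen `β ⊗ x) ⊗ c ⟧ ⊗ u-word r                ∎

-- Fillings and times

-- A factor 1 + x_ℓ u_k of the product, with ℓ < 0 in the first half of the factor of x_ℓ.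
Time : ℕ → ℕ → Set
Time n N = ±[ N ] × Fin n

InTurn : ∀ {n} → Sign → Fin n → Fin n → Set
InTurn Sign.- k k′ = k′ Fin.< k
InTurn Sign.+ k k′ = k Fin.< k′

infix 4 _≺_
_≺_ : ∀ {n N} → Time n N → Time n N → Set
(ℓ , k) ≺ (ℓ′ , k′) = rank ℓ ℕ.< rank ℓ′ ⊎ ℓ ≡ ℓ′ × InTurn (proj₁ ℓ) k k′

InTurn-irrefl : ∀ {n} σ {k : Fin n} → ¬ InTurn σ k k
InTurn-irrefl Sign.- = ℕ.<-irrefl refl
InTurn-irrefl Sign.+ = ℕ.<-irrefl refl

InTurn-trans : ∀ {n} σ {k k′ k″ : Fin n} → InTurn σ k k′ → InTurn σ k′ k″ → InTurn σ k k″
InTurn-trans Sign.- p q = ℕ.<-trans q p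
InTurn-trans Sign.+ p q = ℕ.<-trans p q

≺-irrefl : ∀ {n N} {t : Time n N} → ¬ t ≺ t
≺-irrefl (inj₁ lt)      = ℕ.<-irrefl refl lt
≺-irrefl {t = ℓ , k} (inj₂ (_ , it)) = InTurn-irrefl (proj₁ ℓ) {k} it

≺-trans : ∀ {n N} {t t′ t″ : Time n N} → t ≺ t′ → t′ ≺ t″ → t ≺ t″
≺-trans (inj₁ p)          (inj₁ q)          = inj₁ (ℕ.<-trans p q)
≺-trans (inj₁ p)          (inj₂ (refl , _)) = inj₁ p
≺-trans (inj₂ (refl , _)) (inj₁ q)          = inj₁ q
≺-trans {t = ℓ , k} {_ , k′} {_ , k″} (inj₂ (refl , p)) (inj₂ (refl , q)) =
  inj₂ (refl , InTurn-trans (proj₁ ℓ) {k} {k′} {k″} p q)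

≺-same : ∀ {n N ℓ ℓ′} {k : Fin n} → _≺_ {n} {N} (ℓ , k) (ℓ′ , k) → rank ℓ ℕ.< rank ℓ′
≺-same (inj₁ lt) = lt
≺-same {ℓ = ℓ} {k = k} (inj₂ (_ , it)) = ⊥-elim (InTurn-irrefl (proj₁ ℓ) {k} it)

infix 4 _<ʳ_
_<ʳ_ : ∀ {N} → ±[ N ] → ±[ N ] → Set
p <ʳ q = rank p ℕ.< rank q

≡∷⇒≢[] : ∀ {A : Set} {x : A} {xs ys} → ys ≡ x List.∷ xs → ys ≢ []
≡∷⇒≢[] refl ()

-- What the expansion uses of the skew diagram: its cells lie on or above the main diagonal, and
-- `find` says that none is missing. With rows and columns counted from 0, the index of a diagonal
-- is the subscript of the generator that acts there.
record Cells (n m : ℕ) (Rμ Rν : ℕ → ℕ) : Set where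
  field
    row col  : Fin m → ℕ
    diag     : Fin m → Fin n
    diag+row : ∀ c → toℕ (diag c) ℕ.+ row c ≡ col c
    inside   : ∀ c → col c ℕ.< Rν (row c)
    outside-μ : ∀ c → Rμ (row c) ℕ.≤ col c
    cell-injective : ∀ {c c′} → row c ≡ row c′ → col c ≡ col c′ → c ≡ c′
    find     : ∀ {a b} → a ℕ.≤ b → b ℕ.< Rν a → Rμ a ℕ.≤ b → ∃[ c ] row c ≡ a × col c ≡ b

  row≤col : ∀ c → row c ℕ.≤ col c
  row≤col c = subst (row c ℕ.≤_) (diag+row c) (ℕ.m≤n+m (row c) (toℕ (diag c)))

module Fillings (N : ℕ) {n m : ℕ} {Rμ Rν : ℕ → ℕ} (shapeμ : Shape Rμ) (shapeν : Shape Rν)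
                (cells : Cells n m Rμ Rν) where

  open Cells cells

  PreFilling : Set
  PreFilling = Vec (List ±[ N ]) m

  infix 4 _⋖_
  _⋖_ : Fin m → Fin m → Set
  c ⋖ c′ = row c ℕ.≤ row c′ × col c ℕ.≤ col c′ × c ≢ c′

  ≢⇒ : ∀ {c c′} → c ≢ c′ → ¬ (row c ≡ row c′ × col c ≡ col c′)
  ≢⇒ c≢c′ (r≡ , c≡) = c≢c′ (cell-injective r≡ c≡)

  infixr 5 _[_]∷_
  _[_]∷_ : ±[ N ] → Fin m → PreFilling → PreFilling
  ℓ [ c ]∷ T = updateAt T c (ℓ ∷_)

  -- Describes the fillings that a final segment L of the product can produce, without reference to
  -- words or shapes: cells are filled from the lower right, and cells to the upper left use earlier
  -- factors. For the whole product and no empty cell this becomes the tableau condition.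
  record Valid (L : List (Time n N)) (T : PreFilling) : Set where
    field
      times      : ∀ c {ℓ} → ℓ ∈ lookup T c → (ℓ , diag c) ∈ L
      increasing : ∀ c → AllPairs _<ʳ_ (lookup T c)
      closed     : ∀ {c c′ ℓ} → c ⋖ c′ → ℓ ∈ lookup T c → lookup T c′ ≢ []
      ordered    : ∀ {c c′ ℓ ℓ′} → c ⋖ c′ → ℓ ∈ lookup T c → ℓ′ ∈ lookup T c′ →
                   (ℓ , diag c) ≺ (ℓ′ , diag c′)
  open Valid

  record Fills (R : ℕ → ℕ) (T : PreFilling) : Set where
    field
      empty  : ∀ c → lookup T c ≡ [] → col c ℕ.< R (row c)
      filled : ∀ c → lookup T c ≢ [] → R (row c) ℕ.≤ col c
  open Fills

  Valid-weaken : ∀ {t L T} → Valid L T → Valid (t ∷ L) T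
  Valid-weaken v = record
    { times = λ c → there ∘ times v c ; increasing = increasing v
    ; closed = closed v ; ordered = ordered v }

  data Updated (T : PreFilling) (c : Fin m) (f : List ±[ N ] → List ±[ N ]) : Fin m → List ±[ N ] → Set where
    new : Updated T c f c (f (lookup T c))
    old : ∀ {c′} → c′ ≢ c → Updated T c f c′ (lookup T c′)

  updated : ∀ T c f c′ → Updated T c f c′ (lookup (updateAt T c f) c′)
  updated T c f c′ with c′ Fin.≟ c
  ... | yes refl = subst (Updated T c f c) (sym (lookup∘updateAt c T)) new
  ... | no ne    = subst (Updated T c f c′) (sym (lookup∘updateAt′ c′ c ne T)) (old ne)

  module _ {R} (shape : Shape R) {T} (fills : Fills R T) {c} (pivot : Pivot R (row c) (col c)) where

    pivot-below : ∀ {c′} → c′ ⋖ c → lookup T c′ ≡ []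
    pivot-below {c′} (r≤ , c≤ , ne) with lookup T c′ in eq
    ... | []    = refl
    ... | _ ∷ _ = ⊥-elim (ℕ.<⇒≱ (Pivot-below shape pivot r≤ c≤ (≢⇒ ne))
                    (filled fills c′ (≡∷⇒≢[] eq)))

    pivot-above : ∀ {c′} → c ⋖ c′ → lookup T c′ ≢ []
    pivot-above {c′} (r≤ , c≤ , ne) eq =
      ℕ.<⇒≱ (empty fills c′ eq) (Pivot-above shape pivot r≤ c≤ (≢⇒ (≢-sym ne)))

    -- The new factor precedes all of L, which settles each comparison in which it comes first. It
    -- never comes second, since the cells to the upper left of a pivot are still empty.
    Valid-∷ : ∀ {ℓ k L} → diag c ≡ k → All ((ℓ , k) ≺_) L → Valid L T → Valid ((ℓ , k) ∷ L) (ℓ [ c ]∷ T)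
    Valid-∷ {ℓ} {L = L} refl first v = record
      { times = times′ ; increasing = increasing′ ; closed = closed′ ; ordered = ordered′ }
      where
      T′ = ℓ [ c ]∷ T
      t  = (ℓ , diag c)
      times′ : ∀ c′ {ℓ′} → ℓ′ ∈ lookup T′ c′ → (ℓ′ , diag c′) ∈ t ∷ L
      times′ c′ ∈T with lookup T′ c′ | updated T c (ℓ ∷_) c′ | ∈T
      ... | _ | new   | here refl = here refl
      ... | _ | new   | there ∈T  = there (times v c ∈T)
      ... | _ | old _ | ∈T        = there (times v c′ ∈T)
      increasing′ : ∀ c′ → AllPairs _<ʳ_ (lookup T′ c′)
      increasing′ c′ with lookup T′ c′ | updated T c (ℓ ∷_) c′
      ... | _ | new   = All.tabulate (λ {ℓ′} ∈T →
                          ≺-same {n} {N} {ℓ} {ℓ′} {diag c} (All.lookup first (times v c ∈T))) ∷ increasing v c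
      ... | _ | old _ = increasing v c′
      old-closed : ∀ {c₁ c₂} → c₁ ⋖ c₂ → lookup T c₂ ≢ [] → lookup T′ c₂ ≢ []
      old-closed {c₁} {c₂} _ ne with lookup T′ c₂ | updated T c (ℓ ∷_) c₂
      ... | _ | new   = λ ()
      ... | _ | old _ = ne
      closed′ : ∀ {c₁ c₂ ℓ′} → c₁ ⋖ c₂ → ℓ′ ∈ lookup T′ c₁ → lookup T′ c₂ ≢ []
      closed′ {c₁} {c₂} lt ∈T with lookup T′ c₁ | updated T c (ℓ ∷_) c₁
      ... | _ | new   = old-closed lt (pivot-above lt)
      ... | _ | old _ = old-closed lt (closed v lt ∈T)
      ordered′ : ∀ {c₁ c₂ ℓ₁ ℓ₂} → c₁ ⋖ c₂ → ℓ₁ ∈ lookup T′ c₁ → ℓ₂ ∈ lookup T′ c₂ →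
                 (ℓ₁ , diag c₁) ≺ (ℓ₂ , diag c₂)
      ordered′ {c₁} {c₂} lt ∈₁ ∈₂ with lookup T′ c₁ | updated T c (ℓ ∷_) c₁ | lookup T′ c₂ | updated T c (ℓ ∷_) c₂
      ... | _ | new   | _ | new   = ⊥-elim (proj₂ (proj₂ lt) refl)
      ... | _ | old _ | _ | old _ = ordered v lt ∈₁ ∈₂
      ... | _ | old _ | _ | new   with () ← subst (_ ∈_) (pivot-below lt) ∈₁
      ordered′ {c₁} {c₂} lt (here refl) ∈₂ | _ | new | _ | old _ = All.lookup first (times v c₂ ∈₂)
      ordered′ {c₁} {c₂} lt (there ∈₁) ∈₂ | _ | new | _ | old _ = ordered v lt ∈₁ ∈₂

    Fills-addable : Addable R (row c) (col c) → ∀ ℓ → Fills R (ℓ [ c ]∷ T)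
    Fills-addable (Ra , _) ℓ = record { empty = empty′ ; filled = filled′ }
      where
      T′ = ℓ [ c ]∷ T
      empty′ : ∀ c′ → lookup T′ c′ ≡ [] → col c′ ℕ.< R (row c′)
      empty′ c′ eq with lookup T′ c′ | updated T c (ℓ ∷_) c′
      empty′ c′ () | _ | new
      ... | _ | old _ = empty fills c′ eq
      filled′ : ∀ c′ → lookup T′ c′ ≢ [] → R (row c′) ℕ.≤ col c′
      filled′ c′ ne with lookup T′ c′ | updated T c (ℓ ∷_) c′
      ... | _ | new   = ℕ.≤-reflexive Ra
      ... | _ | old _ = filled fills c′ ne

    Fills-removable : Removable R (row c) (col c) → ∀ ℓ →
                      Fills (remove (row c) (col c) R) (ℓ [ c ]∷ T)
    Fills-removable rem ℓ = record { empty = empty′ ; filled = filled′ }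
      where
      T′ = ℓ [ c ]∷ T
      empty′ : ∀ c′ → lookup T′ c′ ≡ [] → col c′ ℕ.< remove (row c) (col c) R (row c′)
      empty′ c′ eq with lookup T′ c′ | updated T c (ℓ ∷_) c′
      empty′ c′ () | _ | new
      ... | _ | old ne = remove-inside shape rem (empty fills c′ eq) (≢⇒ ne)
            λ { (r≡ , c≡) → ≢⇒ ne (transposed r≡ c≡) }
        where
        -- `remove` also takes away the mirror cell; this is one of the cells only on the main
        -- diagonal, where it is c itself.
        transposed : row c′ ≡ col c → col c′ ≡ row c → row c′ ≡ row c × col c′ ≡ col c
        transposed r≡ c≡ = trans r≡ (sym row≡col) , trans c≡ row≡col
          where
          row≡col : row c ≡ col c
          row≡col = ℕ.≤-antisym (row≤col c) (subst₂ ℕ._≤_ r≡ c≡ (row≤col c′))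
      filled′ : ∀ c′ → lookup T′ c′ ≢ [] → remove (row c) (col c) R (row c′) ℕ.≤ col c′
      filled′ c′ ne with lookup T′ c′ | updated T c (ℓ ∷_) c′
      ... | _ | new   = ℕ.≤-reflexive (remove-a (row c) (col c) R)
      ... | _ | old _ = ℕ.≤-trans (remove-≤ shape rem (row c′)) (filled fills c′ ne)

  same-diagonal : ∀ {c c′} → diag c ≡ diag c′ → c ≢ c′ → c ⋖ c′ ⊎ c′ ⋖ c
  same-diagonal {c} {c′} eq ne with ℕ.≤-total (row c) (row c′)
  ... | inj₁ le = inj₁ (le , subst₂ ℕ._≤_ (diag+row c) (trans (cong (λ k → toℕ k ℕ.+ row c′) eq) (diag+row c′))
                     (ℕ.+-monoʳ-≤ (toℕ (diag c)) le) , ne)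
  ... | inj₂ le = inj₂ (le , subst₂ ℕ._≤_ (trans (cong (λ k → toℕ k ℕ.+ row c′) eq) (diag+row c′)) (diag+row c)
                     (ℕ.+-monoʳ-≤ (toℕ (diag c)) le) , ≢-sym ne)

  -- Inverts `Valid-∷`. The shape is quantified in `pivot` because a valid filling does not carry
  -- one; it is supplied by the summand whose filling is `rest`.
  record Prefixed (ℓ : ±[ N ]) (k : Fin n) (L : List (Time n N)) (T : PreFilling) : Set where
    field
      cell   : Fin m
      rest   : PreFilling
      diag≡  : diag cell ≡ k
      prefix : T ≡ ℓ [ cell ]∷ rest
      valid  : Valid L rest
      pivot  : ∀ {R} → Shape R → (∀ i → Rμ i ℕ.≤ R i) → (∀ i → R i ℕ.≤ Rν i) → Fills R rest →
               Pivot R (row cell) (col cell)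

  module _ {ℓ k L T} (first : All ((ℓ , k) ≺_) L) (v : Valid ((ℓ , k) ∷ L) T) where

    private
      t = (ℓ , k)

      later : ∀ {c ℓ′} → ℓ′ ∈ lookup T c → (ℓ′ , diag c) ≢ t → (ℓ′ , diag c) ∈ L
      later {c} ∈T ne with times v c ∈T
      ... | here eq  = ⊥-elim (ne eq)
      ... | there ∈L = ∈L

    Valid-strengthen : (∀ c → diag c ≡ k → ¬ ℓ ∈ lookup T c) → Valid L T
    Valid-strengthen none = record
      { times = λ c ∈T → later {c} ∈T λ { refl → none c refl ∈T }
      ; increasing = increasing v ; closed = closed v ; ordered = ordered v }

    module _ (c : Fin m) (diag≡k : diag c ≡ k) (ℓ∈ : ℓ ∈ lookup T c) where

      private
        time≡ : (ℓ , diag c) ≡ t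
        time≡ = cong (ℓ ,_) diag≡k

        -- A letter further to the upper left would come from a factor before (ℓ , k), which is the
        -- first one.
        below-empty : ∀ {c′ ℓ′} → c′ ⋖ c → ¬ ℓ′ ∈ lookup T c′
        below-empty {c′} {ℓ′} lt ∈T with subst ((ℓ′ , diag c′) ≺_) time≡ (ordered v lt ∈T ℓ∈) | times v c′ ∈T
        ... | ≺t | here refl = ≺-irrefl {n} {N} {t} ≺t
        ... | ≺t | there ∈L  = ≺-irrefl {n} {N} {t} (≺-trans {n} {N} {t} {_} {t} (All.lookup first ∈L) ≺t)

      head≡ : ∃[ ls ] lookup T c ≡ ℓ ∷ ls
      head≡ = head-of (lookup T c) refl ℓ∈ (increasing v c)
        where
        head-of : ∀ xs → lookup T c ≡ xs → ℓ ∈ xs → AllPairs _<ʳ_ xs → ∃[ ls ] xs ≡ ℓ ∷ ls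
        head-of (_ ∷ ls)  _  (here refl) _       = ls , refl
        head-of (ℓ′ ∷ ls) eq (there ∈ls) (p ∷ _) = ⊥-elim (ℕ.<-asym ℓ′<ℓ
          (≺-same {n} {N} {ℓ} {ℓ′} {k} (subst (λ d → t ≺ (ℓ′ , d)) diag≡k (All.lookup first
            (later {c} (subst (ℓ′ ∈_) (sym eq) (here refl)) λ { refl → ℕ.<-irrefl refl ℓ′<ℓ })))))
          where
          ℓ′<ℓ : ℓ′ <ʳ ℓ
          ℓ′<ℓ = All.lookup p ∈ls

      Valid⇒Prefixed : Prefixed ℓ k L T
      Valid⇒Prefixed = record
        { cell = c ; rest = T₀ ; diag≡ = diag≡k ; prefix = sym (trans (updateAt-updateAt c T) (updateAt-id-local c T (sym T≡)))
        ; valid = record { times = times₀ ; increasing = increasing₀ ; closed = closed₀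
                         ; ordered = λ {c₁} {c₂} lt ∈₁ ∈₂ → ordered v lt (⊆T c₁ ∈₁) (⊆T c₂ ∈₂) }
        ; pivot = pivot₀ }
        where
        ls = proj₁ head≡
        T≡ = proj₂ head≡
        T₀ = updateAt T c (λ _ → ls)
        T₀-c : lookup T₀ c ≡ ls
        T₀-c = lookup∘updateAt c T
        T₀-other : ∀ {c′} → c′ ≢ c → lookup T₀ c′ ≡ lookup T c′
        T₀-other {c′} ne = lookup∘updateAt′ c′ c ne T
        increasing-c : AllPairs _<ʳ_ (ℓ ∷ ls)
        increasing-c = subst (AllPairs _<ʳ_) T≡ (increasing v c)
        ⊆T : ∀ c′ {ℓ′} → ℓ′ ∈ lookup T₀ c′ → ℓ′ ∈ lookup T c′
        ⊆T c′ ∈T₀ with lookup T₀ c′ | updated T c (λ _ → ls) c′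
        ... | _ | new   = subst (_ ∈_) (sym T≡) (there ∈T₀)
        ... | _ | old _ = ∈T₀
        times₀ : ∀ c′ {ℓ′} → ℓ′ ∈ lookup T₀ c′ → (ℓ′ , diag c′) ∈ L
        times₀ c′ {ℓ′} ∈T₀ = later {c′} (⊆T c′ ∈T₀) (distinct ∈T₀)
          where
          distinct : ℓ′ ∈ lookup T₀ c′ → (ℓ′ , diag c′) ≢ t
          distinct ∈T₀ refl with lookup T₀ c′ | updated T c (λ _ → ls) c′
          distinct ∈T₀ refl | _ | new with p ∷ _ ← increasing-c = ℕ.<-irrefl refl (All.lookup p ∈T₀)
          distinct ∈T₀ refl | _ | old ne with same-diagonal (sym diag≡k) ne
          ... | inj₁ lt = below-empty lt ∈T₀
          ... | inj₂ lt = ≺-irrefl {n} {N} {t} (subst (_≺ t) time≡ (ordered v lt ℓ∈ ∈T₀))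
        increasing₀ : ∀ c′ → AllPairs _<ʳ_ (lookup T₀ c′)
        increasing₀ c′ with lookup T₀ c′ | updated T c (λ _ → ls) c′
        ... | _ | old _ = increasing v c′
        ... | _ | new with _ ∷ ps ← increasing-c = ps
        closed₀ : ∀ {c₁ c₂ ℓ′} → c₁ ⋖ c₂ → ℓ′ ∈ lookup T₀ c₁ → lookup T₀ c₂ ≢ []
        closed₀ {c₁} {c₂} lt ∈₁ with lookup T₀ c₂ | updated T c (λ _ → ls) c₂
        ... | _ | new   = λ _ → below-empty lt (⊆T c₁ ∈₁)
        ... | _ | old _ = closed v lt (⊆T c₁ ∈₁)
        -- Cells to the upper left of c are empty and those to the lower right are filled, so c lies
        -- at the boundary of R: it is removable if ℓ was its only letter and addable if letters
        -- remain.
        pivot₀ : ∀ {R} → Shape R → (∀ i → Rμ i ℕ.≤ R i) → (∀ i → R i ℕ.≤ Rν i) → Fills R T₀ →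
                 Pivot R (row c) (col c)
        pivot₀ {R} shape lower upper fills = conclude ls refl
          where
          a = row c
          b = col c
          above : ∀ {i j} → i ℕ.≤ j → a ℕ.≤ i → b ℕ.≤ j → ¬ (a ≡ i × b ≡ j) → R i ℕ.≤ j
          above {i} {j} i≤j a≤i b≤j ne = ℕ.≮⇒≥ λ j<Ri → contra j<Ri
            (find i≤j (ℕ.<-≤-trans j<Ri (upper i))
              (ℕ.≤-trans (Shape-antitone shapeμ a≤i) (ℕ.≤-trans (outside-μ c) b≤j)))
            where
            contra : j ℕ.< R i → ¬ (∃[ c′ ] row c′ ≡ i × col c′ ≡ j)
            contra lt (c′ , refl , refl) = ℕ.<⇒≱ lt (filled fills c′
              λ eq → closed v (a≤i , b≤j , c≢c′) ℓ∈ (trans (sym (T₀-other (≢-sym c≢c′))) eq))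
              where
              c≢c′ : c ≢ c′
              c≢c′ refl = ne (refl , refl)
          below′ : ∀ {i j} → i ℕ.≤ j → i ℕ.≤ a → j ℕ.≤ b → ¬ (i ≡ a × j ≡ b) → j ℕ.< R i
          below′ {i} {j} i≤j i≤a j≤b ne = ℕ.≰⇒> λ Ri≤j → contra Ri≤j
            (find i≤j (ℕ.≤-<-trans j≤b (ℕ.<-≤-trans (inside c) (Shape-antitone shapeν i≤a)))
              (ℕ.≤-trans (lower i) Ri≤j))
            where
            contra : R i ℕ.≤ j → ¬ (∃[ c′ ] row c′ ≡ i × col c′ ≡ j)
            contra le (c′ , refl , refl) = ℕ.<⇒≱ (empty fills c′ T₀≡[]) le
              where
              c′≢c : c′ ≢ c
              c′≢c refl = ne (refl , refl)
              T₀≡[] : lookup T₀ c′ ≡ []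
              T₀≡[] with lookup T c′ in eq
              ... | []     = trans (T₀-other c′≢c) eq
              ... | ℓ′ ∷ _ = ⊥-elim (below-empty (i≤a , j≤b , c′≢c) (subst (ℓ′ ∈_) (sym eq) (here refl)))
          conclude : ∀ ls′ → ls ≡ ls′ → Pivot R a b
          conclude [] ls≡ = inj₁ (Ra , ℕ.≤-antisym Rb≤ (shape b<Ra))
            where
            b<Ra : b ℕ.< R a
            b<Ra = empty fills c (trans T₀-c ls≡)
            Ra : R a ≡ suc b
            Ra = ℕ.≤-antisym (above (ℕ.≤-trans (row≤col c) (ℕ.n≤1+n b)) ℕ.≤-refl (ℕ.n≤1+n b)
                   λ { (_ , eq) → ℕ.1+n≢n (sym eq) }) b<Ra
            Rb≤ : R b ℕ.≤ suc a
            Rb≤ with ℕ.m≤n⇒m<n∨m≡n (row≤col c)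
            -- The place below c is on or above the main diagonal only if c is strictly above it.
            -- For c on the diagonal the bound is `Ra` again, by symmetry.
            ... | inj₁ a<b = outside shape (above a<b (ℕ.n≤1+n a) ℕ.≤-refl λ { (eq , _) → ℕ.1+n≢n (sym eq) })
            ... | inj₂ a≡b = ℕ.≤-reflexive (subst (λ x → R x ≡ suc a) a≡b (trans Ra (cong suc (sym a≡b))))
          conclude (_ ∷ _) ls≡ = inj₂ (ℕ.≤-antisym Ra≤b b≤Ra , Rb)
            where
            Ra≤b : R a ℕ.≤ b
            Ra≤b = filled fills c (≡∷⇒≢[] (trans T₀-c ls≡))
            a≤Rb : ∀ a′ → a ≡ a′ → a′ ℕ.≤ R b
            a≤Rb zero     _  = z≤n
            a≤Rb (suc a′) eq = shape (below′ (ℕ.≤-trans a′≤a (row≤col c)) a′≤a ℕ.≤-refl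
              λ { (e , _) → ℕ.1+n≢n (sym (trans e eq)) })
              where
              a′≤a : a′ ℕ.≤ a
              a′≤a = ℕ.≤-trans (ℕ.n≤1+n a′) (ℕ.≤-reflexive (sym eq))
            Rb : R b ≡ a
            Rb = ℕ.≤-antisym (outside shape Ra≤b) (a≤Rb a refl)
            b≤Ra : b ℕ.≤ R a
            b≤Ra with ℕ.m≤n⇒m<n∨m≡n (row≤col c)
            ... | inj₂ a≡b = ℕ.≤-reflexive (trans (sym a≡b) (trans (sym Rb) (cong R (sym a≡b))))
            ... | inj₁ a<b with b in eq
            ...   | suc b′ = below′ (ℕ.≤-pred a<b) ℕ.≤-refl (ℕ.≤-trans (ℕ.n≤1+n b′) (ℕ.≤-reflexive (sym eq)))
                      λ { (_ , e) → ℕ.1+n≢n (sym (trans e eq)) }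

    Valid-split : Valid L T ⊎ Prefixed ℓ k L T
    Valid-split with Fin.any? (λ c → diag c Fin.≟ k ×-dec _∈?_ (≡-dec Sign._≟_ Fin._≟_) ℓ (lookup T c))
    ... | yes (c , diag≡k , ℓ∈) = inj₂ (Valid⇒Prefixed c diag≡k ℓ∈)
    ... | no none = inj₁ (Valid-strengthen λ c diag≡k ℓ∈ → none (c , diag≡k , ℓ∈))

-- Expansion of the product

module Expansion (n N : ℕ) {Rμ Rν : ℕ → ℕ} (shapeμ : Shape Rμ) (shapeν : Shape Rν)
                 (μ≤ν : ∀ i → Rμ i ℕ.≤ Rν i) (bounded : ∀ i → Rν i ℕ.≤ n)
                 {m : ℕ} (cells : Cells n m Rμ Rν) where

  open WordProperties n N public
  open HeckeProperties n N public
  open Interval n shapeμ shapeν μ≤ν bounded public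
  open Cells cells public
  open Fillings N shapeμ shapeν cells public
  open Reasoning HeckeRing.setoid

  record Good : Set where
    field
      filling : PreFilling
      spelling    : Word
      asc     : Asc spelling
      R       : ℕ → ℕ
      reached : Reached R spelling
      fills   : Fills R filling
    open Reached reached public using (shape; lower; upper)

  record BadTerm : Set where
    field
      coefficient : Poly N
      spelling        : Word
      asc         : Asc spelling
      bad         : Bad spelling

  open Good using (filling)

  good-term : Good → Hecke n N
  good-term g = ⟦ filling-weight (filling g) ⟧ ⊗ u-word (Good.spelling g)

  bad-term : BadTerm → Hecke n N
  bad-term b = ⟦ BadTerm.coefficient b ⟧ ⊗ u-word (BadTerm.spelling b)

  ∑-++ : ∀ (ts ts′ : List (Hecke n N)) → ∑ (ts ++ ts′) ≈ ∑ ts ⊕ ∑ ts′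
  ∑-++ []       ts′ = ≈-sym (⊕-identityˡ _)
  ∑-++ (t ∷ ts) ts′ = ≈-trans (⊕-cong ≈-refl (∑-++ ts ts′)) (≈-sym (⊕-assoc _ _ _))

  ∑-map-++ : ∀ {A : Set} (f : A → Hecke n N) xs ys → ∑ (map f (xs ++ ys)) ≈ ∑ (map f xs) ⊕ ∑ (map f ys)
  ∑-map-++ f xs ys = subst (λ ts → ∑ ts ≈ ∑ (map f xs) ⊕ ∑ (map f ys)) (sym (map-++ f xs ys))
    (∑-++ (map f xs) (map f ys))

  Continues : ±[ N ] → Fin n → Good → Set
  Continues ℓ k g = Σ[ c ∈ Fin m ] diag c ≡ k × Pivot (Good.R g) (row c) (col c) ×
    Σ[ g′ ∈ Good ] filling g′ ≡ ℓ [ c ]∷ filling g × step ℓ k ⊗ good-term g ≈ good-term g′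

  Fails : ±[ N ] → Fin n → Good → Set
  Fails ℓ k g = (∀ c → diag c ≡ k → ¬ Pivot (Good.R g) (row c) (col c)) ×
    Σ[ b ∈ BadTerm ] step ℓ k ⊗ good-term g ≈ bad-term b

  good-step : ∀ ℓ k g → Continues ℓ k g ⊎ Fails ℓ k g
  good-step ℓ k g with Fin.any? (λ c → diag c Fin.≟ k ×-dec Pivot? (Good.R g) (row c) (col c))
  ... | yes (c , refl , inj₁ rem) = inj₁ (c , refl , inj₁ rem , record
        { asc = removable-increases reached k (diag+row c) rem , asc
        ; reached = remove-reached reached k (diag+row c) rem (outside-μ c)
        ; fills = Fills-removable shape fills {c} (inj₁ rem) rem ℓ } , refl ,
        ≈-trans (multiply-increasing (variable-of ℓ) k (filling-weight T) spelling)
          (⊗-cong (≈-sym (subst (λ ls → ⟦ filling-weight (ℓ [ c ]∷ T) ⟧ ≈ ⟦ growth ls ℓ ⟧ ⊗ ⟦ filling-weight T ⟧)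
            T-c (filling-weight-updateAt T c ℓ))) ≈-refl))
    where
    open Good g hiding (filling)
    T = filling g
    -- A removable cell still belongs to R, so it has no letter yet and `growth` gives no β.
    T-c : lookup T c ≡ []
    T-c with lookup T c in eq
    ... | []    = refl
    ... | _ ∷ _ = ⊥-elim (ℕ.<⇒≱ (ℕ.≤-reflexive (sym (proj₁ rem))) (Fills.filled fills c (≡∷⇒≢[] eq)))
  ... | yes (c , refl , inj₂ add) = inj₁ (c , refl , inj₂ add , record
        { asc = asc ; reached = reached
        ; fills = Fills-addable shape fills {c} (inj₂ add) add ℓ } , refl ,
        ≈-trans (multiply-decreasing (variable-of ℓ) k (filling-weight T) spelling
            (u-decreases spelling k asc (addable-decreases reached k (diag+row c) add (inside c))))
          (⊗-cong (≈-sym (subst (λ p → ⟦ filling-weight (ℓ [ c ]∷ T) ⟧ ≈ ⟦ p ⟧ ⊗ ⟦ filling-weight T ⟧)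
            growth≡ (filling-weight-updateAt T c ℓ))) ≈-refl))
    where
    open Good g hiding (filling)
    T = filling g
    -- An addable place is outside R, so the cell there already has a letter; the β of the descent
    -- is the one in `growth`.
    growth≡ : growth (lookup T c) ℓ ≡ gen `β ⊗ variable-of ℓ
    growth≡ with lookup T c in eq
    ... | _ ∷ _ = refl
    ... | []    = ⊥-elim (ℕ.<-irrefl (sym (proj₁ add)) (Fills.empty fills c eq))
  ... | no none = inj₂ ((λ c d p → none (c , d , p)) , record
        { asc = proj₁ ends , asc ; bad = proj₂ ends } ,
        multiply-increasing (variable-of ℓ) k (filling-weight (filling g)) spelling)
    where
    open Good g hiding (filling)
    ends : Increases (act spelling) (toℕ k) × Bad (k ∷ spelling)
    ends = no-pivot⇒Bad reached k λ a b k+a pivot b<Rνa Rμa≤b →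
      impossible k+a pivot (find (subst (a ℕ.≤_) k+a (ℕ.m≤n+m a (toℕ k))) b<Rνa Rμa≤b)
      where
      impossible : ∀ {a b} → toℕ k ℕ.+ a ≡ b → Pivot R a b → ¬ (∃[ c ] row c ≡ a × col c ≡ b)
      impossible k+a pivot (c , refl , refl) = none (c ,
        Fin.toℕ-injective (ℕ.+-cancelʳ-≡ (row c) _ _ (trans (diag+row c) (sym k+a))) , pivot)

  bad-step : ∀ ℓ k b → Σ[ b′ ∈ BadTerm ] step ℓ k ⊗ bad-term b ≈ bad-term b′
  bad-step ℓ k b with increases? (BadTerm.spelling b) (toℕ k)
  ... | inj₁ inc = record { asc = inc , asc ; bad = Bad-∷ spelling k inc bad } ,
                   multiply-increasing (variable-of ℓ) k coefficient spelling
    where open BadTerm b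
  ... | inj₂ dec = record { asc = asc ; bad = bad } ,
                   multiply-decreasing (variable-of ℓ) k coefficient spelling (u-decreases spelling k asc dec)
    where open BadTerm b

  bad-steps : ∀ ℓ k bs → Σ[ bs′ ∈ List BadTerm ] step ℓ k ⊗ ∑ (map bad-term bs) ≈ ∑ (map bad-term bs′)
  bad-steps ℓ k []       = [] , HeckeRing.zeroʳ _
  bad-steps ℓ k (b ∷ bs) with b′ , eq ← bad-step ℓ k b | bs′ , eqs ← bad-steps ℓ k bs =
    b′ ∷ bs′ , ≈-trans (distribˡ _ _ _) (⊕-cong eq eqs)

  Fresh : ±[ N ] → Fin n → PreFilling → Set
  Fresh ℓ k T = ∀ c → diag c ≡ k → ¬ ℓ ∈ lookup T c

  -- The new letter reveals its cell, since ℓ occurred nowhere on the diagonal k before; deleting it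
  -- there recovers the old filling.
  Fresh-injective : ∀ {ℓ k T T′ c c′} → Fresh ℓ k T → Fresh ℓ k T′ → diag c ≡ k → diag c′ ≡ k →
                    ℓ [ c ]∷ T ≡ ℓ [ c′ ]∷ T′ → T ≡ T′
  Fresh-injective {ℓ} {k} {T} {T′} {c} {c′} fresh fresh′ d d′ eq with c Fin.≟ c′
  ... | yes refl = trans (sym (undo T)) (trans (cong (λ S → updateAt S c (drop 1)) eq) (undo T′))
    where
    undo : ∀ S → updateAt (ℓ [ c ]∷ S) c (drop 1) ≡ S
    undo S = trans (updateAt-updateAt c S) (updateAt-id c S)
  ... | no ne = ⊥-elim (fresh′ c d (subst (ℓ ∈_)
    (trans (sym (lookup∘updateAt c T)) (trans (cong (λ S → lookup S c) eq) (lookup∘updateAt′ c c′ ne T′)))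
    (here refl)))

  Origin : ±[ N ] → Fin n → List Good → Good → Set
  Origin ℓ k gs g′ = Σ[ g ∈ Good ] Σ[ c ∈ Fin m ] g ∈ gs × diag c ≡ k ×
    Pivot (Good.R g) (row c) (col c) × filling g′ ≡ ℓ [ c ]∷ filling g

  record Extended (ℓ : ±[ N ]) (k : Fin n) (gs : List Good) : Set where
    field
      goods    : List Good
      bads     : List BadTerm
      equation : step ℓ k ⊗ ∑ (map good-term gs) ≈ ∑ (map good-term goods) ⊕ ∑ (map bad-term bads)
      origin   : All (Origin ℓ k gs) goods
      complete : ∀ {g c} → g ∈ gs → diag c ≡ k → Pivot (Good.R g) (row c) (col c) →
                 (ℓ [ c ]∷ filling g) ∈ map filling goods
      distinct : Unique (map filling goods)

  extended : ∀ ℓ k gs → Unique (map filling gs) → All (Fresh ℓ k ∘ filling) gs → Extended ℓ k gs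
  extended ℓ k [] _ _ = record
    { goods = [] ; bads = []
    ; equation = ≈-trans (HeckeRing.zeroʳ _) (≈-sym (⊕-identityʳ _))
    ; origin = [] ; complete = λ () ; distinct = [] }
  extended ℓ k (g ∷ gs) (g∉ ∷ unique) (fresh ∷ freshs) with good-step ℓ k g
  ... | inj₂ (none , b , eq) = record
    { goods = goods ; bads = b ∷ bads
    ; equation = begin
        step ℓ k ⊗ (good-term g ⊕ ∑ (map good-term gs))                   ≈⟨ distribˡ _ _ _ ⟩
        step ℓ k ⊗ good-term g ⊕ step ℓ k ⊗ ∑ (map good-term gs)          ≈⟨ ⊕-cong eq equation ⟩
        bad-term b ⊕ (∑ (map good-term goods) ⊕ ∑ (map bad-term bads))    ≈⟨ ⊕-assoc _ _ _ ⟨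
        (bad-term b ⊕ ∑ (map good-term goods)) ⊕ ∑ (map bad-term bads)    ≈⟨ ⊕-cong (⊕-comm _ _) ≈-refl ⟩
        (∑ (map good-term goods) ⊕ bad-term b) ⊕ ∑ (map bad-term bads)    ≈⟨ ⊕-assoc _ _ _ ⟩
        ∑ (map good-term goods) ⊕ (bad-term b ⊕ ∑ (map bad-term bads))    ∎
    ; origin = All.map (λ { (g₁ , c , ∈gs , o) → g₁ , c , there ∈gs , o }) origin
    ; complete = λ { (here refl) d p → ⊥-elim (none _ d p) ; (there ∈gs) d p → complete ∈gs d p }
    ; distinct = distinct }
    where open Extended (extended ℓ k gs unique freshs)
  ... | inj₁ (c , d , pivot , g′ , filling≡ , eq) = record
    { goods = g′ ∷ goods ; bads = bads
    ; equation = ≈-trans (distribˡ _ _ _) (≈-trans (⊕-cong eq equation) (≈-sym (⊕-assoc _ _ _)))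
    ; origin = (g , c , here refl , d , pivot , filling≡) ∷
        All.map (λ { (g₁ , c , ∈gs , o) → g₁ , c , there ∈gs , o }) origin
    ; complete = λ { (here refl) d′ p → here (trans (cong (λ x → ℓ [ x ]∷ filling g) (same d′ p)) (sym filling≡))
                   ; (there ∈gs) d′ p → there (complete ∈gs d′ p) }
    ; distinct = All.map⁺ (All.map (λ {g₁} → differ {g₁}) origin) ∷ distinct }
    where
    open Extended (extended ℓ k gs unique freshs)
    -- A diagonal has at most one pivot, so the cell found by `good-step` is the one that
    -- completeness asks for.
    same : ∀ {c′} → diag c′ ≡ k → Pivot (Good.R g) (row c′) (col c′) → c′ ≡ c
    same {c′} d′ p = cell-injective rows≡
      (trans (sym (diag+row c′)) (trans (cong₂ ℕ._+_ (cong toℕ (trans d′ (sym d))) rows≡) (diag+row c)))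
      where
      rows≡ = Pivot-unique (Good.shape g) (trans (cong (λ k → toℕ k ℕ.+ row c′) (sym d′)) (diag+row c′))
        (trans (cong (λ k → toℕ k ℕ.+ row c) (sym d)) (diag+row c)) p pivot
    differ : ∀ {g₁} → Origin ℓ k gs g₁ → filling g′ ≢ filling g₁
    differ (g₀ , c₀ , ∈gs , d₀ , _ , filling≡₀) eq = All.lookup g∉ (∈-map⁺ filling ∈gs)
      (Fresh-injective {c = c} {c₀} fresh (All.lookup freshs ∈gs) d d₀ (trans (sym filling≡) (trans eq filling≡₀)))

  -- `valid`, `complete` and `distinct` together say that the good summands list the valid fillings
  -- once each; the comparison with the sum over tableaux rests on this.
  record Expanded (L : List (Time n N)) : Set where
    field
      goods    : List Good
      bads     : List BadTerm
      equation : ∏ (map factorAt L) ≈ ∑ (map good-term goods) ⊕ ∑ (map bad-term bads)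
      valid    : All (Valid L ∘ filling) goods
      complete : ∀ {T} → Valid L T → T ∈ map filling goods
      distinct : Unique (map filling goods)

  private
    blank : PreFilling
    blank = Vec.replicate m []

    filling-weight-blank : ∀ m → ⟦ filling-weight (Vec.replicate m []) ⟧ ≈ 𝟙
    filling-weight-blank zero    = ≈-refl
    filling-weight-blank (suc m) = ≈-trans (⊗-identityˡ _) (filling-weight-blank m)

    ≡-blank : ∀ {m} (T : Vec (List ±[ N ]) m) → (∀ c → lookup T c ≡ []) → T ≡ Vec.replicate m []
    ≡-blank []       _  = refl
    ≡-blank (ls ∷ T) eq = cong₂ _∷_ (eq Fin.zero) (≡-blank T (eq ∘ Fin.suc))

    no-letters : ∀ {ls : List ±[ N ]} → (∀ {ℓ} → ¬ ℓ ∈ ls) → ls ≡ []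
    no-letters {[]}    _    = refl
    no-letters {_ ∷ _} none = ⊥-elim (none (here refl))

    blank-∉ : ∀ c {ℓ} → ¬ ℓ ∈ lookup blank c
    blank-∉ c ∈T with () ← subst (_ ∈_) (lookup-replicate c []) ∈T

  good-blank : Good
  good-blank = record
    { filling = blank ; spelling = [] ; asc = tt ; R = Rν ; reached = Reached-ν
    ; fills = record { empty = λ c _ → inside c ; filled = λ c ne → ⊥-elim (ne (lookup-replicate c [])) } }

  expanded : ∀ L → AllPairs _≺_ L → Expanded L
  expanded [] _ = record
    { goods = good-blank ∷ [] ; bads = []
    ; equation = ≈-sym (≈-trans (⊕-identityʳ _) (≈-trans (⊕-identityʳ _)
        (≈-trans (⊗-identityʳ _) (filling-weight-blank m))))
    ; valid = record
        { times = λ c ∈T → ⊥-elim (blank-∉ c ∈T)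
        ; increasing = λ c → subst (AllPairs _<ʳ_) (sym (lookup-replicate c [])) []
        ; closed = λ {c} _ ∈T → ⊥-elim (blank-∉ c ∈T)
        ; ordered = λ {c} _ ∈T → ⊥-elim (blank-∉ c ∈T) } ∷ []
    ; complete = λ v → here (≡-blank _ λ c → no-letters λ ∈T → Any.¬Any[] (Valid.times v c ∈T))
    ; distinct = [] ∷ [] }
  expanded ((ℓ , k) ∷ L) (first ∷ sorted) = record
    { goods = X.goods ++ goods ; bads = X.bads ++ bads′ ++ bads
    ; equation = begin
        (𝟙 ⊕ step ℓ k) ⊗ ∏ (map factorAt L)
          ≈⟨ distribʳ _ _ _ ⟩
        𝟙 ⊗ ∏ (map factorAt L) ⊕ step ℓ k ⊗ ∏ (map factorAt L)
          ≈⟨ ⊕-cong (≈-trans (⊗-identityˡ _) equation) (≈-trans (⊗-cong ≈-refl equation) (distribˡ _ _ _)) ⟩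
        (G ⊕ B) ⊕ (step ℓ k ⊗ G ⊕ step ℓ k ⊗ B)
          ≈⟨ ⊕-cong ≈-refl (⊕-cong X.equation bads-eq) ⟩
        (G ⊕ B) ⊕ ((G₁ ⊕ B₁) ⊕ B₂)
          ≈⟨ ⊕-comm _ _ ⟩
        ((G₁ ⊕ B₁) ⊕ B₂) ⊕ (G ⊕ B)
          ≈⟨ ⊕-cong (⊕-assoc _ _ _) ≈-refl ⟩
        (G₁ ⊕ (B₁ ⊕ B₂)) ⊕ (G ⊕ B)
          ≈⟨ ⊕-assoc _ _ _ ⟩
        G₁ ⊕ ((B₁ ⊕ B₂) ⊕ (G ⊕ B))
          ≈⟨ ⊕-cong ≈-refl (≈-trans (≈-sym (⊕-assoc _ _ _)) (≈-trans (⊕-cong (⊕-comm _ _) ≈-refl) (⊕-assoc _ _ _))) ⟩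
        G₁ ⊕ (G ⊕ ((B₁ ⊕ B₂) ⊕ B))
          ≈⟨ ⊕-assoc _ _ _ ⟨
        (G₁ ⊕ G) ⊕ ((B₁ ⊕ B₂) ⊕ B)
          ≈⟨ ⊕-cong (≈-sym (∑-map-++ good-term X.goods goods))
              (≈-trans (⊕-assoc _ _ _) (≈-sym (≈-trans (∑-map-++ bad-term X.bads (bads′ ++ bads))
                (⊕-cong ≈-refl (∑-map-++ bad-term bads′ bads))))) ⟩
        ∑ (map good-term (X.goods ++ goods)) ⊕ ∑ (map bad-term (X.bads ++ bads′ ++ bads)) ∎
    ; valid = All.++⁺ (All.map (λ {g′} → valid-origin {g′}) X.origin) (All.map Valid-weaken valid)
    ; complete = λ {T} v → subst (T ∈_) (sym (map-++ filling X.goods goods)) (complete′ v)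
    ; distinct = subst Unique (sym (map-++ filling X.goods goods)) (Unique.++⁺ X.distinct distinct disjoint)
    }
    where
    open Expanded (expanded L sorted)
    fresh : ∀ {T} → Valid L T → Fresh ℓ k T
    fresh v c refl ∈T = ≺-irrefl {n} {N} {ℓ , k} (All.lookup first (Valid.times v c ∈T))
    module X = Extended (extended ℓ k goods distinct (All.map fresh valid))
    bads′ = proj₁ (bad-steps ℓ k bads)
    bads-eq = proj₂ (bad-steps ℓ k bads)
    G = ∑ (map good-term goods)
    B = ∑ (map bad-term bads)
    G₁ = ∑ (map good-term X.goods)
    B₁ = ∑ (map bad-term X.bads)
    B₂ = ∑ (map bad-term bads′)
    valid-origin : ∀ {g′} → Origin ℓ k goods g′ → Valid ((ℓ , k) ∷ L) (filling g′)
    valid-origin (g , c , ∈goods , d , pivot , filling≡) = subst (Valid _) (sym filling≡)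
      (Valid-∷ (Good.shape g) (Good.fills g) {c} pivot d first (All.lookup valid ∈goods))
    complete′ : ∀ {T} → Valid ((ℓ , k) ∷ L) T → T ∈ map filling X.goods ++ map filling goods
    complete′ v with Valid-split first v
    ... | inj₁ v′ = ∈-++⁺ʳ (map filling X.goods) (complete v′)
    ... | inj₂ p with ∈-map⁻ filling (complete (Prefixed.valid p))
    ...   | g , ∈goods , rest≡ = ∈-++⁺ˡ (subst (_∈ map filling X.goods)
            (trans (cong (λ S → ℓ [ Prefixed.cell p ]∷ S) (sym rest≡)) (sym (Prefixed.prefix p)))
            (X.complete {c = Prefixed.cell p} ∈goods (Prefixed.diag≡ p)
              (Prefixed.pivot p (Good.shape g) (Good.lower g) (Good.upper g)
                (subst (Fills (Good.R g)) (sym rest≡) (Good.fills g)))))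
    -- Fillings that use the new factor contain ℓ on the diagonal k; the old ones do not.
    disjoint : ∀ {T} → ¬ (T ∈ map filling X.goods × T ∈ map filling goods)
    disjoint (∈new , ∈old) with ∈-map⁻ filling ∈new | ∈-map⁻ filling ∈old
    ... | g′ , ∈X , refl | g , ∈goods , eq with All.lookup X.origin ∈X
    ...   | g₀ , c , _ , d , _ , filling≡ = fresh (All.lookup valid ∈goods) c d
            (subst (λ S → ℓ ∈ lookup S c) (trans (sym filling≡) eq)
              (subst (ℓ ∈_) (sym (lookup∘updateAt c (filling g₀))) (here refl)))

-- Skew shifted diagrams

-- The first part l fills the first l cells of row 0 and of column 0 of the doubled shape.
doubled : List ℕ → ℕ → ℕ
doubled []       _       = 0
doubled (l ∷ ls) zero    = l
doubled (l ∷ ls) (suc i) with suc i ℕ.<? l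
... | yes _ = suc (doubled ls i)
... | no _  = 0

doubled-suc⁺ : ∀ {l ls i j} → suc i ℕ.< l → j ℕ.< doubled ls i → suc j ℕ.< doubled (l ∷ ls) (suc i)
doubled-suc⁺ {l} {i = i} i<l lt with suc i ℕ.<? l
... | yes _ = s≤s lt
... | no ≮  = ⊥-elim (≮ i<l)

doubled-suc₀ : ∀ {l ls i} → suc i ℕ.< l → 0 ℕ.< doubled (l ∷ ls) (suc i)
doubled-suc₀ {l} {i = i} i<l with suc i ℕ.<? l
... | yes _ = s≤s z≤n
... | no ≮  = ⊥-elim (≮ i<l)

doubled-suc⁻ : ∀ {l ls i j} → j ℕ.< doubled (l ∷ ls) (suc i) → suc i ℕ.< l × pred j ℕ.≤ doubled ls i
doubled-suc⁻ {l} {i = i} {j} lt with suc i ℕ.<? l | lt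
... | yes i<l | s≤s le = i<l , ℕ.≤-trans (ℕ.pred[n]≤n {j}) le

doubled-suc-suc⁻ : ∀ {l ls i j} → suc j ℕ.< doubled (l ∷ ls) (suc i) → j ℕ.< doubled ls i
doubled-suc-suc⁻ {l} {i = i} lt with suc i ℕ.<? l | lt
... | yes _ | s≤s lt′ = lt′

tail-linked : ∀ {l ls} → Linked _>_ (l ∷ ls) → Linked _>_ ls
tail-linked [-]     = []
tail-linked (_ ∷ d) = d

doubled-head : ∀ {l ls} → Linked _>_ (l ∷ ls) → ∀ {i} → i ℕ.< doubled ls 0 → suc i ℕ.< l
doubled-head (l>l′ ∷ _) lt = ℕ.≤-<-trans lt l>l′

-- Strict decrease of the parts enters through `doubled-head`: the columns of the smaller shape,
-- shifted by one, still lie under cells of row 0.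
doubled-shape : ∀ {ps} → Linked _>_ ps → Shape (doubled ps)
doubled-shape {l ∷ ls} d {zero}  {zero}  lt = lt
doubled-shape {l ∷ ls} d {zero}  {suc j} lt = doubled-suc₀ lt
doubled-shape {l ∷ ls} d {suc i} {zero}  lt = proj₁ (doubled-suc⁻ lt)
doubled-shape {l ∷ ls} d {suc i} {suc j} lt = doubled-suc⁺ (doubled-head d (shape (ℕ.≤-<-trans z≤n i<))) i<
  where
  shape = doubled-shape (tail-linked d)
  i< : i ℕ.< doubled ls j
  i< = shape (doubled-suc-suc⁻ lt)

∈-rows⁺ : ∀ t ps {a b} → a ℕ.≤ b → b ℕ.< doubled ps a → (t ℕ.+ a , t ℕ.+ b) ∈ rows t ps
∈-rows⁺ t (l ∷ ls) {zero} {b} _ lt =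
  subst (λ t′ → (t′ , t ℕ.+ b) ∈ rows t (l ∷ ls)) (sym (ℕ.+-identityʳ t))
    (∈-++⁺ˡ (∈-map⁺ (λ k → t , t ℕ.+ k) (∈-upTo⁺ lt)))
∈-rows⁺ t (l ∷ ls) {suc a} {suc b} (s≤s a≤b) lt = ∈-++⁺ʳ (map (λ k → t , t ℕ.+ k) (upTo l))
  (subst₂ (λ x y → (x , y) ∈ rows (suc t) ls) (sym (ℕ.+-suc t a)) (sym (ℕ.+-suc t b))
    (∈-rows⁺ (suc t) ls a≤b (doubled-suc-suc⁻ lt)))

∈-rows⁻ : ∀ t ps {c} → Linked _>_ ps → c ∈ rows t ps →
          ∃[ a ] ∃[ b ] a ℕ.≤ b × b ℕ.< doubled ps a × c ≡ (t ℕ.+ a , t ℕ.+ b)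
∈-rows⁻ t (l ∷ ls) d c∈ with ∈-++⁻ (map (λ k → t , t ℕ.+ k) (upTo l)) c∈
... | inj₁ ∈row with b , b∈ , refl ← ∈-map⁻ (λ k → t , t ℕ.+ k) ∈row =
      0 , b , z≤n , ∈-upTo⁻ b∈ , cong (_, t ℕ.+ b) (sym (ℕ.+-identityʳ t))
... | inj₂ ∈rows with a , b , a≤b , lt , refl ← ∈-rows⁻ (suc t) ls (tail-linked d) ∈rows =
      suc a , suc b , s≤s a≤b ,
      doubled-suc⁺ (doubled-head d (doubled-shape (tail-linked d) (ℕ.≤-<-trans z≤n lt))) lt ,
      cong₂ _,_ (sym (ℕ.+-suc t a)) (sym (ℕ.+-suc t b))

rows-≥ : ∀ t ps {c} → c ∈ rows t ps → t ℕ.≤ proj₁ c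
rows-≥ t (l ∷ ls) c∈ with ∈-++⁻ (map (λ k → t , t ℕ.+ k) (upTo l)) c∈
... | inj₁ ∈row with _ , _ , refl ← ∈-map⁻ (λ k → t , t ℕ.+ k) ∈row = ℕ.≤-refl
... | inj₂ ∈rows = ℕ.≤-trans (ℕ.n≤1+n t) (rows-≥ (suc t) ls ∈rows)

rows-unique : ∀ t ps → Unique (rows t ps)
rows-unique t []       = []
rows-unique t (l ∷ ls) = Unique.++⁺
  (Unique.map⁺ (λ eq → ℕ.+-cancelˡ-≡ t _ _ (cong proj₂ eq)) (Unique.upTo⁺ l))
  (rows-unique (suc t) ls)
  λ { (∈row , ∈rows) → disjoint (∈-map⁻ (λ k → t , t ℕ.+ k) ∈row) ∈rows }
  where
  disjoint : ∀ {c} → ∃[ k ] k ∈ upTo l × c ≡ (t , t ℕ.+ k) → ¬ c ∈ rows (suc t) ls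
  disjoint (_ , _ , refl) ∈rows = ℕ.<-irrefl refl (rows-≥ (suc t) ls ∈rows)

lookup-injective : ∀ {A : Set} {xs : List A} → Unique xs → ∀ i j → List.lookup xs i ≡ List.lookup xs j → i ≡ j
lookup-injective (_ ∷ _)  Fin.zero    Fin.zero    _  = refl
lookup-injective (x∉ ∷ _) Fin.zero    (Fin.suc j) eq = ⊥-elim (All.lookup x∉ (∈-lookup j) eq)
lookup-injective (x∉ ∷ _) (Fin.suc i) Fin.zero    eq = ⊥-elim (All.lookup x∉ (∈-lookup i) (sym eq))
lookup-injective (_ ∷ u)  (Fin.suc i) (Fin.suc j) eq = cong Fin.suc (lookup-injective u i j eq)

doubledˢ : StrictPartition → ℕ → ℕ
doubledˢ p = doubled (parts p)

doubledˢ-shape : ∀ p → Shape (doubledˢ p)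
doubledˢ-shape p = doubled-shape (StrictPartition.decreasing p)

∈-D⁺ : ∀ p {a b} → a ℕ.≤ b → b ℕ.< doubledˢ p a → (suc a , suc b) ∈ D p
∈-D⁺ p = ∈-rows⁺ 1 (parts p)

∈-D⁻ : ∀ p {c} → c ∈ D p → ∃[ a ] ∃[ b ] a ℕ.≤ b × b ℕ.< doubledˢ p a × c ≡ (suc a , suc b)
∈-D⁻ p = ∈-rows⁻ 1 (parts p) (StrictPartition.decreasing p)

∈-D-inside : ∀ p {a b} → (suc a , suc b) ∈ D p → b ℕ.< doubledˢ p a
∈-D-inside p c∈ with _ , _ , _ , lt , refl ← ∈-D⁻ p c∈ = lt

module Skew (μ ν : StrictPartition) where

  private
    _≟_ = ≡-dec ℕ._≟_ ℕ._≟_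

  skew : List Cell
  skew = ν ∖ μ

  -- Containment of the shifted diagrams covers the cells on and above the main diagonal; the others
  -- follow by symmetry.
  doubled-⊆ : μ ⊆ˢ ν → ∀ i → doubledˢ μ i ℕ.≤ doubledˢ ν i
  doubled-⊆ μ⊆ν i = ℕ.≮⇒≥ λ lt → ℕ.<-irrefl refl (transfer lt)
    where
    transfer : ∀ {j} → j ℕ.< doubledˢ μ i → j ℕ.< doubledˢ ν i
    transfer {j} lt with ℕ.≤-total i j
    ... | inj₁ i≤j = ∈-D-inside ν (μ⊆ν (∈-D⁺ μ i≤j lt))
    ... | inj₂ j≤i = doubledˢ-shape ν (∈-D-inside ν (μ⊆ν (∈-D⁺ μ j≤i (doubledˢ-shape μ lt))))

  -- The n of the theorem: the largest part of ν bounds all rows, so every cell lies on one of the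
  -- diagonals 0, ..., n - 1. It is 0 if ν is empty.
  bound : ℕ
  bound = doubledˢ ν 0

  doubled-bounded : ∀ i → doubledˢ ν i ℕ.≤ bound
  doubled-bounded i = Shape-antitone (doubledˢ-shape ν) z≤n

  cell-spec : ∀ c → ∃[ a ] ∃[ b ] a ℕ.≤ b × b ℕ.< doubledˢ ν a × doubledˢ μ a ℕ.≤ b ×
              List.lookup skew c ≡ (suc a , suc b)
  cell-spec c with ∈ν , ∉μ ← ∈-filter⁻ (λ c → ¬? (_∈?_ _≟_ c (D μ))) {xs = D ν} (∈-lookup c)
    with a , b , a≤b , lt , eq ← ∈-D⁻ ν ∈ν =
    a , b , a≤b , lt , ℕ.≮⇒≥ (λ lt′ → ∉μ (subst (_∈ D μ) (sym eq) (∈-D⁺ μ a≤b lt′))) , eq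

  row col : Fin (length skew) → ℕ
  row c = proj₁ (cell-spec c)
  col c = proj₁ (proj₂ (cell-spec c))
  lookup-skew : ∀ c → List.lookup skew c ≡ (suc (row c) , suc (col c))
  lookup-skew c = proj₂ (proj₂ (proj₂ (proj₂ (proj₂ (cell-spec c)))))

  skew-cells : Cells bound (length skew) (doubledˢ μ) (doubledˢ ν)
  skew-cells = record
    { row = row ; col = col
    ; diag = λ c → fromℕ< (diag< c)
    ; diag+row = λ c → trans (cong (ℕ._+ row c) (Fin.toℕ-fromℕ< (diag< c)))
        (ℕ.m∸n+n≡m (proj₁ (proj₂ (proj₂ (cell-spec c)))))
    ; inside = λ c → proj₁ (proj₂ (proj₂ (proj₂ (cell-spec c))))
    ; outside-μ = λ c → proj₁ (proj₂ (proj₂ (proj₂ (proj₂ (cell-spec c)))))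
    ; cell-injective = λ {c} {c′} r≡ c≡ → lookup-injective skew-unique c c′
        (trans (lookup-skew c) (trans (cong₂ (λ a b → suc a , suc b) r≡ c≡) (sym (lookup-skew c′))))
    ; find = find
    }
    where
    diag< : ∀ c → col c ∸ row c ℕ.< bound
    diag< c = ℕ.≤-<-trans (ℕ.m∸n≤m (col c) (row c))
      (ℕ.<-≤-trans (proj₁ (proj₂ (proj₂ (proj₂ (cell-spec c))))) (doubled-bounded (row c)))
    skew-unique : Unique skew
    skew-unique = Unique.filter⁺ (λ c → ¬? (_∈?_ _≟_ c (D μ))) (rows-unique 1 (parts ν))
    find : ∀ {a b} → a ℕ.≤ b → b ℕ.< doubledˢ ν a → doubledˢ μ a ℕ.≤ b → ∃[ c ] row c ≡ a × col c ≡ b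
    find {a} {b} a≤b lt le = Any.index c∈ , ℕ.suc-injective (cong proj₁ eq) , ℕ.suc-injective (cong proj₂ eq)
      where
      c∈ : (suc a , suc b) ∈ skew
      c∈ = ∈-filter⁺ (λ c → ¬? (_∈?_ _≟_ c (D μ))) (∈-D⁺ ν a≤b lt)
        λ c∈μ → ℕ.<⇒≱ (∈-D-inside μ c∈μ) le
      eq : (suc (row (Any.index c∈)) , suc (col (Any.index c∈))) ≡ (suc a , suc b)
      eq = trans (sym (lookup-skew (Any.index c∈))) (sym (Any.lookup-index c∈))

-- The factors of the Cauchy product

reverse-AllPairs : ∀ {A : Set} {R : A → A → Set} {xs} → AllPairs R xs → AllPairs (flip R) (reverse xs)
reverse-AllPairs [] = []
reverse-AllPairs {R = R} {x ∷ xs} (p ∷ ps) = subst (AllPairs (flip R)) (sym (unfold-reverse x xs))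
  (AllPairs.++⁺ (reverse-AllPairs ps) ([] ∷ [])
    (All.map (_∷ []) (All.tabulate λ y∈ → All.lookup p (Any.reverse⁻ y∈))))

block : ∀ n {N} → Fin N → List (Time n N)
block n a = map ((Sign.- , a) ,_) (reverse (allFin n)) ++ map ((Sign.+ , a) ,_) (allFin n)

allTimes : ∀ n N → List (Time n N)
allTimes n N = concatMap (block n) (allFin N)

∈-allTimes : ∀ {n N} (t : Time n N) → t ∈ allTimes n N
∈-allTimes ((Sign.- , a) , k) = ∈-concatMap⁺ (block _) (Any.map
  (λ { refl → ∈-++⁺ˡ (∈-map⁺ ((Sign.- , a) ,_) (Any.reverse⁺ (∈-allFin k))) }) (∈-allFin a))
∈-allTimes {n} ((Sign.+ , a) , k) = ∈-concatMap⁺ (block _) (Any.map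
  (λ { refl → ∈-++⁺ʳ (map ((Sign.- , a) ,_) (reverse (allFin n))) (∈-map⁺ ((Sign.+ , a) ,_) (∈-allFin k)) })
  (∈-allFin a))

rank-lower : ∀ {N} (p : ±[ N ]) → 2 ℕ.* toℕ (proj₂ p) ℕ.≤ rank p
rank-lower (Sign.- , a) = ℕ.≤-refl
rank-lower (Sign.+ , a) = ℕ.n≤1+n _

rank-upper : ∀ {N} (p : ±[ N ]) → rank p ℕ.≤ suc (2 ℕ.* toℕ (proj₂ p))
rank-upper (Sign.- , a) = ℕ.n≤1+n _
rank-upper (Sign.+ , a) = ℕ.≤-refl

rank-< : ∀ {N} {p q : ±[ N ]} → proj₂ p Fin.< proj₂ q → p <ʳ q
rank-< {p = p} {q} lt = ℕ.<-≤-trans (s≤s (rank-upper p))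
  (ℕ.≤-trans (ℕ.≤-reflexive (sym (ℕ.*-suc 2 (toℕ (proj₂ p)))))
    (ℕ.≤-trans (ℕ.*-monoʳ-≤ 2 lt) (rank-lower q)))

rank-injective : ∀ {N} {p q : ±[ N ]} → rank p ≡ rank q → p ≡ q
rank-injective {p = p} {q} eq with Fin.<-cmp (proj₂ p) (proj₂ q)
... | tri< lt _ _ = ⊥-elim (ℕ.<-irrefl eq (rank-< {p = p} {q} lt))
... | tri> _ _ gt = ⊥-elim (ℕ.<-irrefl (sym eq) (rank-< {p = q} {p} gt))
rank-injective {p = Sign.- , a} {Sign.- , _} eq | tri≈ _ refl _ = refl
rank-injective {p = Sign.+ , a} {Sign.+ , _} eq | tri≈ _ refl _ = refl
rank-injective {p = Sign.- , a} {Sign.+ , _} eq | tri≈ _ refl _ = ⊥-elim (ℕ.1+n≢n (sym eq))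
rank-injective {p = Sign.+ , a} {Sign.- , _} eq | tri≈ _ refl _ = ⊥-elim (ℕ.1+n≢n eq)

allFin-sorted : ∀ n → AllPairs Fin._<_ (allFin n)
allFin-sorted n = AllPairs.tabulate⁺-< id

concatMap-sorted : ∀ {A : Set} {N} {R : A → A → Set} (f : Fin N → List A) → (∀ a → AllPairs R (f a)) →
                   (∀ {a b} → a Fin.< b → ∀ {x y} → x ∈ f a → y ∈ f b → R x y) →
                   AllPairs R (concatMap f (allFin N))
concatMap-sorted {N = N} f sorted across = AllPairs.concat⁺
  (All.map⁺ (All.universal sorted (allFin N)))
  (AllPairs.map⁺ (AllPairs.map (λ a<b → All.tabulate λ x∈ → All.tabulate λ y∈ → across a<b x∈ y∈)
    (allFin-sorted N)))

∈-block⁻ : ∀ {n N} {a : Fin N} {t : Time n N} → t ∈ block n a → proj₂ (proj₁ t) ≡ a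
∈-block⁻ {n} {a = a} t∈ with ∈-++⁻ (map ((Sign.- , a) ,_) (reverse (allFin n))) t∈
... | inj₁ t∈⁻ with _ , _ , refl ← ∈-map⁻ ((Sign.- , a) ,_) t∈⁻ = refl
... | inj₂ t∈⁺ with _ , _ , refl ← ∈-map⁻ ((Sign.+ , a) ,_) t∈⁺ = refl

allTimes-sorted : ∀ n N → AllPairs _≺_ (allTimes n N)
allTimes-sorted n N = concatMap-sorted (block n) block-sorted
  λ {_} {_} a<b {s} {t} s∈ t∈ → inj₁ (rank-< {p = proj₁ s} {proj₁ t}
    (subst₂ Fin._<_ (sym (∈-block⁻ s∈)) (sym (∈-block⁻ t∈)) a<b))
  where
  block-sorted : ∀ a → AllPairs _≺_ (block n a)
  block-sorted a = AllPairs.++⁺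
    (AllPairs.map⁺ (AllPairs.map (λ lt → inj₂ (refl , lt)) (reverse-AllPairs (allFin-sorted n))))
    (AllPairs.map⁺ (AllPairs.map (λ lt → inj₂ (refl , lt)) (allFin-sorted n)))
    (All.map⁺ (All.universal (λ _ → All.map⁺ (All.universal (λ _ → inj₁ ℕ.≤-refl) _)) _))

module _ (n N : ℕ) where

  open HeckeProperties n N

  cauchyProduct≈ : cauchyProduct n N ≈ ∏ (map factorAt (allTimes n N))
  cauchyProduct≈ = blocks (allFin N)
    where
    factor≡ : ∀ a → factor n a ≡ ∏ (map factorAt (block n a))
    factor≡ a = cong ∏ (trans (map-++ _ (reverse (allFin n)) (allFin n))
      (sym (trans (map-++ factorAt (map ((Sign.- , a) ,_) (reverse (allFin n))) _)
        (cong₂ _++_ (sym (map-∘ (reverse (allFin n)))) (sym (map-∘ (allFin n)))))))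
    blocks : ∀ as → ∏ (map (factor n) as) ≈ ∏ (map factorAt (concatMap (block n) as))
    blocks []       = ≈-refl
    blocks (a ∷ as) = ≈-trans
      (⊗-cong (subst (factor n a ≈_) (factor≡ a) ≈-refl) (blocks as))
      (≈-sym (subst (λ ts → ∏ ts ≈ ∏ (map factorAt (block n a)) ⊗ ∏ (map factorAt (concatMap (block n) as)))
        (sym (map-++ factorAt (block n a) (concatMap (block n) as))) (∏-++ (map factorAt (block n a)) (map factorAt (concatMap (block n) as)))))

letters-sorted : ∀ N → AllPairs _<ʳ_ (letters N)
letters-sorted N = concatMap-sorted _ (λ a → (ℕ.≤-refl ∷ []) ∷ [] ∷ [])
  λ {_} {_} a<b {p} {q} p∈ q∈ → rank-< {p = p} {q} (subst₂ Fin._<_ (sym (index p∈)) (sym (index q∈)) a<b)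
  where
  index : ∀ {N} {a : Fin N} {p} → p ∈ (Sign.- , a) ∷ (Sign.+ , a) ∷ [] → proj₂ p ≡ a
  index (here refl)         = refl
  index (there (here refl)) = refl

∈-letters : ∀ {N} (p : ±[ N ]) → p ∈ letters N
∈-letters (Sign.- , a) = ∈-concatMap⁺ _ (Any.map (λ { refl → here refl }) (∈-allFin a))
∈-letters (Sign.+ , a) = ∈-concatMap⁺ _ (Any.map (λ { refl → there (here refl) }) (∈-allFin a))

-- Set-valued tableaux

module _ {A : Set} where

  last-spec : ∀ (e : List⁺ A) → ∃[ xs ] toList e ≡ xs ++ List⁺.last e ∷ []
  last-spec e with List⁺.snocView e
  ... | []       ∷ʳ′ y = [] , refl
  ... | (x ∷ xs) ∷ʳ′ y = x ∷ xs , refl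

  AllPairs-∷ʳ : ∀ {R : A → A → Set} xs {y} → AllPairs R (xs ++ y ∷ []) → All (λ x → R x y) xs
  AllPairs-∷ʳ []       _        = []
  AllPairs-∷ʳ (x ∷ xs) (p ∷ ps) = All.lookup p (∈-++⁺ʳ xs (here refl)) ∷ AllPairs-∷ʳ xs ps

  []∈sublists : ∀ (ys : List A) → [] ∈ sublists ys
  []∈sublists []       = here refl
  []∈sublists (y ∷ ys) = ∈-++⁺ʳ (map (y ∷_) (sublists ys)) ([]∈sublists ys)

  sublists⇒⊆ : ∀ ys {xs : List A} → xs ∈ sublists ys → ∀ {x} → x ∈ xs → x ∈ ys
  sublists⇒⊆ [] (here refl) ()
  sublists⇒⊆ (y ∷ ys) xs∈ x∈ with ∈-++⁻ (map (y ∷_) (sublists ys)) xs∈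
  ... | inj₂ xs∈′ = there (sublists⇒⊆ ys xs∈′ x∈)
  ... | inj₁ xs∈′ with _ , zs∈ , refl ← ∈-map⁻ (y ∷_) xs∈′ | x∈
  ...   | here refl  = here refl
  ...   | there x∈zs = there (sublists⇒⊆ ys zs∈ x∈zs)

  sublists-unique : ∀ {ys : List A} → Unique ys → Unique (sublists ys)
  sublists-unique {[]}     _          = [] ∷ []
  sublists-unique {y ∷ ys} (y∉ ∷ ys!) = Unique.++⁺
    (Unique.map⁺ (λ { refl → refl }) (sublists-unique ys!)) (sublists-unique ys!)
    λ { (xs∈ , xs∈′) → disjoint (∈-map⁻ (y ∷_) xs∈) xs∈′ }
    where
    disjoint : ∀ {xs} → ∃[ zs ] zs ∈ sublists ys × xs ≡ y ∷ zs → ¬ xs ∈ sublists ys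
    disjoint (_ , _ , refl) xs∈ = All.lookup y∉ (sublists⇒⊆ ys xs∈ (here refl)) refl

  module _ {R : A → A → Set} where

    sublists-AllPairs : ∀ {ys xs} → AllPairs R ys → xs ∈ sublists ys → AllPairs R xs
    sublists-AllPairs {[]} _ (here refl) = []
    sublists-AllPairs {y ∷ ys} (p ∷ ps) xs∈ with ∈-++⁻ (map (y ∷_) (sublists ys)) xs∈
    ... | inj₂ xs∈′ = sublists-AllPairs ps xs∈′
    ... | inj₁ xs∈′ with _ , zs∈ , refl ← ∈-map⁻ (y ∷_) xs∈′ =
      All.tabulate (λ z∈ → All.lookup p (sublists⇒⊆ ys zs∈ z∈)) ∷ sublists-AllPairs ps zs∈

    -- Sets are represented by increasing lists. Asymmetry rules out that an element of `ys` already
    -- passed occurs later in `xs`, so containment of members is enough.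
    ∈-sublists⁺ : (∀ {x y} → R x y → ¬ R y x) → ∀ {ys xs} → AllPairs R ys → AllPairs R xs →
                  (∀ {x} → x ∈ xs → x ∈ ys) → xs ∈ sublists ys
    ∈-sublists⁺ asym {ys} {[]} _ _ _ = []∈sublists ys
    ∈-sublists⁺ asym {[]} {x ∷ xs} _ _ sub with () ← sub (here refl)
    ∈-sublists⁺ asym {y ∷ ys} {x ∷ xs} (p ∷ ps) (q ∷ qs) sub with sub (here refl)
    ... | here refl = ∈-++⁺ˡ (∈-map⁺ (y ∷_) (∈-sublists⁺ asym ps qs later))
      where
      later : ∀ {z} → z ∈ xs → z ∈ ys
      later z∈ with sub (there z∈)
      ... | here refl = ⊥-elim (asym (All.lookup q z∈) (All.lookup q z∈))
      ... | there z∈ys = z∈ys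
    ... | there x∈ = ∈-++⁺ʳ (map (y ∷_) (sublists ys)) (∈-sublists⁺ asym ps (q ∷ qs) later)
      where
      later : ∀ {z} → z ∈ x ∷ xs → z ∈ ys
      later (here refl) = x∈
      later (there z∈) with sub (there z∈)
      ... | here refl = ⊥-elim (asym (All.lookup q z∈) (All.lookup p x∈))
      ... | there z∈ys = z∈ys

  ∈-fromLists⁻ : ∀ (xss : List (List A)) {e} → e ∈ mapMaybe List⁺.fromList xss → toList e ∈ xss
  ∈-fromLists⁻ ([] ∷ xss)       e∈          = there (∈-fromLists⁻ xss e∈)
  ∈-fromLists⁻ ((x ∷ xs) ∷ xss) (here refl) = here refl
  ∈-fromLists⁻ ((x ∷ xs) ∷ xss) (there e∈)  = there (∈-fromLists⁻ xss e∈)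

  ∈-fromLists⁺ : ∀ (xss : List (List A)) {e} → toList e ∈ xss → e ∈ mapMaybe List⁺.fromList xss
  ∈-fromLists⁺ ((x ∷ xs) ∷ xss) (here refl) = here refl
  ∈-fromLists⁺ ([] ∷ xss)       (there e∈)  = ∈-fromLists⁺ xss e∈
  ∈-fromLists⁺ ((x ∷ xs) ∷ xss) (there e∈)  = there (∈-fromLists⁺ xss e∈)

  fromLists-unique : ∀ {xss : List (List A)} → Unique xss → Unique (mapMaybe List⁺.fromList xss)
  fromLists-unique {[]} _ = []
  fromLists-unique {[] ∷ xss} (_ ∷ u) = fromLists-unique u
  fromLists-unique {(x ∷ xs) ∷ xss} (xs∉ ∷ u) =
    All.tabulate (λ e∈ eq → All.lookup xs∉ (∈-fromLists⁻ xss e∈) (cong toList eq)) ∷ fromLists-unique u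

  ∈-vectors⁺ : ∀ (as : List A) {m} (v : Vec A m) → (∀ c → lookup v c ∈ as) → v ∈ vectors as m
  ∈-vectors⁺ as []      _  = here refl
  ∈-vectors⁺ as (a ∷ v) ∈s = ∈-cartesianProductWith⁺ Vec._∷_ (∈s Fin.zero) (∈-vectors⁺ as v (∈s ∘ Fin.suc))

  ∈-vectors⁻ : ∀ (as : List A) {m} {v : Vec A m} → v ∈ vectors as m → ∀ c → lookup v c ∈ as
  ∈-vectors⁻ as {suc m} v∈ c with _ , _ , a∈ , v∈′ , refl ← ∈-cartesianProductWith⁻ Vec._∷_ as (vectors as m) v∈ | c
  ... | Fin.zero  = a∈
  ... | Fin.suc c = ∈-vectors⁻ as v∈′ c

  vectors-unique : ∀ {as : List A} → Unique as → ∀ m → Unique (vectors as m)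
  vectors-unique u zero    = [] ∷ []
  vectors-unique u (suc m) =
    Unique.cartesianProductWith⁺ Vec._∷_ (λ { refl → refl , refl }) u (vectors-unique u m)

  toList-injective : ∀ {e e′ : List⁺ A} → toList e ≡ toList e′ → e ≡ e′
  toList-injective {_ ∷ _} {_ ∷ _} refl = refl

  erase : ∀ {m} → Vec (List⁺ A) m → Vec (List A) m
  erase = Vec.map toList

  erase-injective : ∀ {m} {v w : Vec (List⁺ A) m} → erase v ≡ erase w → v ≡ w
  erase-injective {v = []}    {[]}    _  = refl
  erase-injective {v = e ∷ v} {f ∷ w} eq =
    cong₂ _∷_ (toList-injective (cong Vec.head eq)) (erase-injective (cong Vec.tail eq))

  unerase : ∀ {m} (v : Vec (List A) m) → (∀ c → lookup v c ≢ []) → ∃[ w ] erase w ≡ v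
  unerase []             _  = [] , refl
  unerase ([] ∷ v)       ne = ⊥-elim (ne Fin.zero refl)
  unerase ((x ∷ xs) ∷ v) ne with w , refl ← unerase v (ne ∘ Fin.suc) = (x ∷ xs) ∷ w , refl

module _ {N : ℕ} where

  minᴱ-≤ : ∀ {e : Entry N} → AllPairs _<ʳ_ (toList e) → ∀ {ℓ} → ℓ ∈ toList e → minᴱ e ≡ ℓ ⊎ minᴱ e <ʳ ℓ
  minᴱ-≤ _       (here refl) = inj₁ refl
  minᴱ-≤ (p ∷ _) (there ℓ∈)  = inj₂ (All.lookup p ℓ∈)

  maxᴱ-≥ : ∀ {e : Entry N} → AllPairs _<ʳ_ (toList e) → ∀ {ℓ} → ℓ ∈ toList e → ℓ ≡ maxᴱ e ⊎ ℓ <ʳ maxᴱ e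
  maxᴱ-≥ {e} sorted ℓ∈ with xs , eq ← last-spec e with ∈-++⁻ xs (subst (_ ∈_) eq ℓ∈)
  ... | inj₁ ℓ∈xs       = inj₂ (All.lookup (AllPairs-∷ʳ xs (subst (AllPairs _<ʳ_) eq sorted)) ℓ∈xs)
  ... | inj₂ (here ℓ≡) = inj₁ ℓ≡

  minᴱ-∈ : ∀ (e : Entry N) → minᴱ e ∈ toList e
  minᴱ-∈ (_ ∷ _) = here refl

  maxᴱ-∈ : ∀ (e : Entry N) → maxᴱ e ∈ toList e
  maxᴱ-∈ e with xs , eq ← last-spec e = subst (maxᴱ e ∈_) (sym eq) (∈-++⁺ʳ xs (here refl))

  ∈-entries⁺ : ∀ {e : Entry N} → AllPairs _<ʳ_ (toList e) → e ∈ entries N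
  ∈-entries⁺ {e} sorted = ∈-fromLists⁺ (sublists (letters N))
    (∈-sublists⁺ ℕ.<-asym (letters-sorted N) sorted λ {p} _ → ∈-letters p)

  ∈-entries⁻ : ∀ {e : Entry N} → e ∈ entries N → AllPairs _<ʳ_ (toList e)
  ∈-entries⁻ {e} e∈ = sublists-AllPairs (letters-sorted N) (∈-fromLists⁻ (sublists (letters N)) e∈)

  entries-unique : Unique (entries N)
  entries-unique = fromLists-unique (sublists-unique
    (AllPairs.map (λ { lt refl → ℕ.<-irrefl refl lt }) (letters-sorted N)))

  module _ {n : ℕ} {k k′ : Fin n} {S T : Entry N} where

    -- If the two extreme letters coincide, the sign that the tableau allows must be the one whose
    -- half of the factor runs from k to `k′`; this is what `turn` supplies.
    Precedes⇒≺ : ∀ {τ} → (∀ {σ} → σ ≡ τ → InTurn σ k k′) → Precedes τ S T → (maxᴱ S , k) ≺ (minᴱ T , k′)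
    Precedes⇒≺ turn (le , sign) with ℕ.m≤n⇒m<n∨m≡n le
    ... | inj₁ lt = inj₁ lt
    ... | inj₂ eq = inj₂ (max≡min , turn (sign max≡min))
      where
      max≡min : maxᴱ S ≡ minᴱ T
      max≡min = rank-injective eq

    ≺⇒Precedes : ∀ {τ} → (∀ {σ} → InTurn σ k k′ → σ ≡ τ) → (maxᴱ S , k) ≺ (minᴱ T , k′) → Precedes τ S T
    ≺⇒Precedes turn (inj₁ lt)        = ℕ.<⇒≤ lt , λ eq → ⊥-elim (ℕ.<-irrefl (cong rank eq) lt)
    ≺⇒Precedes turn (inj₂ (eq , it)) = ℕ.≤-reflexive (cong rank eq) , λ _ → turn it

  InTurn-+ : ∀ {n} {k k′ : Fin n} → toℕ k′ ≡ suc (toℕ k) →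
    ∀ {σ} → (σ ≡ Sign.+ → InTurn σ k k′) × (InTurn σ k k′ → σ ≡ Sign.+)
  InTurn-+ eq = (λ { refl → ℕ.≤-reflexive (sym eq) }) , positive _
    where
    positive : ∀ σ → InTurn σ _ _ → σ ≡ Sign.+
    positive Sign.+ _  = refl
    positive Sign.- lt = ⊥-elim (ℕ.<-asym lt (ℕ.≤-reflexive (sym eq)))

  InTurn-- : ∀ {n} {k k′ : Fin n} → toℕ k ≡ suc (toℕ k′) →
    ∀ {σ} → (σ ≡ Sign.- → InTurn σ k k′) × (InTurn σ k k′ → σ ≡ Sign.-)
  InTurn-- eq = (λ { refl → ℕ.≤-reflexive (sym eq) }) , negative _
    where
    negative : ∀ σ → InTurn σ _ _ → σ ≡ Sign.-
    negative Sign.- _  = refl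
    negative Sign.+ lt = ⊥-elim (ℕ.<-asym lt (ℕ.≤-reflexive (sym eq)))

-- Tableaux as valid fillings without empty cells

module Tableaux (N : ℕ) {n : ℕ} {Rμ Rν : ℕ → ℕ} (shapeμ : Shape Rμ) (shapeν : Shape Rν) (skew : List Cell)
                (cells : Cells n (length skew) Rμ Rν)
                (lookup-skew : ∀ c → List.lookup skew c ≡ (suc (Cells.row cells c) , suc (Cells.col cells c))) where

  open Cells cells
  open Fillings N shapeμ shapeν cells

  Full : PreFilling → Set
  Full T = ∀ c → lookup T c ≢ []

  Adjacent : Fin (length skew) → Fin (length skew) → Sign → Set
  Adjacent c c′ Sign.+ = row c′ ≡ row c × col c′ ≡ suc (col c)
  Adjacent c c′ Sign.- = row c′ ≡ suc (row c) × col c′ ≡ col c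

  adjacent-⋖ : ∀ {c c′} τ → Adjacent c c′ τ → c ⋖ c′
  adjacent-⋖ Sign.+ (r≡ , c≡) = ℕ.≤-reflexive (sym r≡) , ℕ.≤-trans (ℕ.n≤1+n _) (ℕ.≤-reflexive (sym c≡)) ,
    λ { refl → ℕ.1+n≢n (sym c≡) }
  adjacent-⋖ Sign.- (r≡ , c≡) = ℕ.≤-trans (ℕ.n≤1+n _) (ℕ.≤-reflexive (sym r≡)) , ℕ.≤-reflexive (sym c≡) ,
    λ { refl → ℕ.1+n≢n (sym r≡) }

  adjacent-turn : ∀ {c c′} τ → Adjacent c c′ τ → ∀ {σ} →
    (σ ≡ τ → InTurn σ (diag c) (diag c′)) × (InTurn σ (diag c) (diag c′) → σ ≡ τ)
  adjacent-turn {c} {c′} Sign.+ (r≡ , c≡) = InTurn-+ {N} {k = diag c} {diag c′} (ℕ.+-cancelʳ-≡ (row c) _ _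
    (trans (cong (toℕ (diag c′) ℕ.+_) (sym r≡)) (trans (diag+row c′) (trans c≡ (cong suc (sym (diag+row c)))))))
  adjacent-turn {c} {c′} Sign.- (r≡ , c≡) = InTurn-- {N} {k = diag c} {diag c′} (ℕ.+-cancelʳ-≡ (row c) _ _
    (trans (diag+row c) (trans (sym c≡) (trans (sym (diag+row c′))
      (trans (cong (toℕ (diag c′) ℕ.+_) r≡) (ℕ.+-suc (toℕ (diag c′)) (row c)))))))

  Follows : Filling N skew → Set
  Follows T = ∀ {c c′} τ → Adjacent c c′ τ → Precedes τ (lookup T c) (lookup T c′)

  IsTableau⇒Follows : ∀ {T} → IsTableau skew T → Follows T
  IsTableau⇒Follows tab {c} {c′} Sign.+ (r≡ , c≡) = proj₂ (tab c c′)
    (trans (lookup-skew c′) (trans (cong₂ (λ i j → suc i , suc j) r≡ c≡) (cong right (sym (lookup-skew c)))))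
  IsTableau⇒Follows tab {c} {c′} Sign.- (r≡ , c≡) = proj₁ (tab c c′)
    (trans (lookup-skew c′) (trans (cong₂ (λ i j → suc i , suc j) r≡ c≡) (cong below (sym (lookup-skew c)))))

  Follows⇒IsTableau : ∀ {T} → Follows T → IsTableau skew T
  Follows⇒IsTableau follows c c′ =
    (λ eq → follows Sign.- (coordinates (trans (sym (lookup-skew c′)) (trans eq (cong below (lookup-skew c)))))) ,
    (λ eq → follows Sign.+ (coordinates (trans (sym (lookup-skew c′)) (trans eq (cong right (lookup-skew c))))))
    where
    coordinates : ∀ {i j i′ j′} → _≡_ {A = Cell} (suc i , suc j) (suc i′ , suc j′) → i ≡ i′ × j ≡ j′
    coordinates refl = refl , refl

  module _ {T : Filling N skew} (sorted : ∀ c → AllPairs _<ʳ_ (toList (lookup T c))) (follows : Follows T) where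

    private
      Before : Fin (length skew) → Fin (length skew) → Set
      Before c c′ = (maxᴱ (lookup T c) , diag c) ≺ (minᴱ (lookup T c′) , diag c′)

      before-adjacent : ∀ {c c′} τ → Adjacent c c′ τ → Before c c′
      before-adjacent {c} {c′} τ adj = Precedes⇒≺ {k = diag c} {diag c′} {lookup T c} {lookup T c′}
        (proj₁ (adjacent-turn {c} {c′} τ adj)) (follows τ adj)

      ≺-within : ∀ {ℓ ℓ′ k} {t : Time n N} → ℓ ≡ ℓ′ ⊎ ℓ <ʳ ℓ′ → (ℓ′ , k) ≺ t → (ℓ , k) ≺ t
      ≺-within (inj₁ refl) ≺t = ≺t
      ≺-within {ℓ} {ℓ′} {k} {t} (inj₂ lt) ≺t = ≺-trans {t = ℓ , k} {ℓ′ , k} {t} (inj₁ lt) ≺t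

      within-≺ : ∀ {ℓ ℓ′ k} {t : Time n N} → ℓ ≡ ℓ′ ⊎ ℓ <ʳ ℓ′ → t ≺ (ℓ , k) → t ≺ (ℓ′ , k)
      within-≺ (inj₁ refl) t≺ = t≺
      within-≺ {ℓ} {ℓ′} {k} {t} (inj₂ lt) t≺ = ≺-trans {t = t} {ℓ , k} {ℓ′ , k} t≺ (inj₁ lt)

      before-trans : ∀ {c c′ c″} → Before c c′ → Before c′ c″ → Before c c″
      before-trans {c} {c′} {c″} p q =
        ≺-trans {t = maxᴱ (lookup T c) , diag c} {minᴱ (lookup T c′) , diag c′} {minᴱ (lookup T c″) , diag c″} p
          (≺-within {minᴱ (lookup T c′)} {maxᴱ (lookup T c′)} (maxᴱ-≥ (sorted c′) (minᴱ-∈ (lookup T c′))) q)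

      before-right : ∀ d {c c′} → row c′ ≡ row c → col c′ ≡ suc d ℕ.+ col c → Before c c′
      before-right zero r≡ c≡ = before-adjacent Sign.+ (r≡ , c≡)
      before-right (suc d) {c} {c′} r≡ c≡ with find (ℕ.≤-trans (row≤col c) (ℕ.n≤1+n (col c)))
          (ℕ.≤-<-trans (subst (suc (col c) ℕ.≤_) (sym c≡) (s≤s (ℕ.m≤n+m (col c) (suc d))))
            (subst (λ i → col c′ ℕ.< Rν i) r≡ (inside c′)))
          (ℕ.≤-trans (outside-μ c) (ℕ.n≤1+n (col c)))
      ... | x , xr≡ , xc≡ = before-trans {c} {x} {c′} (before-adjacent Sign.+ (xr≡ , xc≡))
            (before-right d (trans r≡ (sym xr≡)) (trans c≡ (trans (sym (ℕ.+-suc (suc d) (col c))) (cong (suc d ℕ.+_) (sym xc≡)))))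

      before-below : ∀ d {c c′} → col c′ ≡ col c → row c′ ≡ suc d ℕ.+ row c → Before c c′
      before-below zero c≡ r≡ = before-adjacent Sign.- (r≡ , c≡)
      -- The next cell down is on or above the main diagonal since `c′`, further down in the same
      -- column, is.
      before-below (suc d) {c} {c′} c≡ r≡ with find {suc (row c)} {col c}
          (ℕ.≤-trans row< (subst (row c′ ℕ.≤_) c≡ (row≤col c′)))
          (ℕ.<-≤-trans (subst (ℕ._< Rν (row c′)) c≡ (inside c′)) (Shape-antitone shapeν row<))
          (ℕ.≤-trans (Shape-antitone shapeμ (ℕ.n≤1+n (row c))) (outside-μ c))
        where
        row< : suc (row c) ℕ.≤ row c′
        row< = subst (suc (row c) ℕ.≤_) (sym r≡) (s≤s (ℕ.m≤n+m (row c) (suc d)))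
      ... | x , xr≡ , xc≡ = before-trans {c} {x} {c′} (before-adjacent Sign.- (xr≡ , xc≡))
            (before-below d (trans c≡ (sym xc≡)) (trans r≡ (trans (sym (ℕ.+-suc (suc d) (row c))) (cong (suc d ℕ.+_) (sym xr≡)))))

      gap : ∀ {i j} → i ℕ.< j → j ≡ suc (j ∸ suc i) ℕ.+ i
      gap {i} {j} lt = trans (sym (ℕ.m∸n+n≡m lt)) (ℕ.+-suc (j ∸ suc i) i)

      -- Move along the row of c, then down the column of `c′`. The turning point is in ν because
      -- its row is not below that of `c′`, and outside μ because its column is not left of that of
      -- c. Going down first could cross the main diagonal.
      before : ∀ {c c′} → c ⋖ c′ → Before c c′
      before {c} {c′} (r≤ , c≤ , ne) with ℕ.m≤n⇒m<n∨m≡n r≤ | ℕ.m≤n⇒m<n∨m≡n c≤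
      ... | inj₂ r≡ | inj₂ c≡ = ⊥-elim (≢⇒ ne (r≡ , c≡))
      ... | inj₂ r≡ | inj₁ c< = before-right (col c′ ∸ suc (col c)) (sym r≡) (gap c<)
      ... | inj₁ r< | inj₂ c≡ = before-below (row c′ ∸ suc (row c)) (sym c≡) (gap r<)
      ... | inj₁ r< | inj₁ c< with find {row c} {col c′} (ℕ.≤-trans (row≤col c) c≤)
              (ℕ.<-≤-trans (inside c′) (Shape-antitone shapeν r≤))
              (ℕ.≤-trans (outside-μ c) c≤)
      ...   | x , xr≡ , xc≡ = before-trans {c} {x} {c′}
              (before-right (col c′ ∸ suc (col c)) {c} {x} xr≡ (trans xc≡ (gap c<)))
              (before-below (row c′ ∸ suc (row c)) {x} {c′} (sym xc≡)
                (trans (gap r<) (cong (suc (row c′ ∸ suc (row c)) ℕ.+_) (sym xr≡))))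

    Follows⇒Valid : Valid (allTimes n N) (erase T)
    Follows⇒Valid = record
      { times = λ c {ℓ} _ → ∈-allTimes (ℓ , diag c)
      ; increasing = λ c → subst (AllPairs _<ʳ_) (sym (lookup-map c toList T)) (sorted c)
      ; closed = λ {_} {c′} _ _ → ≡∷⇒≢[] (lookup-map c′ toList T)
      ; ordered = λ {c} {c′} {ℓ} {ℓ′} lt ℓ∈ ℓ′∈ →
          ≺-within {ℓ} {maxᴱ (lookup T c)} {diag c} {ℓ′ , diag c′}
            (maxᴱ-≥ (sorted c) (subst (ℓ ∈_) (lookup-map c toList T) ℓ∈))
            (within-≺ {minᴱ (lookup T c′)} {ℓ′} {diag c′} {maxᴱ (lookup T c) , diag c}
              (minᴱ-≤ (sorted c′) (subst (ℓ′ ∈_) (lookup-map c′ toList T) ℓ′∈)) (before lt)) }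

  Valid⇒Follows : ∀ {T} → Valid (allTimes n N) (erase T) → Follows T
  Valid⇒Follows {T} v {c} {c′} τ adj = ≺⇒Precedes {k = diag c} {diag c′} {lookup T c} {lookup T c′}
    (proj₂ (adjacent-turn {c} {c′} τ adj))
    (Valid.ordered v (adjacent-⋖ τ adj)
      (subst (maxᴱ (lookup T c) ∈_) (sym (lookup-map c toList T)) (maxᴱ-∈ (lookup T c)))
      (subst (minᴱ (lookup T c′) ∈_) (sym (lookup-map c′ toList T)) (minᴱ-∈ (lookup T c′))))

  ∈-tableaux⁻ : ∀ {S} → S ∈ map erase (tableaux N skew) → Valid (allTimes n N) S × Full S
  ∈-tableaux⁻ S∈ with T , T∈ , refl ← ∈-map⁻ erase S∈
    with T∈v , tab ← ∈-filter⁻ (isTableau? skew) {xs = vectors (entries N) (length skew)} T∈ =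
    Follows⇒Valid {T} (λ c → ∈-entries⁻ (∈-vectors⁻ (entries N) T∈v c)) (λ {c} {c′} → IsTableau⇒Follows {T} tab {c} {c′}) ,
    λ c → ≡∷⇒≢[] (lookup-map c toList T)

  ∈-tableaux⁺ : ∀ {S} → Valid (allTimes n N) S → Full S → S ∈ map erase (tableaux N skew)
  ∈-tableaux⁺ {S} v full with T , refl ← unerase S full = ∈-map⁺ erase (∈-filter⁺ (isTableau? skew)
    (∈-vectors⁺ (entries N) T λ c → ∈-entries⁺ (subst (AllPairs _<ʳ_) (lookup-map c toList T) (Valid.increasing v c)))
    (Follows⇒IsTableau {T} (λ {c} {c′} → Valid⇒Follows {T} v {c} {c′})))

  tableaux-unique : Unique (map erase (tableaux N skew))
  tableaux-unique = Unique.map⁺ erase-injective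
    (Unique.filter⁺ (isTableau? skew) (vectors-unique entries-unique (length skew)))

-- Weights of tableaux

module Weights (n N : ℕ) where

  open HeckeProperties n N
  open Reasoning HeckeRing.setoid

  interchange : ∀ a b c d → (a ⊗ ⟦ b ⟧) ⊗ (⟦ c ⟧ ⊗ d) ≈ (a ⊗ ⟦ c ⟧) ⊗ (⟦ b ⟧ ⊗ d)
  interchange a b c d = begin
    (a ⊗ ⟦ b ⟧) ⊗ (⟦ c ⟧ ⊗ d) ≈⟨ ⊗-assoc _ _ _ ⟩
    a ⊗ (⟦ b ⟧ ⊗ (⟦ c ⟧ ⊗ d)) ≈⟨ ⊗-cong ≈-refl (scalar-left ⟦ b ⟧ c d) ⟩
    a ⊗ (⟦ c ⟧ ⊗ (⟦ b ⟧ ⊗ d)) ≈⟨ ⊗-assoc _ _ _ ⟨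
    (a ⊗ ⟦ c ⟧) ⊗ (⟦ b ⟧ ⊗ d) ∎

  β^ : ℕ → Poly N
  β^ k = ∏ (List.replicate k (gen `β))

  monomial : List ±[ N ] → Poly N
  monomial ls = ∏ (map (λ p → gen (`x (proj₂ p))) ls)

  β^-+ : ∀ j k → ⟦ β^ (j ℕ.+ k) ⟧ ≈ ⟦ β^ j ⟧ ⊗ ⟦ β^ k ⟧
  β^-+ zero    k = ≈-sym (⊗-identityˡ _)
  β^-+ (suc j) k = ≈-trans (⊗-cong ≈-refl (β^-+ j k)) (≈-sym (⊗-assoc _ _ _))

  monomial-++ : ∀ ls ls′ → ⟦ monomial (ls ++ ls′) ⟧ ≈ ⟦ monomial ls ⟧ ⊗ ⟦ monomial ls′ ⟧
  monomial-++ []       ls′ = ≈-sym (⊗-identityˡ _)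
  monomial-++ (ℓ ∷ ls) ls′ = ≈-trans (⊗-cong ≈-refl (monomial-++ ls ls′)) (≈-sym (⊗-assoc _ _ _))

  cell-weight≈ : ∀ ℓ ls → ⟦ cell-weight (ℓ ∷ ls) ⟧ ≈ ⟦ β^ (length ls) ⟧ ⊗ ⟦ monomial (ℓ ∷ ls) ⟧
  cell-weight≈ ℓ []        = ≈-sym (⊗-identityˡ _)
  cell-weight≈ ℓ (ℓ′ ∷ ls) = ≈-trans (⊗-cong ≈-refl (cell-weight≈ ℓ′ ls))
    (interchange _ (variable-of ℓ) (β^ (length ls)) _)

  content-≥ : ∀ {m} (T : Vec (Entry N) m) → m ℕ.≤ length (content T)
  content-≥ []             = z≤n
  content-≥ ((ℓ ∷ ls) ∷ T) = s≤s (ℕ.≤-trans (content-≥ T)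
    (subst (length (content T) ℕ.≤_) (sym (length-++ ls)) (ℕ.m≤n+m _ (length ls))))

  filling-weight≈ : ∀ {m} (T : Vec (Entry N) m) →
    ⟦ filling-weight (erase T) ⟧ ≈ ⟦ β^ (length (content T) ∸ m) ⊗ monomial (content T) ⟧
  filling-weight≈ []             = ≈-sym (⊗-identityˡ _)
  filling-weight≈ {suc m} ((ℓ ∷ ls) ∷ T) = begin
    ⟦ cell-weight (ℓ ∷ ls) ⟧ ⊗ ⟦ filling-weight (erase T) ⟧
      ≈⟨ ⊗-cong (cell-weight≈ ℓ ls) (filling-weight≈ T) ⟩
    (⟦ β^ (length ls) ⟧ ⊗ ⟦ monomial (ℓ ∷ ls) ⟧) ⊗ (⟦ β^ (length (content T) ∸ m) ⟧ ⊗ ⟦ monomial (content T) ⟧)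
      ≈⟨ interchange _ (monomial (ℓ ∷ ls)) (β^ (length (content T) ∸ m)) _ ⟩
    (⟦ β^ (length ls) ⟧ ⊗ ⟦ β^ (length (content T) ∸ m) ⟧) ⊗ (⟦ monomial (ℓ ∷ ls) ⟧ ⊗ ⟦ monomial (content T) ⟧)
      ≈⟨ ⊗-cong (β^-+ (length ls) (length (content T) ∸ m)) (monomial-++ (ℓ ∷ ls) (content T)) ⟨
    ⟦ β^ (length ls ℕ.+ (length (content T) ∸ m)) ⟧ ⊗ ⟦ monomial (ℓ ∷ ls ++ content T) ⟧
      ≈⟨ ⊗-cong (subst (λ e → ⟦ β^ (length ls ℕ.+ (length (content T) ∸ m)) ⟧ ≈ ⟦ β^ e ⟧) exponent ≈-refl) ≈-refl ⟩
    ⟦ β^ (length (ls ++ content T) ∸ m) ⟧ ⊗ ⟦ monomial (ℓ ∷ ls ++ content T) ⟧ ∎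
    where
    -- Truncated subtraction is harmless: entries are nonempty, so the content has at least m
    -- letters.
    exponent : length ls ℕ.+ (length (content T) ∸ m) ≡ length (ls ++ content T) ∸ m
    exponent = trans (sym (ℕ.+-∸-assoc (length ls) (content-≥ T))) (cong (_∸ m) (sym (length-++ ls)))

-- The coefficient

module Coefficient (N : ℕ) {n : ℕ} {Rμ Rν : ℕ → ℕ} (shapeμ : Shape Rμ) (shapeν : Shape Rν)
                   (μ≤ν : ∀ i → Rμ i ℕ.≤ Rν i) (bounded : ∀ i → Rν i ℕ.≤ n) (skew : List Cell)
                   (cells : Cells n (length skew) Rμ Rν)
                   (lookup-skew : ∀ c → List.lookup skew c ≡ (suc (Cells.row cells c) , suc (Cells.col cells c))) where

  open Expansion n N shapeμ shapeν μ≤ν bounded cells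
  open Tableaux N shapeμ shapeν skew cells lookup-skew using (Full; ∈-tableaux⁺; ∈-tableaux⁻; tableaux-unique)
  open Weights n N using (filling-weight≈)
  open Expanded (expanded (allTimes n N) (allTimes-sorted n N))
  open Reasoning HeckeRing.setoid

  private
    w : SignedPerm n
    w = signedPerm word-ν/μ

    Full? : ∀ T → Dec (Full T)
    Full? T = Fin.all? λ c → ¬? (empty? (lookup T c))
      where
      empty? : ∀ (ls : List ±[ N ]) → Dec (ls ≡ [])
      empty? []      = yes refl
      empty? (_ ∷ _) = no λ ()

    -- A cell of R outside μ, or its mirror image, would be a cell of ν/μ without letters.
    Full⇒μ : ∀ g → Full (Good.filling g) → ∀ i → Good.R g i ≡ Rμ i
    Full⇒μ g full i = ℕ.≤-antisym (ℕ.≮⇒≥ no-cell) (lower i)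
      where
      open Good g
      no-cell : ¬ Rμ i ℕ.< R i
      no-cell lt with ℕ.≤-total i (Rμ i)
      ... | inj₁ i≤j with find i≤j (ℕ.<-≤-trans lt (upper i)) ℕ.≤-refl
      ...   | c , r≡ , c≡ = ℕ.<⇒≱ lt (subst₂ (λ a b → R a ℕ.≤ b) r≡ c≡ (Fills.filled fills c (full c)))
      no-cell lt | inj₂ j≤i with find j≤i (ℕ.<-≤-trans (shape lt) (upper (Rμ i))) (outside shapeμ ℕ.≤-refl)
      ...   | c , r≡ , c≡ = ℕ.<⇒≱ (shape lt) (subst₂ (λ a b → R a ℕ.≤ b) r≡ c≡ (Fills.filled fills c (full c)))

    ¬Full⇒≢ : ∀ g → ¬ Full (Good.filling g) → ¬ signedPerm (Good.spelling g) ≗ₛ w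
    ¬Full⇒≢ g ¬full eq = ¬full λ c empty → ℕ.<⇒≱ (Fills.empty fills c empty)
      (subst (ℕ._≤ col c) (sym (Reached⇒μ reached (s-word⇒act spelling word-ν/μ eq) (row c))) (outside-μ c))
      where open Good g

    Rest : Set
    Rest = List (Poly N × Basis n)

    Others : Rest → Set
    Others = All λ (_ , b) → ¬ (element b ≗ₛ w)

    combination-++ : ∀ (xs ys : Rest) → combination (xs ++ ys) ≈ combination xs ⊕ combination ys
    combination-++ []       ys = ≈-sym (⊕-identityˡ _)
    combination-++ (x ∷ xs) ys = ≈-trans (⊕-cong ≈-refl (combination-++ xs ys)) (≈-sym (⊕-assoc _ _ _))

    total : List PreFilling → Hecke n N
    total Ts = ∑ (map (λ T → ⟦ filling-weight T ⟧) Ts)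

    -- Summands with full fillings may reach the element of ν/μ by different words; `Asc⇒∼` makes
    -- their u-words equal, so their weights add up to one coefficient.
    collect : ∀ gs → Σ[ rest ∈ Rest ] Others rest ×
      ∑ (map good-term gs) ≈ total (filter Full? (map Good.filling gs)) ⊗ u-word word-ν/μ ⊕ combination rest
    collect [] = [] , [] , ≈-sym (≈-trans (⊕-identityʳ _) (HeckeRing.zeroˡ _))
    collect (g ∷ gs) with rest , others , eq ← collect gs with Full? (Good.filling g)
    ... | yes full = rest , others , subst (λ Ts → good-term g ⊕ ∑ (map good-term gs) ≈ total Ts ⊗ u-word word-ν/μ ⊕ combination rest)
        (sym (filter-accept Full? full)) (begin
          good-term g ⊕ ∑ (map good-term gs)
            ≈⟨ ⊕-cong (⊗-cong ≈-refl (u≈ same)) eq ⟩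
          ⟦ filling-weight T ⟧ ⊗ u-word word-ν/μ ⊕ (S ⊗ u-word word-ν/μ ⊕ combination rest)
            ≈⟨ ⊕-assoc _ _ _ ⟨
          (⟦ filling-weight T ⟧ ⊗ u-word word-ν/μ ⊕ S ⊗ u-word word-ν/μ) ⊕ combination rest
            ≈⟨ ⊕-cong (distribʳ _ _ _) ≈-refl ⟨
          (⟦ filling-weight T ⟧ ⊕ S) ⊗ u-word word-ν/μ ⊕ combination rest ∎)
      where
      T = Good.filling g
      S = total (filter Full? (map Good.filling gs))
      same : Good.spelling g ∼ word-ν/μ
      same = Asc⇒∼ (Good.spelling g) word-ν/μ (Good.asc g) Asc-ν/μ (μ⇒act (Good.reached g) (Full⇒μ g full))
    ... | no ¬full = (filling-weight T , basis (Good.spelling g) (Good.asc g)) ∷ rest , ¬Full⇒≢ g ¬full ∷ others ,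
        subst (λ Ts → good-term g ⊕ ∑ (map good-term gs) ≈ total Ts ⊗ u-word word-ν/μ ⊕ (good-term g ⊕ combination rest))
        (sym (filter-reject Full? ¬full)) (begin
          good-term g ⊕ ∑ (map good-term gs)
            ≈⟨ ⊕-cong ≈-refl eq ⟩
          good-term g ⊕ (S ⊗ u-word word-ν/μ ⊕ combination rest)
            ≈⟨ ⊕-assoc _ _ _ ⟨
          (good-term g ⊕ S ⊗ u-word word-ν/μ) ⊕ combination rest
            ≈⟨ ⊕-cong (⊕-comm _ _) ≈-refl ⟩
          (S ⊗ u-word word-ν/μ ⊕ good-term g) ⊕ combination rest
            ≈⟨ ⊕-assoc _ _ _ ⟩
          S ⊗ u-word word-ν/μ ⊕ (good-term g ⊕ combination rest) ∎)
      where
      T = Good.filling g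
      S = total (filter Full? (map Good.filling gs))

    discard : ∀ bs → Σ[ rest ∈ Rest ] Others rest × ∑ (map bad-term bs) ≈ combination rest
    discard [] = [] , [] , ≈-refl
    discard (b ∷ bs) with rest , others , eq ← discard bs =
      (BadTerm.coefficient b , basis spelling asc) ∷ rest ,
      (λ e → Bad⇒≢ spelling bad (s-word⇒act spelling word-ν/μ e)) ∷ others ,
      ⊕-cong ≈-refl eq
      where open BadTerm b

    total-↭ : ∀ {Ts Ts′} → Ts ↭ Ts′ → total Ts ≈ total Ts′
    total-↭ ↭.refl         = ≈-refl
    total-↭ (↭.prep T p)   = ⊕-cong ≈-refl (total-↭ p)
    total-↭ (↭.swap T T′ p) = ≈-trans (≈-sym (⊕-assoc _ _ _))
      (≈-trans (⊕-cong (⊕-comm _ _) (total-↭ p)) (⊕-assoc _ _ _))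
    total-↭ (↭.trans p q)  = ≈-trans (total-↭ p) (total-↭ q)

    -- Both lists are free of repetitions and have the same members, hence differ only in order.
    full-goods↭tableaux : filter Full? (map Good.filling goods) ↭ map erase (tableaux N skew)
    full-goods↭tableaux = ∼bag⇒↭ (unique∧set⇒bag (Unique.filter⁺ Full? distinct) tableaux-unique (mk⇔ to from))
      where
      to : ∀ {T} → T ∈ filter Full? (map Good.filling goods) → T ∈ map erase (tableaux N skew)
      to T∈ with T∈goods , full ← ∈-filter⁻ Full? {xs = map Good.filling goods} T∈
        with g , g∈ , refl ← ∈-map⁻ Good.filling T∈goods = ∈-tableaux⁺ (All.lookup valid g∈) full
      from : ∀ {T} → T ∈ map erase (tableaux N skew) → T ∈ filter Full? (map Good.filling goods)
      from T∈ with v , full ← ∈-tableaux⁻ T∈ = ∈-filter⁺ Full? (complete v) full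

    total-tableaux : ∀ (Ts : List (Filling N skew)) → total (map erase Ts) ≈ ⟦ ∑ (map (weight skew) Ts) ⟧
    total-tableaux []       = ≈-refl
    total-tableaux (T ∷ Ts) = ⊕-cong (filling-weight≈ T) (total-tableaux Ts)

  isCoefficient : IsCoefficient (cauchyProduct n N) w (∑ (map (weight skew) (tableaux N skew)))
  isCoefficient with rest , others , eq ← collect goods | rest′ , others′ , eq′ ← discard bads =
    basis word-ν/μ Asc-ν/μ , (λ p → refl) , rest ++ rest′ , All.++⁺ others others′ , (begin
      cauchyProduct n N
        ≈⟨ cauchyProduct≈ n N ⟩
      ∏ (map factorAt (allTimes n N))
        ≈⟨ equation ⟩
      ∑ (map good-term goods) ⊕ ∑ (map bad-term bads)
        ≈⟨ ⊕-cong eq eq′ ⟩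
      (S ⊗ u-word word-ν/μ ⊕ combination rest) ⊕ combination rest′
        ≈⟨ ⊕-assoc _ _ _ ⟩
      S ⊗ u-word word-ν/μ ⊕ (combination rest ⊕ combination rest′)
        ≈⟨ ⊕-cong (⊗-cong (≈-trans (total-↭ full-goods↭tableaux) (total-tableaux (tableaux N skew))) ≈-refl)
             (≈-sym (combination-++ rest rest′)) ⟩
      ⟦ ∑ (map (weight skew) (tableaux N skew)) ⟧ ⊗ u-word word-ν/μ ⊕ combination (rest ++ rest′) ∎)
    where
    S = total (filter Full? (map Good.filling goods))

theorem1p5 : (μ ν : StrictPartition) → μ ⊆ˢ ν →
    Σ[ n ∈ ℕ ] Σ[ w ∈ SignedPerm n ] IsGC w (GQ ν μ)
-- The word comes from `Interval`, which does not involve N, so one w serves all truncations.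
theorem1p5 μ ν μ⊆ν = bound , SignedWords.signedPerm bound word-ν/μ , λ N →
  Coefficient.isCoefficient N (doubledˢ-shape μ) (doubledˢ-shape ν) (doubled-⊆ μ⊆ν) doubled-bounded
    (ν ∖ μ) skew-cells lookup-skew
  where
  open Skew μ ν
  open Interval bound (doubledˢ-shape μ) (doubledˢ-shape ν) (doubled-⊆ μ⊆ν) doubled-bounded using (word-ν/μ)
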